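{- Every $k$-tunnel gadget that is reversible, deterministic, and has interacting tunnels simulates, in planar systems, each of the parallel, antiparallel, and crossing locking 2-toggles.
   Context: A gadget consists of finitely many locations and finitely many states; each state $s$ has a set of transitions $(a,b,s')$ meaning a robot may enter at $a$, exit at $b$, and the state becomes $s'$. The transition graph has an edge $(s,a)\to(s',b)$ for each transition. A $k$-tunnel gadget has $2k$ locations partitioned into $k$ pairs called tunnels, every transition going between the two locations of one tunnel. It has interacting tunnels if some transition across a tunnel from $s$ to $s'$ changes the set of allowed traversal directions of some other tunnel; it is deterministic if the transition graph has out-degree at most 1, and reversible if the reverse of every transition-graph edge is an edge. The locking 2-toggle has tunnels $\{a_1,b_1\},\{a_2,b_2\}$ and states $M,S_1,S_2$: in $M$ the only transitions are $a_1\to b_1$ (to $S_1$) and $a_2\to b_2$ (to $S_2$); in $S_i$ the only transition is $b_i\to a_i$ (to $M$). For planar systems, a gadget's locations carry a cyclic order; the parallel locking 2-toggle has cyclic order $(a_1,b_1,b_2,a_2)$, the antiparallel one $(a_1,b_1,a_2,b_2)$, and the crossing one $(a_1,a_2,b_1,b_2)$. A system of gadgets consists of copies of gadgets, initial states, and a connection graph on locations; the robot moves freely along connection-graph paths and traverses gadgets according to their states. A system is planar if replacing each gadget by a wheel graph (cycle on its locations in cyclic order plus a hub adjacent to each) and adding the connection edges gives a planar graph (gadgets may be rotated and reflected). A gadget $G$ simulates $H$ in planar systems if there is a planar system of copies of $G$ with designated locations, appearing on the outer boundary in the cyclic order of $H$'s locations, playing the roles of $H$'s locations, and with each state of $H$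 corresponding to a configuration of the system, such that from the configuration of any state $q$, a robot entering at designated location $a$ can exit at designated location $b$ leaving the configuration of state $q'$ exactly when $H$ has transition $(a,b,q')$ in state $q$, and no other behavior is possible. -}

module Defs where

open import Data.Bool using (Bool; T; _∧_; _∨_)
open import Data.Nat using (ℕ; zero; suc) renaming (_*_ to _*ℕ_)
open import Data.Fin using (Fin; toℕ; _≟_) renaming (zero to f0; suc to fs)
open import Data.Vec using (Vec; lookup; _[_]≔_)
open import Data.Product using (Σ; _×_; _,_; ∃)
open import Data.Sum using (_⊎_)
open import Data.Rational using (ℚ; _+_; _*_; _-_; _≤_; 0ℚ; 1ℚ)
open import Relation.Nullary using (¬_; does)
open import Relation.Binary.PropositionalEquality using (_≡_; _≢_)
open import Relation.Binary.Construct.Closure.ReflexiveTransitive using (Star)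

-- Gadgets.  Locations are Fin nLoc; for planar purposes the cyclic
-- order of the locations is 0, 1, ..., nLoc-1 (the index order).
-- States are Fin nState.  trans s a b s' = true  iff  (a , b , s') is a
-- transition of state s.

record Gadget : Set where
  field
    nLoc   : ℕ
    nState : ℕ
    trans  : Fin nState → Fin nLoc → Fin nLoc → Fin nState → Bool
open Gadget public

Trans : (G : Gadget) → Fin (nState G) → Fin (nLoc G) → Fin (nLoc G) → Fin (nState G) → Set
Trans G s a b s' = T (trans G s a b s')

record KTunnel (G : Gadget) (k : ℕ) : Set where
  field
    size       : nLoc G ≡ 2 *ℕ k
    partner    : Fin (nLoc G) → Fin (nLoc G)
    involutive : ∀ a → partner (partner a) ≡ a
    noFixed    : ∀ a → partner a ≢ a
    inTunnel   : ∀ s a b s' → Trans G s a b s' → b ≡ partner a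
open KTunnel public

Allowed : (G : Gadget) → Fin (nState G) → Fin (nLoc G) → Fin (nLoc G) → Set
Allowed G s c d = ∃ λ s'' → Trans G s c d s''

-- some transition across a tunnel (from a to b, state s to s') changes
-- the set of allowed traversal directions of some other tunnel
-- (the tunnel containing c, c ∉ {a , b}; direction c → partner c, and
-- since c ranges over both ends, both directions are covered).
InteractingTunnels : (G : Gadget) {k : ℕ} → KTunnel G k → Set
InteractingTunnels G t =
  Σ (Fin (nState G)) λ s → Σ (Fin (nLoc G)) λ a → Σ (Fin (nLoc G)) λ b →
  Σ (Fin (nState G)) λ s' → Trans G s a b s' ×
  Σ (Fin (nLoc G)) λ c → c ≢ a × c ≢ b ×
    ((Allowed G s c (partner t c) × ¬ Allowed G s' c (partner t c))
     ⊎ (¬ Allowed G s c (partner t c) × Allowed G s' c (partner t c)))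

Deterministic : Gadget → Set
Deterministic G = ∀ s a b s' b₂ s₂ → Trans G s a b s' → Trans G s a b₂ s₂ →
  b ≡ b₂ × s' ≡ s₂

Reversible : Gadget → Set
Reversible G = ∀ s a b s' → Trans G s a b s' → Trans G s' b a s

-- Locking 2-toggles.  States: M = 0, S₁ = 1, S₂ = 2.  The arguments give
-- the positions (in the cyclic order 0,1,2,3) of a₁ , b₁ , a₂ , b₂.

_==_ : ∀ {n} → Fin n → Fin n → Bool
x == y = does (x ≟ y)

stM stS₁ stS₂ : Fin 3
stM = f0
stS₁ = fs f0
stS₂ = fs (fs f0)

locking2Toggle : (a₁ b₁ a₂ b₂ : Fin 4) → Gadget
locking2Toggle a₁ b₁ a₂ b₂ = record { nLoc = 4 ; nState = 3 ; trans = tr }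
  where
  tr : Fin 3 → Fin 4 → Fin 4 → Fin 3 → Bool
  tr f0 a b s' = (a == a₁ ∧ b == b₁ ∧ s' == stS₁) ∨ (a == a₂ ∧ b == b₂ ∧ s' == stS₂)
  tr (fs f0) a b s' = a == b₁ ∧ b == a₁ ∧ s' == stM
  tr (fs (fs f0)) a b s' = a == b₂ ∧ b == a₂ ∧ s' == stM

l0 l1 l2 l3 : Fin 4
l0 = f0
l1 = fs f0
l2 = fs (fs f0)
l3 = fs (fs (fs f0))

-- cyclic order (a₁ , b₁ , b₂ , a₂)
parallelLocking2Toggle : Gadget
parallelLocking2Toggle = locking2Toggle l0 l1 l3 l2

-- cyclic order (a₁ , b₁ , a₂ , b₂)
antiparallelLocking2Toggle : Gadget
antiparallelLocking2Toggle = locking2Toggle l0 l1 l2 l3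

-- cyclic order (a₁ , a₂ , b₁ , b₂)
crossingLocking2Toggle : Gadget
crossingLocking2Toggle = locking2Toggle l0 l2 l1 l3

-- Planarity of a (finite) graph, via straight-line drawings with
-- rational coordinates (equivalent to planarity by Fáry's theorem).

Pt : Set
Pt = ℚ × ℚ

along : Pt → Pt → ℚ → Pt
along (ux , uy) (vx , vy) t = (ux + t * (vx - ux)) , (uy + t * (vy - uy))

Unit : ℚ → Set
Unit t = 0ℚ ≤ t × t ≤ 1ℚ

OnSegment : Pt → Pt → Pt → Set
OnSegment w u v = Σ ℚ λ t → Unit t × w ≡ along u v t

SegmentsMeet : Pt → Pt → Pt → Pt → Set
SegmentsMeet u v x y = Σ ℚ λ s → Σ ℚ λ t → Unit s × Unit t × along u v s ≡ along x y t

Planar : (V : Set) → (V → V → Set) → Set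
Planar V E = Σ (V → Pt) λ pos →
  (∀ u v → pos u ≡ pos v → u ≡ v) ×
  (∀ u v w → E u v → w ≢ u → w ≢ v → ¬ OnSegment (pos w) (pos u) (pos v)) ×
  (∀ u v x y → E u v → E x y → u ≢ x → u ≢ y → v ≢ x → v ≢ y →
     ¬ SegmentsMeet (pos u) (pos v) (pos x) (pos y))

RimAdj : ∀ {n} → Fin n → Fin n → Set
RimAdj {n} j j' = toℕ j' ≡ suc (toℕ j) ⊎ (suc (toℕ j) ≡ n × toℕ j' ≡ 0)

record System (G : Gadget) : Set where
  field
    copies : ℕ
    conn   : Fin copies × Fin (nLoc G) → Fin copies × Fin (nLoc G) → Bool
open System public

Loc : {G : Gadget} → System G → Set
Loc {G} S = Fin (copies S) × Fin (nLoc G)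

Config : {G : Gadget} → System G → Set
Config {G} S = Vec (Fin (nState G)) (copies S)

data Step {G : Gadget} (S : System G) : Loc S × Config S → Loc S × Config S → Set where
  walk     : ∀ p q C → T (conn S p q) → Step S (p , C) (q , C)
  walkBack : ∀ p q C → T (conn S q p) → Step S (p , C) (q , C)
  traverse : ∀ i a b s' C → Trans G (lookup C i) a b s' →
             Step S ((i , a) , C) ((i , b) , (C [ i ]≔ s'))

Reach : {G : Gadget} (S : System G) → Loc S × Config S → Loc S × Config S → Set
Reach S = Star (Step S)

-- vertices of the planarity graph: locations, one wheel hub per copy,
-- and the hub of the outer wheel of the simulated gadget.
data Vtx (m n : ℕ) : Set where
  loc   : Fin m × Fin n → Vtx m n
  hub   : Fin m → Vtx m n
  outer : Vtx m n

-- each copy replaced by its wheel, plus connection edges, plus the wheel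
-- of the simulated gadget H on the designated locations d (in H's cyclic
-- order), placed outside; planarity of this graph expresses that the
-- system is planar with the designated locations on its outer boundary
-- in the cyclic order of H.
data SimEdge {G : Gadget} (S : System G) (nH : ℕ) (d : Fin nH → Loc S)
     : Vtx (copies S) (nLoc G) → Vtx (copies S) (nLoc G) → Set where
  rim        : ∀ i j j' → RimAdj j j' → SimEdge S nH d (loc (i , j)) (loc (i , j'))
  spoke      : ∀ i j → SimEdge S nH d (loc (i , j)) (hub i)
  connection : ∀ p q → T (conn S p q) → SimEdge S nH d (loc p) (loc q)
  outerRim   : ∀ x y → RimAdj x y → SimEdge S nH d (loc (d x)) (loc (d y))
  outerSpoke : ∀ x → SimEdge S nH d (loc (d x)) outer

PlanarSimulates : Gadget → Gadget → Set
PlanarSimulates G H =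
  Σ (System G) λ S →
  Σ (Fin (nLoc H) → Loc S) λ d →
  Σ (Fin (nState H) → Config S) λ cfg →
    (∀ x y → d x ≡ d y → x ≡ y) ×
    Planar (Vtx (copies S) (nLoc G)) (SimEdge S (nLoc H) d) ×
    (∀ q a b q' → Trans H q a b q' → Reach S (d a , cfg q) (d b , cfg q')) ×
    (∀ q a b C → Reach S (d a , cfg q) (d b , C) →
       (a ≡ b × C ≡ cfg q) ⊎ (Σ (Fin (nState H)) λ q' → Trans H q a b q' × C ≡ cfg q'))

{-# OPTIONS --safe #-}
module Submission where

-- Every direction of a tunnel acts on the states as a partial injection, inverted by the other direction.
-- Interaction yields states σ, σ' and tunnels a, c such that a leads from σ to σ', c is open in σ, leading to τ,
-- and c is closed in σ'. Take two copies in state σ and let one tunnel run through c of the first and a of the second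
-- copy, the other one through a of the first and c of the second: using either closes the other. With
-- 1-toggles around them these tunnels form a locking 2-toggle.
--
-- A 1-toggle consists of a passage that cannot be repeated in one copy, and the reverse passage in a second copy.
-- If in σ' the tunnel of c is open from its other end c', then c leads into σ', where it is closed: such a passage.
-- Otherwise take the passage through c' and then a, from τ over σ to σ'; it can be wired in the plane unless
-- a and c are antiparallel. In that case follow a from σ' on: either it ends, and its last step cannot be repeated, or
-- c opens again before the states return to σ; reversing a there makes the tunnels parallel.
--
-- Two crossing toggles make a parallel one, two antiparallel ones a crossing one, and four parallel ones an
-- antiparallel one. So finitely many systems suffice. Only what is known about σ, σ', τ matters for their
-- behaviour, which is checked by exhaustive search. Planarity is checked on an integer drawing, by finding for any
-- two wheels or connections a line that separates them up to common vertices; the unused locations of a copy are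
-- spread inside the triangles formed by its hub and consecutive used locations.

open import Defs
open import Data.Bool using (Bool; true; false; T; _∧_; _∨_; not; if_then_else_)
open import Data.Bool.ListAction using (any)
open import Data.Bool.Properties using (T?)
open import Data.Empty using (⊥; ⊥-elim)
open import Data.Fin using (Fin; toℕ; _≟_; #_; combine) renaming (suc to fs)
open import Data.Fin.Patterns using (0F; 1F; 2F; 3F)
import Data.Fin.Properties as FinP
open import Data.Integer as ℤ using (ℤ; +_; -[1+_]; 1ℤ)
import Data.Integer.Properties as ℤP
import Data.Integer.Solver as ℤSolver
open import Data.List using (List; []; _∷_; _++_; map; concatMap; length; lookup; allFin)
open import Data.List.Membership.Propositional using (_∈_)
open import Data.List.Membership.Propositional.Properties using (∈-lookup; ∈-++⁺ˡ; ∈-++⁺ʳ; ∈-++⁻; ∈-map⁺; ∈-allFin)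
open import Data.List.Relation.Unary.All as All using (All; []; _∷_)
import Data.List.Relation.Unary.All.Properties as AllP
open import Data.List.Relation.Unary.Any as Any using (here; there)
open import Data.List.Relation.Unary.Any.Properties using (lookup-index)
open import Data.Nat as ℕ using (ℕ; zero; suc; _+_; _∸_; _≤_; _<_; z≤n; s≤s)
import Data.Nat.Coprimality as Coprime
import Data.Nat.Properties as ℕP
open import Data.Product using (Σ; _×_; _,_; ∃; proj₁; proj₂)
open import Data.Rational as ℚ using (ℚ; 0ℚ; 1ℚ; ½; mkℚ)
import Data.Rational.Properties as ℚP
open import Data.Rational.Solver using (module +-*-Solver)
import Data.Rational.Unnormalised as ℚᵘ
import Data.Rational.Unnormalised.Properties as ℚᵘP
open import Data.Sum using (_⊎_; inj₁; inj₂; [_,_]′)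
open import Data.Unit using (⊤; tt)
open import Data.Vec as Vec using (Vec; []; _∷_; _[_]≔_)
import Data.Vec.Properties as VecP
open import Relation.Binary.Construct.Closure.ReflexiveTransitive using (ε; _◅_; _◅◅_)
open import Relation.Binary.Definitions using (tri<; tri≈; tri>)
open import Relation.Binary.PropositionalEquality renaming (trans to ≡-trans)
open import Relation.Nullary using (¬_; yes; no; does)

-- Affine functions and segments

-- Very little is known about the gadget: three states, the passages of a and c between them with
-- their reversals, and one closed entrance. The other entrances differ from gadget to gadget, so a
-- system has to keep the robot away from them. This is the task of the 1-toggles: they force each
-- simulated tunnel to be used alternately in its two directions, so that inside it the robot comes
-- only to entrances about which something is known. The search can then work with names of states
-- instead of states, and one finite check holds for all gadgets.
--
-- A 1-toggle made of two passages needs a connection from c to a beside the copy. In the cyclic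
-- order a, a', c, c' this connection and the copy together separate a' from c', the two ends
-- through which the toggle is entered and left. In the two other orders a and c are neighbours on
-- the rim, and the connection can run next to it. Hence only the antiparallel case has to follow a
-- through further states.

record Affine : Set where
  constructor affine
  field cx cy c₀ : ℚ

neg : Affine → Affine
neg (affine a b c) = affine (ℚ.- a) (ℚ.- b) (ℚ.- c)

blend : ℚ → Affine → ℚ → Affine → Affine
blend s (affine a b c) t (affine a' b' c') =
  affine (s ℚ.* a ℚ.+ t ℚ.* a') (s ℚ.* b ℚ.+ t ℚ.* b') (s ℚ.* c ℚ.+ t ℚ.* c')

mix : ℚ → ℚ → ℚ → ℚ
mix t a b = a ℚ.+ t ℚ.* (b ℚ.- a)

opaque
  ev : Affine → Pt → ℚ
  ev (affine a b c) (x , y) = a ℚ.* x ℚ.+ b ℚ.* y ℚ.+ c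

  ev-neg : ∀ f p → ev (neg f) p ≡ ℚ.- ev f p
  ev-neg (affine a b c) (x , y) =
    solve 5 (λ a b c x y → (:- a) :* x :+ (:- b) :* y :+ (:- c) := :- (a :* x :+ b :* y :+ c))
      refl a b c x y
    where open +-*-Solver

  ev-blend : ∀ s f t g p → ev (blend s f t g) p ≡ s ℚ.* ev f p ℚ.+ t ℚ.* ev g p
  ev-blend s (affine a b c) t (affine a' b' c') (x , y) =
    solve 10 (λ s a b c t a' b' c' x y →
        (s :* a :+ t :* a') :* x :+ (s :* b :+ t :* b') :* y :+ (s :* c :+ t :* c')
        := s :* (a :* x :+ b :* y :+ c) :+ t :* (a' :* x :+ b' :* y :+ c'))
      refl s a b c t a' b' c' x y
    where open +-*-Solver

  ev-along : ∀ f u v t → ev f (along u v t) ≡ mix t (ev f u) (ev f v)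
  ev-along (affine a b c) (ux , uy) (vx , vy) t =
    solve 8 (λ a b c ux uy vx vy t →
        a :* (ux :+ t :* (vx :- ux)) :+ b :* (uy :+ t :* (vy :- uy)) :+ c
        := (a :* ux :+ b :* uy :+ c) :+
           t :* ((a :* vx :+ b :* vy :+ c) :- (a :* ux :+ b :* uy :+ c)))
      refl a b c ux uy vx vy t
    where open +-*-Solver

along-0 : ∀ u v → along u v 0ℚ ≡ u
along-0 (ux , uy) (vx , vy) = cong₂ _,_ (lem ux vx) (lem uy vy)
  where
  open +-*-Solver
  lem : ∀ a b → mix 0ℚ a b ≡ a
  lem = solve 2 (λ a b → a :+ con 0ℚ :* (b :- a) := a) refl

along-1 : ∀ u v → along u v 1ℚ ≡ v
along-1 (ux , uy) (vx , vy) = cong₂ _,_ (lem ux vx) (lem uy vy)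
  where
  open +-*-Solver
  lem : ∀ a b → mix 1ℚ a b ≡ b
  lem = solve 2 (λ a b → a :+ con 1ℚ :* (b :- a) := b) refl

mix-convex : ∀ t a b → mix t a b ≡ (1ℚ ℚ.- t) ℚ.* a ℚ.+ t ℚ.* b
mix-convex = solve 3 (λ t a b → a :+ t :* (b :- a) := (con 1ℚ :- t) :* a :+ t :* b) refl
  where open +-*-Solver

*-pos : ∀ {a b} → 0ℚ ℚ.< a → 0ℚ ℚ.< b → 0ℚ ℚ.< a ℚ.* b
*-pos {a} {b} 0<a 0<b =
  subst (ℚ._< a ℚ.* b) (ℚP.*-zeroʳ a) (ℚP.*-monoʳ-<-pos a {{ℚ.positive 0<a}} 0<b)

*-nonNeg : ∀ {a b} → 0ℚ ℚ.≤ a → 0ℚ ℚ.≤ b → 0ℚ ℚ.≤ a ℚ.* b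
*-nonNeg {a} {b} 0≤a 0≤b =
  subst (ℚ._≤ a ℚ.* b) (ℚP.*-zeroʳ a) (ℚP.*-monoˡ-≤-nonNeg a {{ℚ.nonNegative 0≤a}} 0≤b)

+-pos-nonNeg : ∀ {a b} → 0ℚ ℚ.< a → 0ℚ ℚ.≤ b → 0ℚ ℚ.< a ℚ.+ b
+-pos-nonNeg = ℚP.+-mono-<-≤ {0ℚ}

+-nonNeg-pos : ∀ {a b} → 0ℚ ℚ.≤ a → 0ℚ ℚ.< b → 0ℚ ℚ.< a ℚ.+ b
+-nonNeg-pos = ℚP.+-mono-≤-< {0ℚ}

+-nonNeg : ∀ {a b} → 0ℚ ℚ.≤ a → 0ℚ ℚ.≤ b → 0ℚ ℚ.≤ a ℚ.+ b
+-nonNeg = ℚP.+-mono-≤ {0ℚ}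

<⇒0<- : ∀ {a b} → a ℚ.< b → 0ℚ ℚ.< b ℚ.- a
<⇒0<- {a} {b} a<b = subst (ℚ._< b ℚ.- a) (ℚP.+-inverseʳ a) (ℚP.+-monoˡ-< (ℚ.- a) a<b)

≤⇒0≤- : ∀ {a b} → a ℚ.≤ b → 0ℚ ℚ.≤ b ℚ.- a
≤⇒0≤- {a} {b} a≤b = subst (ℚ._≤ b ℚ.- a) (ℚP.+-inverseʳ a) (ℚP.+-monoˡ-≤ (ℚ.- a) a≤b)

0<-⇒< : ∀ {a b} → 0ℚ ℚ.< b ℚ.- a → a ℚ.< b
0<-⇒< {a} {b} h = subst₂ ℚ._<_ (ℚP.+-identityˡ a) (lem b a) (ℚP.+-monoˡ-< a h)
  where
  open +-*-Solver
  lem : ∀ b a → b ℚ.- a ℚ.+ a ≡ b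
  lem = solve 2 (λ b a → b :- a :+ a := b) refl

mix-nonNeg : ∀ {t a b} → Unit t → 0ℚ ℚ.≤ a → 0ℚ ℚ.≤ b → 0ℚ ℚ.≤ mix t a b
mix-nonNeg {t} {a} {b} (0≤t , t≤1) 0≤a 0≤b =
  subst (0ℚ ℚ.≤_) (sym (mix-convex t a b)) (+-nonNeg (*-nonNeg (≤⇒0≤- t≤1) 0≤a) (*-nonNeg 0≤t 0≤b))

≤⇒<∨≡ : ∀ {a b} → a ℚ.≤ b → a ℚ.< b ⊎ a ≡ b
≤⇒<∨≡ {a} {b} a≤b with ℚP.<-cmp a b
... | tri< p _ _ = inj₁ p
... | tri≈ _ p _ = inj₂ p
... | tri> _ _ p = ⊥-elim (ℚP.<-irrefl refl (ℚP.<-≤-trans p a≤b))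

mix-pos-or-0 : ∀ {t a b} → Unit t → 0ℚ ℚ.≤ a → 0ℚ ℚ.< b → 0ℚ ℚ.< mix t a b ⊎ t ≡ 0ℚ
mix-pos-or-0 {t} {a} {b} (0≤t , t≤1) 0≤a 0<b with ≤⇒<∨≡ 0≤t
... | inj₂ 0≡t = inj₂ (sym 0≡t)
... | inj₁ 0<t = inj₁ (subst (0ℚ ℚ.<_) (sym (mix-convex t a b))
                   (+-nonNeg-pos (*-nonNeg (≤⇒0≤- t≤1) 0≤a) (*-pos 0<t 0<b)))

mix-pos-or-1 : ∀ {t a b} → Unit t → 0ℚ ℚ.< a → 0ℚ ℚ.≤ b → 0ℚ ℚ.< mix t a b ⊎ t ≡ 1ℚ
mix-pos-or-1 {t} {a} {b} (0≤t , t≤1) 0<a 0≤b with ≤⇒<∨≡ t≤1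
... | inj₂ t≡1 = inj₂ t≡1
... | inj₁ t<1 = inj₁ (subst (0ℚ ℚ.<_) (sym (mix-convex t a b))
                   (+-pos-nonNeg (*-pos (<⇒0<- t<1) 0<a) (*-nonNeg 0≤t 0≤b)))

mix-pos : ∀ {t a b} → Unit t → 0ℚ ℚ.< a → 0ℚ ℚ.< b → 0ℚ ℚ.< mix t a b
mix-pos {t} {a} {b} tu 0<a 0<b with mix-pos-or-0 tu (ℚP.<⇒≤ 0<a) 0<b
... | inj₁ p = p
... | inj₂ refl = subst (0ℚ ℚ.<_) (sym (lem a b)) 0<a
  where
  open +-*-Solver
  lem : ∀ a b → mix 0ℚ a b ≡ a
  lem = solve 2 (λ a b → a :+ con 0ℚ :* (b :- a) := a) refl

neg-neg : ∀ a → ℚ.- (ℚ.- a) ≡ a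
neg-neg = solve 1 (λ a → :- (:- a) := a) refl
  where open +-*-Solver

nonNeg∧neg-nonNeg : ∀ {a} → 0ℚ ℚ.≤ a → 0ℚ ℚ.≤ ℚ.- a → a ≡ 0ℚ
nonNeg∧neg-nonNeg {a} p q = ℚP.≤-antisym (subst (ℚ._≤ 0ℚ) (neg-neg a) (ℚP.neg-antimono-≤ q)) p

pos≢0 : ∀ {a} → 0ℚ ℚ.< a → a ≢ 0ℚ
pos≢0 p refl = ℚP.<-irrefl refl p

pos∧neg-nonNeg : ∀ {a} → 0ℚ ℚ.< a → ¬ (0ℚ ℚ.≤ ℚ.- a)
pos∧neg-nonNeg p q = pos≢0 p (nonNeg∧neg-nonNeg (ℚP.<⇒≤ p) q)

-- Gluing straight-line drawings along separating lines

module Drawing {V : Set} (pos : V → Pt) where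

  record PlanarOn (I : V → Set) (E : V → V → Set) : Set where
    field
      endpoints : ∀ {u v} → E u v → I u × I v
      loopless  : ∀ {u v} → E u v → u ≢ v
      injective : ∀ {u v} → I u → I v → pos u ≡ pos v → u ≡ v
      avoids    : ∀ {u v w} → E u v → I w → w ≢ u → w ≢ v → ¬ OnSegment (pos w) (pos u) (pos v)
      disjoint  : ∀ {u v x y} → E u v → E x y → u ≢ x → u ≢ y → v ≢ x → v ≢ y →
                  ¬ SegmentsMeet (pos u) (pos v) (pos x) (pos y)
  open PlanarOn public

  data Side (f : Affine) (z₁ z₂ : V) (J : V → Set) (v : V) : Set where
    inside : 0ℚ ℚ.< ev f (pos v) → Side f z₁ z₂ J v
    onLine : ev f (pos v) ≡ 0ℚ → v ≡ z₁ ⊎ v ≡ z₂ → J v → Side f z₁ z₂ J v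

  -- The line f = 0 separates I from J and meets them at most in two common vertices.
  record Separated (I J : V → Set) : Set where
    field
      {f g}    : Affine
      {z₁ z₂}  : V
      opposite : ∀ p → ev g p ≡ ℚ.- ev f p
      left     : ∀ {v} → I v → Side f z₁ z₂ J v
      right    : ∀ {v} → J v → Side g z₁ z₂ I v

  Separated-sym : ∀ {I J} → Separated I J → Separated J I
  Separated-sym s = record
    { opposite = λ p → ≡-trans (sym (neg-neg _)) (cong ℚ.-_ (sym (S.opposite p)))
    ; left = S.right ; right = S.left }
    where module S = Separated s

  side≥0 : ∀ {f z₁ z₂ J v} → Side f z₁ z₂ J v → 0ℚ ℚ.≤ ev f (pos v)
  side≥0 (inside p) = ℚP.<⇒≤ p
  side≥0 (onLine p _ _) = ℚP.≤-reflexive (sym p)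

  private
    edge≥0 : ∀ {f u v t} → 0ℚ ℚ.≤ ev f u → 0ℚ ℚ.≤ ev f v → Unit t → 0ℚ ℚ.≤ ev f (along u v t)
    edge≥0 {f} {u} {v} {t} p q r = subst (0ℚ ℚ.≤_) (sym (ev-along f u v t)) (mix-nonNeg r p q)

    edge>0 : ∀ {f u v t} → 0ℚ ℚ.< ev f u → 0ℚ ℚ.< ev f v → Unit t → 0ℚ ℚ.< ev f (along u v t)
    edge>0 {f} {u} {v} {t} p q r = subst (0ℚ ℚ.<_) (sym (ev-along f u v t)) (mix-pos r p q)

  module _ {f g : Affine} (opposite : ∀ p → ev g p ≡ ℚ.- ev f p) where

    segments-apart : ∀ {u v x y} → 0ℚ ℚ.≤ ev g u → 0ℚ ℚ.≤ ev g v → 0ℚ ℚ.< ev f x → 0ℚ ℚ.< ev f y →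
                     ¬ SegmentsMeet u v x y
    segments-apart {u} {v} {x} {y} gu gv fx fy (s , t , s∈ , t∈ , e) =
      pos∧neg-nonNeg (edge>0 {f} {x} {y} fx fy t∈)
        (subst (0ℚ ℚ.≤_) (≡-trans (cong (ev g) e) (opposite _)) (edge≥0 {g} {u} {v} gu gv s∈))

    point-apart : ∀ {w x y} → 0ℚ ℚ.≤ ev g w → 0ℚ ℚ.< ev f x → 0ℚ ℚ.< ev f y → ¬ OnSegment w x y
    point-apart {w} gw fx fy (t , t∈ , e) =
      segments-apart gw gw fx fy (0ℚ , t , (ℚP.≤-refl , ℚP.<⇒≤ (ℚP.positive⁻¹ 1ℚ)) , t∈ , ≡-trans (along-0 w w) e)

    point-apart′ : ∀ {w x y} → 0ℚ ℚ.< ev f w → 0ℚ ℚ.≤ ev g x → 0ℚ ℚ.≤ ev g y → ¬ OnSegment w x y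
    point-apart′ {w} fw gx gy (t , t∈ , e) =
      segments-apart gx gy fw fw (t , 0ℚ , t∈ , (ℚP.≤-refl , ℚP.<⇒≤ (ℚP.positive⁻¹ 1ℚ)) , ≡-trans (sym e) (sym (along-0 w w)))

  private
    -- Where a segment can touch the line bounding its half-plane.
    touch : ∀ {f z₁ z₂ J u v t} → Side f z₁ z₂ J u → Side f z₁ z₂ J v → Unit t →
            ev f (along (pos u) (pos v) t) ≡ 0ℚ →
            ((u ≡ z₁ ⊎ u ≡ z₂) × J u × along (pos u) (pos v) t ≡ pos u) ⊎
            ((v ≡ z₁ ⊎ v ≡ z₂) × J v × along (pos u) (pos v) t ≡ pos v) ⊎
            ((u ≡ z₁ ⊎ u ≡ z₂) × (v ≡ z₁ ⊎ v ≡ z₂) × J u × J v)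
    touch {f} {u = u} {v} (inside p) (inside q) t∈ e = ⊥-elim (pos≢0 (edge>0 {f} {pos u} {pos v} p q t∈) e)
    touch {f} {u = u} {v} {t} (inside p) (onLine q z j) t∈ e
      with mix-pos-or-1 t∈ p (ℚP.≤-reflexive (sym q))
    ... | inj₁ r = ⊥-elim (pos≢0 (subst (0ℚ ℚ.<_) (sym (ev-along f (pos u) (pos v) t)) r) e)
    ... | inj₂ refl = inj₂ (inj₁ (z , j , along-1 (pos u) (pos v)))
    touch {f} {u = u} {v} {t} (onLine q z j) (inside p) t∈ e
      with mix-pos-or-0 t∈ (ℚP.≤-reflexive (sym q)) p
    ... | inj₁ r = ⊥-elim (pos≢0 (subst (0ℚ ℚ.<_) (sym (ev-along f (pos u) (pos v) t)) r) e)
    ... | inj₂ refl = inj₁ (z , j , along-0 (pos u) (pos v))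
    touch (onLine _ z j) (onLine _ z' j') t∈ e = inj₂ (inj₂ (z , z' , j , j'))

    -- This is why a separating line may carry only two common vertices: an edge lying in the line
    -- has both of them as its ends, and an edge of the other side that touches the line then has
    -- one of them as an end too, so the two edges are not disjoint in the graph.
    at-most-two : ∀ {z₁ z₂ u v w : V} → (u ≡ z₁ ⊎ u ≡ z₂) → (v ≡ z₁ ⊎ v ≡ z₂) → (w ≡ z₁ ⊎ w ≡ z₂) →
                  u ≢ v → u ≢ w → v ≢ w → ⊥
    at-most-two (inj₁ refl) (inj₁ refl) _ a b c = a refl
    at-most-two (inj₁ refl) (inj₂ refl) (inj₁ refl) a b c = b refl
    at-most-two (inj₁ refl) (inj₂ refl) (inj₂ refl) a b c = c refl
    at-most-two (inj₂ refl) (inj₂ refl) _ a b c = a refl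
    at-most-two (inj₂ refl) (inj₁ refl) (inj₁ refl) a b c = c refl
    at-most-two (inj₂ refl) (inj₁ refl) (inj₂ refl) a b c = b refl

  module _ {I J : V → Set} {E F : V → V → Set} (s : Separated I J)
           (planarI : PlanarOn I E) (planarJ : PlanarOn J F) where
    private
      open Separated s
      module A = PlanarOn planarI
      module B = PlanarOn planarJ

    injective-apart : ∀ {u v} → I u → J v → pos u ≡ pos v → u ≡ v
    injective-apart {u} {v} iu jv e with left iu
    ... | onLine _ _ ju = B.injective ju jv e
    ... | inside p = ⊥-elim (pos∧neg-nonNeg p
            (subst (0ℚ ℚ.≤_) (≡-trans (cong (ev g) (sym e)) (opposite _)) (side≥0 (right jv))))

    avoids-apart : ∀ {w u v} → I w → F u v → w ≢ u → w ≢ v → ¬ OnSegment (pos w) (pos u) (pos v)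
    avoids-apart {w} {u} {v} iw fuv w≢u w≢v with left iw
    ... | onLine _ _ jw = B.avoids fuv jw w≢u w≢v
    ... | inside p = point-apart′ {f} {g} opposite p
            (side≥0 (right (proj₁ (B.endpoints fuv)))) (side≥0 (right (proj₂ (B.endpoints fuv))))

    disjoint-apart : ∀ {u v x y} → E u v → F x y → u ≢ x → u ≢ y → v ≢ x → v ≢ y →
                     ¬ SegmentsMeet (pos u) (pos v) (pos x) (pos y)
    disjoint-apart {u} {v} {x} {y} euv fxy ux uy vx vy (a , b , a∈ , b∈ , e) =
      conclude (touch {f} su sv a∈ fz≡0) (touch {g} sx sy b∈ gz≡0)
      where
      iu = proj₁ (A.endpoints euv)
      iv = proj₂ (A.endpoints euv)
      jx = proj₁ (B.endpoints fxy)
      jy = proj₂ (B.endpoints fxy)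
      su = left iu
      sv = left iv
      sx = right jx
      sy = right jy
      -- A common point lies in both closed half-planes, hence on the line.
      fz≡0 : ev f (along (pos u) (pos v) a) ≡ 0ℚ
      fz≡0 = nonNeg∧neg-nonNeg (edge≥0 {f} {pos u} {pos v} (side≥0 su) (side≥0 sv) a∈)
        (subst (0ℚ ℚ.≤_) (≡-trans (cong (ev g) (sym e)) (opposite _))
          (edge≥0 {g} {pos x} {pos y} (side≥0 sx) (side≥0 sy) b∈))
      gz≡0 : ev g (along (pos x) (pos y) b) ≡ 0ℚ
      gz≡0 = ≡-trans (opposite _) (cong ℚ.-_ (≡-trans (cong (ev f) (sym e)) fz≡0))
      conclude : _ → _ → ⊥
      conclude (inj₁ (zu , ju , p)) (inj₁ (_ , ix , q)) = ux (A.injective iu ix (≡-trans (sym p) (≡-trans e q)))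
      conclude (inj₁ (zu , ju , p)) (inj₂ (inj₁ (_ , iy , q))) = uy (A.injective iu iy (≡-trans (sym p) (≡-trans e q)))
      conclude (inj₂ (inj₁ (zu , ju , p))) (inj₁ (_ , ix , q)) = vx (A.injective iv ix (≡-trans (sym p) (≡-trans e q)))
      conclude (inj₂ (inj₁ (zu , ju , p))) (inj₂ (inj₁ (_ , iy , q))) = vy (A.injective iv iy (≡-trans (sym p) (≡-trans e q)))
      conclude (inj₁ (zu , _)) (inj₂ (inj₂ (zx , zy , _))) = at-most-two zu zx zy ux uy (B.loopless fxy)
      conclude (inj₂ (inj₁ (zv , _))) (inj₂ (inj₂ (zx , zy , _))) = at-most-two zv zx zy vx vy (B.loopless fxy)
      conclude (inj₂ (inj₂ (zu , zv , _))) (inj₁ (zx , _)) = at-most-two zu zv zx (A.loopless euv) ux vx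
      conclude (inj₂ (inj₂ (zu , zv , _))) (inj₂ (inj₁ (zy , _))) = at-most-two zu zv zy (A.loopless euv) uy vy
      conclude (inj₂ (inj₂ (zu , zv , _))) (inj₂ (inj₂ (zx , _))) = at-most-two zu zv zx (A.loopless euv) ux vx

  -- Each condition of planarity involves at most two cells, so separating the cells in pairs is
  -- enough.
  glue : {Cell : Set} {I : Cell → V → Set} {E : Cell → V → V → Set} →
         (∀ c → PlanarOn (I c) (E c)) → (∀ c d → c ≡ d ⊎ Separated (I c) (I d)) →
         PlanarOn (λ v → ∃ λ c → I c v) (λ u v → ∃ λ c → E c u v)
  glue {Cell} {I} {E} planar separated = record
    { endpoints = λ { (c , e) → (c , proj₁ (endpoints (planar c) e)) , (c , proj₂ (endpoints (planar c) e)) }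
    ; loopless = λ { (c , e) → loopless (planar c) e }
    ; injective = inj
    ; avoids = avoid
    ; disjoint = dis
    }
    where
    inj : ∀ {u v} → ∃ (λ c → I c u) → ∃ (λ c → I c v) → pos u ≡ pos v → u ≡ v
    inj (c , i) (d , j) with separated c d
    ... | inj₁ refl = injective (planar c) i j
    ... | inj₂ s = injective-apart s (planar c) (planar d) i j
    avoid : ∀ {u v w} → ∃ (λ c → E c u v) → ∃ (λ c → I c w) → w ≢ u → w ≢ v → ¬ OnSegment (pos w) (pos u) (pos v)
    avoid (c , e) (d , i) with separated d c
    ... | inj₁ refl = avoids (planar c) e i
    ... | inj₂ s = avoids-apart s (planar d) (planar c) i e
    dis : ∀ {u v x y} → ∃ (λ c → E c u v) → ∃ (λ c → E c x y) → u ≢ x → u ≢ y → v ≢ x → v ≢ y →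
          ¬ SegmentsMeet (pos u) (pos v) (pos x) (pos y)
    dis (c , e) (d , e') with separated c d
    ... | inj₁ refl = disjoint (planar c) e e'
    ... | inj₂ s = disjoint-apart s (planar c) (planar d) e e'

  mono : ∀ {I E I' E'} → (∀ {v} → I' v → I v) → (∀ {u v} → E' u v → E u v) →
         (∀ {u v} → E' u v → I' u × I' v) → PlanarOn I E → PlanarOn I' E'
  mono I⊆ E⊆ ends p = record
    { endpoints = ends
    ; loopless = λ e → loopless p (E⊆ e)
    ; injective = λ i j → injective p (I⊆ i) (I⊆ j)
    ; avoids = λ e i → avoids p (E⊆ e) (I⊆ i)
    ; disjoint = λ e e' → disjoint p (E⊆ e) (E⊆ e')
    }

  planar-on-all : ∀ {I E E'} → PlanarOn I E → (∀ v → I v) → (∀ u v → E' u v → E u v) → Planar V E'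
  planar-on-all p all E⊆ = pos , (λ u v → injective p (all u) (all v))
    , (λ u v w e → avoids p (E⊆ u v e) (all w))
    , (λ u v x y e e' → disjoint p (E⊆ u v e) (E⊆ x y e'))

-- Cyclic orders of locations

module CyclicOrders where

  Next : ℕ → ℕ → ℕ → Set
  Next n r r' = r' ≡ suc r ⊎ (suc r ≡ n × r' ≡ 0)

  -- `rank-cycle` admits both senses of rotation because a copy may be drawn reflected. Rankings can
  -- therefore be rotated and reflected at will.
  record Ranking (n : ℕ) : Set where
    field
      rank       : Fin n → ℕ
      rank<      : ∀ j → rank j < n
      rank-inj   : ∀ {j j'} → rank j ≡ rank j' → j ≡ j'
      rank-cycle : ∀ j j' → RimAdj j j' → Next n (rank j) (rank j') ⊎ Next n (rank j') (rank j)
  open Ranking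

  identityRanking : ∀ {n} → Ranking n
  identityRanking = record
    { rank = toℕ ; rank< = FinP.toℕ<n ; rank-inj = FinP.toℕ-injective ; rank-cycle = λ _ _ → inj₁ }

  shift : ℕ → ℕ → ℕ → ℕ
  shift n m r with m ℕ.≤? r
  ... | yes _ = r ∸ m
  ... | no  _ = r + (n ∸ m)

  shift-≥ : ∀ {n m r} → m ≤ r → shift n m r ≡ r ∸ m
  shift-≥ {n} {m} {r} m≤r with m ℕ.≤? r
  ... | yes _ = refl
  ... | no ¬p = ⊥-elim (¬p m≤r)

  shift-< : ∀ {n m r} → r < m → shift n m r ≡ r + (n ∸ m)
  shift-< {n} {m} {r} r<m with m ℕ.≤? r
  ... | yes p = ⊥-elim (ℕP.<⇒≱ r<m p)
  ... | no _ = refl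

  shift-bound : ∀ {n m r} → m < n → r < n → shift n m r < n
  shift-bound {n} {m} {r} m<n r<n with m ℕ.≤? r
  ... | yes _ = ℕP.≤-<-trans (ℕP.m∸n≤m r m) r<n
  ... | no ¬p = subst (r + (n ∸ m) <_) (ℕP.m+[n∸m]≡n (ℕP.<⇒≤ m<n)) (ℕP.+-monoˡ-< (n ∸ m) (ℕP.≰⇒> ¬p))

  private
    shift-mixed : ∀ {n m r r'} → m < n → m ≤ r → r < n → r ∸ m ≢ r' + (n ∸ m)
    shift-mixed {n} {m} {r} {r'} m<n m≤r r<n e =
      ℕP.<-irrefl e (ℕP.<-≤-trans (ℕP.∸-monoˡ-< r<n m≤r) (ℕP.m≤n+m (n ∸ m) r'))

  shift-injective : ∀ {n m r r'} → m < n → r < n → r' < n → shift n m r ≡ shift n m r' → r ≡ r'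
  shift-injective {n} {m} {r} {r'} m<n r<n r'<n e with m ℕ.≤? r | m ℕ.≤? r'
  ... | yes p | yes q = ℕP.∸-cancelʳ-≡ p q e
  ... | no  _ | no  _ = ℕP.+-cancelʳ-≡ (n ∸ m) r r' e
  ... | yes p | no  _ = ⊥-elim (shift-mixed m<n p r<n e)
  ... | no  _ | yes q = ⊥-elim (shift-mixed m<n q r'<n (sym e))

  shift-Next : ∀ {n m r r'} → m < n → r < n → r' < n → Next n r r' → Next n (shift n m r) (shift n m r')
  shift-Next {n} {m} {r} m<n r<n r'<n (inj₁ refl) with ℕP.<-cmp m (suc r)
  ... | tri< (s≤s m≤r) _ _ = inj₁ (≡-trans (shift-≥ {n} (ℕP.m≤n⇒m≤1+n m≤r))
          (≡-trans (ℕP.+-∸-assoc 1 m≤r) (cong suc (sym (shift-≥ {n} m≤r)))))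
  ... | tri≈ _ refl _ = inj₂ (≡-trans (cong suc (shift-< {n} {suc r} {r} ℕP.≤-refl)) (ℕP.m+[n∸m]≡n (ℕP.<⇒≤ m<n))
          , ≡-trans (shift-≥ {n} {suc r} ℕP.≤-refl) (ℕP.n∸n≡0 r))
  ... | tri> _ _ r+1<m = inj₁ (≡-trans (shift-< {n} r+1<m) (cong suc (sym (shift-< {n} (ℕP.<⇒≤ r+1<m)))))
  shift-Next {n} {zero} {r} m<n r<n r'<n (inj₂ (refl , refl)) = inj₂ (refl , refl)
  shift-Next {n} {suc m} {r} (s≤s m<r) r<n r'<n (inj₂ (refl , refl)) =
    inj₁ (sym (≡-trans (cong suc (shift-≥ {suc r} m<r)) (sym (ℕP.+-∸-assoc 1 m<r))))

  shiftRanking : ∀ {n} m → m < n → Ranking n → Ranking n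
  shiftRanking {n} m m<n R = record
    { rank = λ j → shift n m (rank R j)
    ; rank< = λ j → shift-bound {n} {m} m<n (rank< R j)
    ; rank-inj = λ {j} {j'} e → rank-inj R (shift-injective m<n (rank< R j) (rank< R j') e)
    ; rank-cycle = λ j j' a → [ (λ x → inj₁ (shift-Next m<n (rank< R j) (rank< R j') x))
                              , (λ x → inj₂ (shift-Next m<n (rank< R j') (rank< R j) x)) ]′ (rank-cycle R j j' a)
    }

  -- Negation modulo `n`. It fixes 0, so a reflected `Quad` keeps its first location.
  reflect : ℕ → ℕ → ℕ
  reflect n zero    = zero
  reflect n (suc r) = n ∸ suc r

  reflect-bound : ∀ {n r} → r < n → reflect n r < n
  reflect-bound {n} {zero} p = p
  reflect-bound {suc n} {suc r} p = s≤s (ℕP.m∸n≤m n r)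

  reflect-injective : ∀ {n r r'} → r < n → r' < n → reflect n r ≡ reflect n r' → r ≡ r'
  reflect-injective {n} {zero} {zero} p q e = refl
  reflect-injective {n} {zero} {suc r'} p q e = ⊥-elim (ℕP.<-irrefl e (ℕP.m<n⇒0<n∸m q))
  reflect-injective {n} {suc r} {zero} p q e = ⊥-elim (ℕP.<-irrefl (sym e) (ℕP.m<n⇒0<n∸m p))
  reflect-injective {n} {suc r} {suc r'} p q e = ℕP.∸-cancelˡ-≡ (ℕP.<⇒≤ p) (ℕP.<⇒≤ q) e

  reflect-Next : ∀ {n r r'} → r < n → r' < n → Next n r r' → Next n (reflect n r') (reflect n r)
  reflect-Next {suc n} {zero} p q (inj₁ refl) = inj₂ (refl , refl)
  reflect-Next {n} {suc r} p q (inj₁ refl) = inj₁ (≡-trans (cong (_∸ suc r) (sym (ℕP.m+[n∸m]≡n {1} {n} (ℕP.≤-trans (s≤s z≤n) p)))) (lem n r q))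
    where
    lem : ∀ n r → suc (suc r) < n → suc (n ∸ 1) ∸ suc r ≡ suc (n ∸ suc (suc r))
    lem (suc n) r (s≤s x) = ℕP.+-∸-assoc 1 {n} {suc r} (ℕP.<⇒≤ x)
  reflect-Next {n} {zero} p q (inj₂ (refl , refl)) = inj₂ (refl , refl)
  reflect-Next {n} {suc r} p q (inj₂ (refl , refl)) = inj₁ (ℕP.m+n∸n≡m 1 (suc r))

  reflectRanking : ∀ {n} → Ranking n → Ranking n
  reflectRanking {n} R = record
    { rank = λ j → reflect n (rank R j)
    ; rank< = λ j → reflect-bound (rank< R j)
    ; rank-inj = λ {j} {j'} e → rank-inj R (reflect-injective (rank< R j) (rank< R j') e)
    ; rank-cycle = λ j j' a → [ (λ x → inj₂ (reflect-Next (rank< R j) (rank< R j') x))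
                              , (λ x → inj₁ (reflect-Next (rank< R j') (rank< R j) x)) ]′ (rank-cycle R j j' a)
    }

  -- Four locations met in this order around the gadget, in one of the two senses of rotation.
  record Quad {n : ℕ} (w x y z : Fin n) : Set where
    field
      ranking : Ranking n
    at : Fin n → ℕ
    at = rank ranking
    field
      first : at w ≡ 0
      w<x   : at w < at x
      x<y   : at x < at y
      y<z   : at y < at z
  open Quad

  rotate : ∀ {n} {w x y z : Fin n} → Quad w x y z → Quad x y z w
  rotate {n} {w} {x} {y} {z} q = record
    { ranking = shiftRanking m (rank< (ranking q) x) (ranking q)
    ; first = ≡-trans (shift-≥ {n} {m} ℕP.≤-refl) (ℕP.n∸n≡0 m)
    ; w<x = subst₂ _<_ (sym (shift-≥ {n} {m} ℕP.≤-refl)) (sym (shift-≥ {n} (ℕP.<⇒≤ (x<y q)))) (ℕP.∸-monoˡ-< (x<y q) ℕP.≤-refl)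
    ; x<y = subst₂ _<_ (sym (shift-≥ {n} (ℕP.<⇒≤ (x<y q)))) (sym (shift-≥ {n} m≤z)) (ℕP.∸-monoˡ-< (y<z q) (ℕP.<⇒≤ (x<y q)))
    ; y<z = subst₂ _<_ (sym (shift-≥ {n} m≤z)) (sym (≡-trans (shift-< {n} (w<x q)) (cong (_+ (n ∸ m)) (first q))))
              (ℕP.∸-monoˡ-< (rank< (ranking q) z) m≤z)
    }
    where
    m = at q x
    m≤z = ℕP.<⇒≤ (ℕP.<-trans (x<y q) (y<z q))

  reverse : ∀ {n} {w x y z : Fin n} → Quad w x y z → Quad w z y x
  reverse {n} {w} {x} {y} {z} q = record
    { ranking = reflectRanking (ranking q)
    ; first = cong (reflect n) (first q)
    ; w<x = subst (_< reflect n (at q z)) (sym (cong (reflect n) (first q))) (subst (0 <_) (sym (reflect-pos 0<z)) (ℕP.m<n⇒0<n∸m (rank< (ranking q) z)))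
    ; x<y = subst₂ _<_ (sym (reflect-pos 0<z)) (sym (reflect-pos 0<y)) (ℕP.∸-monoʳ-< (y<z q) (ℕP.<⇒≤ (rank< (ranking q) z)))
    ; y<z = subst₂ _<_ (sym (reflect-pos 0<y)) (sym (reflect-pos 0<x)) (ℕP.∸-monoʳ-< (x<y q) (ℕP.<⇒≤ (rank< (ranking q) y)))
    }
    where
    reflect-pos : ∀ {r} → 0 < r → reflect n r ≡ n ∸ r
    reflect-pos {suc r} _ = refl
    0<x = ℕP.≤-<-trans z≤n (w<x q)
    0<y = ℕP.<-trans 0<x (x<y q)
    0<z = ℕP.<-trans 0<y (y<z q)

  data CyclicOrder {n : ℕ} (a a' c c' : Fin n) : Set where
    parallel     : Quad a a' c' c → CyclicOrder a a' c c'
    antiparallel : Quad a a' c c' → CyclicOrder a a' c c'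
    crossing     : Quad a c a' c' → CyclicOrder a a' c c'

  -- With `a` at rank 0 the type depends only on how the other three ranks are ordered. The six
  -- orders form three pairs, exchanged by reflection; the two remaining combinations of comparisons
  -- violate transitivity.
  cyclicOrder : ∀ {n} (a a' c c' : Fin n) → a ≢ a' → a ≢ c → a ≢ c' → a' ≢ c → a' ≢ c' → c ≢ c' →
                CyclicOrder a a' c c'
  cyclicOrder {n} a a' c c' aa' ac ac' a'c a'c' cc' = sort
    where
    R : Ranking n
    R = shiftRanking (toℕ a) (FinP.toℕ<n a) identityRanking
    a≡0 : rank R a ≡ 0
    a≡0 = ≡-trans (shift-≥ {n} {toℕ a} ℕP.≤-refl) (ℕP.n∸n≡0 (toℕ a))
    above : ∀ {x} → a ≢ x → rank R a < rank R x
    above {x} a≢x = subst (_< rank R x) (sym a≡0)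
      (ℕP.n≢0⇒n>0 (λ e → a≢x (rank-inj R (≡-trans a≡0 (sym e)))))
    quad : ∀ {x y z} → a ≢ x → rank R x < rank R y → rank R y < rank R z → Quad a x y z
    quad p q r = record { ranking = R ; first = a≡0 ; w<x = above p ; x<y = q ; y<z = r }
    cmp : ∀ {x y} → x ≢ y → rank R x < rank R y ⊎ rank R y < rank R x
    cmp {x} {y} x≢y with ℕP.<-cmp (rank R x) (rank R y)
    ... | tri< p _ _ = inj₁ p
    ... | tri≈ _ p _ = ⊥-elim (x≢y (rank-inj R p))
    ... | tri> _ _ p = inj₂ p
    sort : CyclicOrder a a' c c'
    sort with cmp a'c | cmp a'c' | cmp cc'
    ... | inj₁ p | inj₁ q | inj₁ r = antiparallel (quad aa' p r)
    ... | inj₁ p | inj₁ q | inj₂ r = parallel (quad aa' q r)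
    ... | inj₁ p | inj₂ q | inj₁ r = ⊥-elim (ℕP.<-asym p (ℕP.<-trans r q))
    ... | inj₁ p | inj₂ q | inj₂ r = crossing (reverse (quad ac' q p))
    ... | inj₂ p | inj₁ q | inj₁ r = crossing (quad ac p q)
    ... | inj₂ p | inj₁ q | inj₂ r = ⊥-elim (ℕP.<-asym q (ℕP.<-trans r p))
    ... | inj₂ p | inj₂ q | inj₁ r = parallel (reverse (quad ac r q))
    ... | inj₂ p | inj₂ q | inj₂ r = antiparallel (reverse (quad ac' r p))

open CyclicOrders using (Next; Ranking; Quad; rotate; reverse; CyclicOrder; parallel; antiparallel; crossing; cyclicOrder)

-- The wheel of a gadget with four distinguished locations

0<½ : 0ℚ ℚ.< ½
0<½ = ℚP.positive⁻¹ ½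

0<1 : 0ℚ ℚ.< 1ℚ
0<1 = ℚP.positive⁻¹ 1ℚ

-- An increasing sequence in [0, 1), used to spread the unused locations along the rim.
slot : ℕ → ℚ
slot zero    = 0ℚ
slot (suc r) = mix ½ (slot r) 1ℚ

private
  slot-gap : ∀ t → 1ℚ ℚ.- mix ½ t 1ℚ ≡ ½ ℚ.* (1ℚ ℚ.- t)
  slot-gap = solve 1 (λ t → con 1ℚ :- (t :+ con ½ :* (con 1ℚ :- t)) := con ½ :* (con 1ℚ :- t)) refl
    where open +-*-Solver
  slot-step : ∀ t → mix ½ t 1ℚ ℚ.- t ≡ ½ ℚ.* (1ℚ ℚ.- t)
  slot-step = solve 1 (λ t → (t :+ con ½ :* (con 1ℚ :- t)) :- t := con ½ :* (con 1ℚ :- t)) refl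
    where open +-*-Solver

slot<1 : ∀ r → slot r ℚ.< 1ℚ
slot<1 zero    = 0<1
slot<1 (suc r) = 0<-⇒< (subst (0ℚ ℚ.<_) (sym (slot-gap (slot r))) (*-pos 0<½ (<⇒0<- (slot<1 r))))

slot-suc : ∀ r → slot r ℚ.< slot (suc r)
slot-suc r = 0<-⇒< (subst (0ℚ ℚ.<_) (sym (slot-step (slot r))) (*-pos 0<½ (<⇒0<- (slot<1 r))))

slot-mono : ∀ {r r'} → r ℕ.< r' → slot r ℚ.< slot r'
slot-mono {r} {suc r'} (s≤s r≤r') with ℕP.m≤n⇒m<n∨m≡n r≤r'
... | inj₁ r<r' = ℚP.<-trans (slot-mono r<r') (slot-suc r')
... | inj₂ refl = slot-suc r

0<slot : ∀ {r r'} → r ℕ.< r' → 0ℚ ℚ.< slot r'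
0<slot {r} r<r' = slot-mono {0} (ℕP.≤-<-trans z≤n r<r')

mix-open : ∀ {t a b} → 0ℚ ℚ.< t → t ℚ.< 1ℚ → 0ℚ ℚ.≤ a → 0ℚ ℚ.≤ b → 0ℚ ℚ.< a ⊎ 0ℚ ℚ.< b → 0ℚ ℚ.< mix t a b
mix-open {t} {a} {b} 0<t t<1 0≤a 0≤b (inj₁ 0<a) with mix-pos-or-1 (ℚP.<⇒≤ 0<t , ℚP.<⇒≤ t<1) 0<a 0≤b
... | inj₁ p = p
... | inj₂ refl = ⊥-elim (ℚP.<-irrefl refl t<1)
mix-open {t} {a} {b} 0<t t<1 0≤a 0≤b (inj₂ 0<b) with mix-pos-or-0 (ℚP.<⇒≤ 0<t , ℚP.<⇒≤ t<1) 0≤a 0<b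
... | inj₁ p = p
... | inj₂ refl = ⊥-elim (ℚP.<-irrefl refl 0<t)

½<1 : ½ ℚ.< 1ℚ
½<1 = 0<-⇒< 0<½

next : Fin 4 → Fin 4
next 0F = fs 0F
next 1F = fs 1F
next 2F = fs 2F
next 3F = 0F

-- A quadrilateral around a hub, given by the lines through the hub and its corners
-- and by lines separating opposite triangles.
record StarQuad (H : Pt) (P : Fin 4 → Pt) : Set where
  field
    ray side       : Fin 4 → Affine
    ray-hub        : ∀ g → ev (ray g) H ≡ 0ℚ
    ray-corner     : ∀ g → ev (ray g) (P (next g)) ≡ 0ℚ
    ray-before     : ∀ g → 0ℚ ℚ.< ev (ray g) (P g)
    ray-after      : ∀ g → 0ℚ ℚ.< ev (neg (ray g)) (P (next (next g)))
    side-hub       : ∀ g → ev (side g) H ≡ 0ℚ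
    side-near      : ∀ g → 0ℚ ℚ.< ev (side g) (P g) × 0ℚ ℚ.< ev (side g) (P (next g))
    side-far       : ∀ g → 0ℚ ℚ.< ev (neg (side g)) (P (next (next g))) ×
                           0ℚ ℚ.< ev (neg (side g)) (P (next (next (next g))))

-- Locations between two consecutive corners are drawn inside the triangle
-- spanned by these corners and the hub.
inner : Pt → Pt → Pt → ℕ → Pt
inner H P Q r = along H (along P Q (slot r)) ½

ev-inner : ∀ f H P Q r → ev f (inner H P Q r) ≡ mix ½ (ev f H) (mix (slot r) (ev f P) (ev f Q))
ev-inner f H P Q r = ≡-trans (ev-along f H (along P Q (slot r)) ½) (cong (mix ½ (ev f H)) (ev-along f P Q (slot r)))

-- All three vertices have positive weight: `slot r'` vanishes only at rank 0, which the smaller `r`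
-- excludes. An inner location lies above the lower end of its gap, so its rank can serve directly
-- as index of the slot.
inner-pos : ∀ f {H P Q r r'} → r ℕ.< r' → 0ℚ ℚ.≤ ev f H → 0ℚ ℚ.≤ ev f P → 0ℚ ℚ.≤ ev f Q →
            0ℚ ℚ.< ev f H ⊎ (0ℚ ℚ.< ev f P ⊎ 0ℚ ℚ.< ev f Q) → 0ℚ ℚ.< ev f (inner H P Q r')
inner-pos f {H} {P} {Q} {r} {r'} r<r' h p q s = subst (0ℚ ℚ.<_) (sym (ev-inner f H P Q r'))
  (mix-open 0<½ ½<1 h (mix-nonNeg (ℚP.<⇒≤ 0<t , ℚP.<⇒≤ (slot<1 r')) p q)
    ([ inj₁ , (λ pq → inj₂ (mix-open 0<t (slot<1 r') p q pq)) ]′ s))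
  where 0<t = 0<slot r<r'

module Wheel {n : ℕ} {w x y z : Fin n} (quad : Quad w x y z) where
  open Quad quad
  open Ranking ranking using (rank<; rank-inj; rank-cycle)

  corner : Fin 4 → Fin n
  corner 0F = w
  corner 1F = x
  corner 2F = y
  corner 3F = z

  lo hi : Fin 4 → ℕ
  lo g = at (corner g)
  hi 0F = at x
  hi 1F = at y
  hi 2F = at z
  hi 3F = n

  lo<hi : ∀ g → lo g ℕ.< hi g
  lo<hi 0F = w<x
  lo<hi 1F = x<y
  lo<hi 2F = y<z
  lo<hi 3F = rank< z

  gap : ℕ → Fin 4
  gap r with r ℕ.<? at x | r ℕ.<? at y | r ℕ.<? at z
  ... | yes _ | _     | _     = 0F
  ... | no _  | yes _ | _     = fs 0F
  ... | no _  | no _  | yes _ = fs 1F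
  ... | no _  | no _  | no _  = fs 2F

  gap-bounds : ∀ {r} → r ℕ.< n → lo (gap r) ℕ.≤ r × r ℕ.< hi (gap r)
  gap-bounds {r} r<n with r ℕ.<? at x | r ℕ.<? at y | r ℕ.<? at z
  ... | yes p | _     | _     = subst (ℕ._≤ r) (sym first) z≤n , p
  ... | no p  | yes q | _     = ℕP.≮⇒≥ p , q
  ... | no _  | no p  | yes q = ℕP.≮⇒≥ p , q
  ... | no _  | no _  | no p  = ℕP.≮⇒≥ p , r<n

  gap-unique : ∀ g {r} → lo g ℕ.≤ r → r ℕ.< hi g → gap r ≡ g
  gap-unique g {r} l h with r ℕ.<? at x | r ℕ.<? at y | r ℕ.<? at z
  gap-unique 0F l h | yes p | _ | _ = refl
  gap-unique 1F l h | yes p | _ | _ = ⊥-elim (ℕP.<⇒≱ p l)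
  gap-unique 2F l h | yes p | _ | _ = ⊥-elim (ℕP.<⇒≱ (ℕP.<-trans p x<y) l)
  gap-unique 3F l h | yes p | _ | _ = ⊥-elim (ℕP.<⇒≱ (ℕP.<-trans p (ℕP.<-trans x<y y<z)) l)
  gap-unique 0F l h | no p | yes q | _ = ⊥-elim (p h)
  gap-unique 1F l h | no p | yes q | _ = refl
  gap-unique 2F l h | no p | yes q | _ = ⊥-elim (ℕP.<⇒≱ q l)
  gap-unique 3F l h | no p | yes q | _ = ⊥-elim (ℕP.<⇒≱ (ℕP.<-trans q y<z) l)
  gap-unique 0F l h | no p | no q | yes s = ⊥-elim (p h)
  gap-unique 1F l h | no p | no q | yes s = ⊥-elim (q h)
  gap-unique 2F l h | no p | no q | yes s = refl
  gap-unique 3F l h | no p | no q | yes s = ⊥-elim (ℕP.<⇒≱ s l)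
  gap-unique 0F l h | no p | no q | no s = ⊥-elim (p h)
  gap-unique 1F l h | no p | no q | no s = ⊥-elim (q h)
  gap-unique 2F l h | no p | no q | no s = ⊥-elim (s h)
  gap-unique 3F l h | no p | no q | no s = refl

  module _ (H : Pt) (P : Fin 4 → Pt) where

    keyPoint : Fin 4 → ℕ → Pt
    keyPoint g r with r ℕ.≟ lo g | r ℕ.≟ hi g
    ... | yes _ | _     = P g
    ... | no _  | yes _ = P (next g)
    ... | no _  | no _  = inner H (P g) (P (next g)) r

    locPoint : Fin n → Pt
    locPoint j = keyPoint (gap (at j)) (at j)

    keyPoint-lo : ∀ g → keyPoint g (lo g) ≡ P g
    keyPoint-lo g with lo g ℕ.≟ lo g
    ... | yes _ = refl
    ... | no p = ⊥-elim (p refl)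

    keyPoint-hi : ∀ g → keyPoint g (hi g) ≡ P (next g)
    keyPoint-hi g with hi g ℕ.≟ lo g | hi g ℕ.≟ hi g
    ... | yes p | _ = ⊥-elim (ℕP.<-irrefl (sym p) (lo<hi g))
    ... | no _ | yes _ = refl
    ... | no _ | no p = ⊥-elim (p refl)

    keyPoint-mid : ∀ g {r} → lo g ℕ.< r → r ℕ.< hi g → keyPoint g r ≡ inner H (P g) (P (next g)) r
    keyPoint-mid g {r} l h with r ℕ.≟ lo g | r ℕ.≟ hi g
    ... | yes p | _ = ⊥-elim (ℕP.<-irrefl (sym p) l)
    ... | no _ | yes p = ⊥-elim (ℕP.<-irrefl p h)
    ... | no _ | no _ = refl

    data KeyView (g : Fin 4) (r : ℕ) : Set where
      low  : r ≡ lo g → KeyView g r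
      mid  : lo g ℕ.< r → r ℕ.< hi g → KeyView g r
      high : r ≡ hi g → KeyView g r

    keyView : ∀ g {r} → lo g ℕ.≤ r → r ℕ.≤ hi g → KeyView g r
    keyView g l h with ℕP.m≤n⇒m<n∨m≡n l | ℕP.m≤n⇒m<n∨m≡n h
    ... | inj₂ p | _ = low (sym p)
    ... | inj₁ _ | inj₂ p = high p
    ... | inj₁ p | inj₁ q = mid p q

    -- The location of rank 0 closes the last gap and there has the second key n.
    Key : Fin n → ℕ → Set
    Key j r = r ≡ at j ⊎ (r ≡ n × at j ≡ 0)

    Key-injective : ∀ {j j' r} → Key j r → Key j' r → j ≡ j'
    Key-injective (inj₁ p) (inj₁ q) = rank-inj (≡-trans (sym p) q)
    Key-injective {j} (inj₁ p) (inj₂ (q , _)) = ⊥-elim (ℕP.<-irrefl (≡-trans (sym p) q) (rank< j))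
    Key-injective {j' = j'} (inj₂ (p , _)) (inj₁ q) = ⊥-elim (ℕP.<-irrefl (≡-trans (sym q) p) (rank< j'))
    Key-injective (inj₂ (_ , p)) (inj₂ (_ , q)) = rank-inj (≡-trans p (sym q))

    -- A corner closes one gap and opens the next one, and both formulas give the same point. A
    -- location at a shared end may therefore be read in either gap.
    keyPoint-loc : ∀ g {j r} → Key j r → lo g ℕ.≤ r → r ℕ.≤ hi g → locPoint j ≡ keyPoint g r
    keyPoint-loc g {j} (inj₁ refl) l h with ℕP.m≤n⇒m<n∨m≡n h
    ... | inj₁ r<hi = cong (λ g → keyPoint g (at j)) (gap-unique g l r<hi)
    keyPoint-loc g {j} (inj₁ refl) l h | inj₂ r≡hi = upper g r≡hi
      where
      shared : ∀ g → at j ≡ lo (next g) → at j ≡ hi g → locPoint j ≡ keyPoint g (at j)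
      shared g e e' = ≡-trans (cong (λ g → keyPoint g (at j))
            (gap-unique (next g) (ℕP.≤-reflexive (sym e)) (subst (ℕ._< hi (next g)) (sym e) (lo<hi (next g)))))
        (≡-trans (≡-trans (cong (keyPoint (next g)) e) (keyPoint-lo (next g)))
          (sym (≡-trans (cong (keyPoint g) e') (keyPoint-hi g))))
      upper : ∀ g → at j ≡ hi g → locPoint j ≡ keyPoint g (at j)
      upper 0F e = shared 0F e e
      upper 1F e = shared 1F e e
      upper 2F e = shared 2F e e
      upper 3F e = ⊥-elim (ℕP.<-irrefl e (rank< j))
    keyPoint-loc 0F (inj₂ (refl , _)) l h = ⊥-elim (ℕP.<⇒≱ (rank< x) h)
    keyPoint-loc 1F (inj₂ (refl , _)) l h = ⊥-elim (ℕP.<⇒≱ (rank< y) h)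
    keyPoint-loc 2F (inj₂ (refl , _)) l h = ⊥-elim (ℕP.<⇒≱ (rank< z) h)
    keyPoint-loc 3F {j} (inj₂ (refl , e)) l h =
      ≡-trans (cong₂ keyPoint (≡-trans (cong gap e) (gap-unique 0F (ℕP.≤-reflexive first) (ℕP.≤-<-trans z≤n w<x))) e)
        (≡-trans (≡-trans (cong (keyPoint 0F) (sym first)) (keyPoint-lo 0F)) (sym (keyPoint-hi 3F)))

    locPoint-corner : ∀ g → locPoint (corner g) ≡ P g
    locPoint-corner g = ≡-trans (keyPoint-loc g (inj₁ refl) ℕP.≤-refl (ℕP.<⇒≤ (lo<hi g))) (keyPoint-lo g)

private
  cross-mid : ∀ s t → mix ½ 0ℚ (mix s 1ℚ 0ℚ) ℚ.* mix ½ 0ℚ (mix t 0ℚ 1ℚ) ℚ.+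
                      ℚ.- mix ½ 0ℚ (mix s 0ℚ 1ℚ) ℚ.* mix ½ 0ℚ (mix t 1ℚ 0ℚ) ≡ ½ ℚ.* (½ ℚ.* (t ℚ.- s))
  cross-mid = solve 2 (λ s t →
    let m : ∀ {n} → Polynomial n → Polynomial n → Polynomial n → Polynomial n
        m t a b = a :+ t :* (b :- a) in
    m (con ½) (con 0ℚ) (m s (con 1ℚ) (con 0ℚ)) :* m (con ½) (con 0ℚ) (m t (con 0ℚ) (con 1ℚ)) :+
    (:- m (con ½) (con 0ℚ) (m s (con 0ℚ) (con 1ℚ))) :* m (con ½) (con 0ℚ) (m t (con 1ℚ) (con 0ℚ))
    := con ½ :* (con ½ :* (t :- s))) refl
    where open +-*-Solver
  cross-lo : ∀ a b → 1ℚ ℚ.* b ℚ.+ ℚ.- 0ℚ ℚ.* a ≡ b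
  cross-lo = solve 2 (λ a b → con 1ℚ :* b :+ (:- con 0ℚ) :* a := b) refl
    where open +-*-Solver
  cross-hi : ∀ a b → a ℚ.* 1ℚ ℚ.+ ℚ.- b ℚ.* 0ℚ ≡ a
  cross-hi = solve 2 (λ a b → a :* con 1ℚ :+ (:- b) :* con 0ℚ := a) refl
    where open +-*-Solver
  cross-self : ∀ a b → a ℚ.* b ℚ.+ ℚ.- b ℚ.* a ≡ 0ℚ
  cross-self = solve 2 (λ a b → a :* b :+ (:- b) :* a := con 0ℚ) refl
    where open +-*-Solver
  cross-swap : ∀ a b c d → ℚ.- (a ℚ.* d ℚ.+ ℚ.- b ℚ.* c) ≡ c ℚ.* b ℚ.+ ℚ.- d ℚ.* a
  cross-swap = solve 4 (λ a b c d → :- (a :* d :+ (:- b) :* c) := c :* b :+ (:- d) :* a) refl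
    where open +-*-Solver
  blend-00 : ∀ a b → a ℚ.* 0ℚ ℚ.+ b ℚ.* 0ℚ ≡ 0ℚ
  blend-00 = solve 2 (λ a b → a :* con 0ℚ :+ b :* con 0ℚ := con 0ℚ) refl
    where open +-*-Solver
  blend-11 : ∀ a b → 1ℚ ℚ.* a ℚ.+ 1ℚ ℚ.* b ≡ a ℚ.+ b
  blend-11 = solve 2 (λ a b → con 1ℚ :* a :+ con 1ℚ :* b := a :+ b) refl
    where open +-*-Solver
  blend-10 : ∀ a b → a ℚ.* b ℚ.+ 0ℚ ℚ.* b ≡ a ℚ.* b
  blend-10 = solve 2 (λ a b → a :* b :+ con 0ℚ :* b := a :* b) refl
    where open +-*-Solver

unit : ∀ f p → 0ℚ ℚ.< ev f p → Affine
unit f p 0<fp = blend ((ℚ.1/ ev f p) {{ℚ.>-nonZero 0<fp}}) f 0ℚ f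

ev-unit : ∀ f p (h : 0ℚ ℚ.< ev f p) → ev (unit f p h) p ≡ 1ℚ
ev-unit f p h = ≡-trans (ev-blend c f 0ℚ f p) (≡-trans (blend-10 c (ev f p)) (ℚP.*-inverseˡ (ev f p) {{ℚ.>-nonZero h}}))
  where c = (ℚ.1/ ev f p) {{ℚ.>-nonZero h}}

ev-unit-0 : ∀ f p (h : 0ℚ ℚ.< ev f p) {q} → ev f q ≡ 0ℚ → ev (unit f p h) q ≡ 0ℚ
ev-unit-0 f p h {q} e = ≡-trans (ev-blend c f 0ℚ f q) (≡-trans (cong (λ v → c ℚ.* v ℚ.+ 0ℚ ℚ.* v) e) (blend-00 c 0ℚ))
  where c = (ℚ.1/ ev f p) {{ℚ.>-nonZero h}}

ev-neg-0 : ∀ f {q} → ev f q ≡ 0ℚ → ev (neg f) q ≡ 0ℚ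
ev-neg-0 f {q} e = ≡-trans (ev-neg f q) (cong ℚ.-_ e)

-- The wheel cut into four fans around its hub

data InWheel {V : Set} {n : ℕ} (hubV : V) (locV : Fin n → V) : V → Set where
  isHub : InWheel hubV locV hubV
  isLoc : ∀ j → InWheel hubV locV (locV j)

data WheelEdge {V : Set} {n : ℕ} (hubV : V) (locV : Fin n → V) : V → V → Set where
  rimᵂ   : ∀ j j' → RimAdj j j' → WheelEdge hubV locV (locV j) (locV j')
  spokeᵂ : ∀ j → WheelEdge hubV locV (locV j) hubV

module WheelDrawing {V : Set} (pos : V → Pt) {n : ℕ} {w x y z : Fin n} (quad : Quad w x y z)
  (H : Pt) (P : Fin 4 → Pt) (star : StarQuad H P)
  (hubV : V) (locV : Fin n → V) (locV-injective : ∀ {j j'} → locV j ≡ locV j' → j ≡ j')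
  (hub≢loc : ∀ j → hubV ≢ locV j)
  (pos-hub : pos hubV ≡ H) (pos-loc : ∀ j → pos (locV j) ≡ Wheel.locPoint quad H P j) where

  open Drawing pos
  open Wheel quad
  open StarQuad star
  open Quad quad
  open Ranking ranking using (rank<; rank-inj; rank-cycle)

  record At (g : Fin 4) (r : ℕ) (v : V) : Set where
    constructor placed
    field
      {j}  : Fin n
      is   : v ≡ locV j
      key  : Key H P j r
      l≤   : lo g ℕ.≤ r
      ≤h   : r ℕ.≤ hi g

  At-unique : ∀ {g g' r u v} → At g r u → At g' r v → u ≡ v
  At-unique (placed refl k _ _) (placed refl k' _ _) = cong locV (Key-injective H P k k')

  At-pos : ∀ {g r v} → At g r v → pos v ≡ keyPoint H P g r
  At-pos {g} (placed {j} refl k l h) = ≡-trans (pos-loc j) (keyPoint-loc H P g k l h)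

  InFan : Fin 4 → V → Set
  InFan g v = v ≡ hubV ⊎ ∃ λ r → At g r v

  data FanEdge (g : Fin 4) : V → V → Set where
    spokeᶠ : ∀ {r u} → At g r u → FanEdge g u hubV
    rimUp  : ∀ {r u v} → At g r u → At g (suc r) v → FanEdge g u v
    rimDown : ∀ {r u v} → At g r u → At g (suc r) v → FanEdge g v u

  At≢hub : ∀ {g r v} → At g r v → v ≢ hubV
  At≢hub (placed {j} refl _ _ _) e = hub≢loc j (sym e)

  module Fan (g : Fin 4) where
    -- Coordinates with origin at the hub in which the corners g and g + 1 are (1 , 0) and (0 , 1).
    γ₁ γ₂ : Affine
    γ₁ = unit (ray g) (P g) (ray-before g)

    prev : Fin 4
    prev = next (next (next g))
    next-prev : next prev ≡ g
    next-prev = lem g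
      where
      lem : ∀ g → next (next (next (next g))) ≡ g
      lem 0F = refl
      lem 1F = refl
      lem 2F = refl
      lem 3F = refl
    0<γ₂ : 0ℚ ℚ.< ev (neg (ray prev)) (P (next g))
    0<γ₂ = subst (λ h → 0ℚ ℚ.< ev (neg (ray prev)) (P (next h))) next-prev (ray-after prev)
    γ₂ = unit (neg (ray prev)) (P (next g)) 0<γ₂

    γ₁-H : ev γ₁ H ≡ 0ℚ
    γ₁-H = ev-unit-0 (ray g) (P g) (ray-before g) (ray-hub g)
    γ₁-P : ev γ₁ (P g) ≡ 1ℚ
    γ₁-P = ev-unit (ray g) (P g) (ray-before g)
    γ₁-Q : ev γ₁ (P (next g)) ≡ 0ℚ
    γ₁-Q = ev-unit-0 (ray g) (P g) (ray-before g) (ray-corner g)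
    γ₂-H : ev γ₂ H ≡ 0ℚ
    γ₂-H = ev-unit-0 (neg (ray prev)) _ 0<γ₂ (ev-neg-0 (ray prev) (ray-hub prev))
    γ₂-P : ev γ₂ (P g) ≡ 0ℚ
    γ₂-P = ev-unit-0 (neg (ray prev)) _ 0<γ₂
      (ev-neg-0 (ray prev) (subst (λ h → ev (ray prev) (P h) ≡ 0ℚ) next-prev (ray-corner prev)))
    γ₂-Q : ev γ₂ (P (next g)) ≡ 1ℚ
    γ₂-Q = ev-unit (neg (ray prev)) _ 0<γ₂

    a b : ℕ → ℚ
    a r = ev γ₁ (keyPoint H P g r)
    b r = ev γ₂ (keyPoint H P g r)

    a-lo : ∀ {r} → r ≡ lo g → a r ≡ 1ℚ
    a-lo refl = ≡-trans (cong (ev γ₁) (keyPoint-lo H P g)) γ₁-P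
    b-lo : ∀ {r} → r ≡ lo g → b r ≡ 0ℚ
    b-lo refl = ≡-trans (cong (ev γ₂) (keyPoint-lo H P g)) γ₂-P
    a-hi : ∀ {r} → r ≡ hi g → a r ≡ 0ℚ
    a-hi refl = ≡-trans (cong (ev γ₁) (keyPoint-hi H P g)) γ₁-Q
    b-hi : ∀ {r} → r ≡ hi g → b r ≡ 1ℚ
    b-hi refl = ≡-trans (cong (ev γ₂) (keyPoint-hi H P g)) γ₂-Q
    a-mid : ∀ {r} → lo g ℕ.< r → r ℕ.< hi g → a r ≡ mix ½ 0ℚ (mix (slot r) 1ℚ 0ℚ)
    a-mid {r} l h = ≡-trans (cong (ev γ₁) (keyPoint-mid H P g l h)) (≡-trans (ev-inner γ₁ H (P g) (P (next g)) r)
      (cong₂ (mix ½) γ₁-H (cong₂ (mix (slot r)) γ₁-P γ₁-Q)))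
    b-mid : ∀ {r} → lo g ℕ.< r → r ℕ.< hi g → b r ≡ mix ½ 0ℚ (mix (slot r) 0ℚ 1ℚ)
    b-mid {r} l h = ≡-trans (cong (ev γ₂) (keyPoint-mid H P g l h)) (≡-trans (ev-inner γ₂ H (P g) (P (next g)) r)
      (cong₂ (mix ½) γ₂-H (cong₂ (mix (slot r)) γ₂-P γ₂-Q)))

    0≤0 : 0ℚ ℚ.≤ 0ℚ
    0≤0 = ℚP.≤-refl
    0≤1 : 0ℚ ℚ.≤ 1ℚ
    0≤1 = ℚP.<⇒≤ 0<1

    a-pos : ∀ {r} → lo g ℕ.≤ r → r ℕ.< hi g → 0ℚ ℚ.< a r
    a-pos {r} l h with ℕP.m≤n⇒m<n∨m≡n l
    ... | inj₂ e = subst (0ℚ ℚ.<_) (sym (a-lo (sym e))) 0<1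
    ... | inj₁ l' = subst (0ℚ ℚ.<_) (sym (a-mid l' h)) (mix-open 0<½ ½<1 0≤0 (ℚP.<⇒≤ p) (inj₂ p))
      where p = mix-open (0<slot l') (slot<1 r) 0≤1 0≤0 (inj₁ 0<1)
    b-pos : ∀ {r} → lo g ℕ.< r → r ℕ.≤ hi g → 0ℚ ℚ.< b r
    b-pos {r} l h with ℕP.m≤n⇒m<n∨m≡n h
    ... | inj₂ e = subst (0ℚ ℚ.<_) (sym (b-hi e)) 0<1
    ... | inj₁ h' = subst (0ℚ ℚ.<_) (sym (b-mid l h')) (mix-open 0<½ ½<1 0≤0 (ℚP.<⇒≤ p) (inj₂ p))
      where p = mix-open (0<slot l) (slot<1 r) 0≤0 0≤1 (inj₂ 0<1)

    -- The determinant of two keys as vectors from the hub. That it is positive for increasing keys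
    -- means that the keys of a fan follow each other by angle; all disjointness inside a fan comes
    -- from this.
    cross : ℕ → ℕ → ℚ
    cross r s = a r ℚ.* b s ℚ.+ ℚ.- b r ℚ.* a s

    cross-pos : ∀ {r s} → lo g ℕ.≤ r → r ℕ.< s → s ℕ.≤ hi g → 0ℚ ℚ.< cross r s
    cross-pos {r} {s} l r<s h with ℕP.m≤n⇒m<n∨m≡n l | ℕP.m≤n⇒m<n∨m≡n h
    ... | inj₂ e | _ = subst (0ℚ ℚ.<_)
            (sym (≡-trans (cong₂ (λ p q → p ℚ.* b s ℚ.+ ℚ.- q ℚ.* a s) (a-lo (sym e)) (b-lo (sym e))) (cross-lo (a s) (b s))))
            (b-pos (ℕP.≤-<-trans l r<s) h)
    ... | inj₁ l' | inj₂ e = subst (0ℚ ℚ.<_)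
            (sym (≡-trans (cong₂ (λ p q → a r ℚ.* p ℚ.+ ℚ.- b r ℚ.* q) (b-hi e) (a-hi e)) (cross-hi (a r) (b r))))
            (a-pos l (ℕP.<-≤-trans r<s h))
    ... | inj₁ l' | inj₁ h' = subst (0ℚ ℚ.<_)
            (sym (≡-trans (cong₂ ℚ._+_ (cong₂ ℚ._*_ (a-mid l' r<hi) (b-mid lo<s h'))
                                       (cong₂ ℚ._*_ (cong ℚ.-_ (b-mid l' r<hi)) (a-mid lo<s h')))
                 (cross-mid (slot r) (slot s))))
            (*-pos 0<½ (*-pos 0<½ (<⇒0<- (slot-mono r<s))))
      where
      r<hi = ℕP.<-trans r<s h'
      lo<s = ℕP.<-trans l' r<s

    -- The line from the hub towards the key r, and one missing the hub.
    beam : ℕ → Affine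
    beam r = blend (a r) γ₂ (ℚ.- b r) γ₁
    beyond : Affine
    beyond = blend 1ℚ γ₁ 1ℚ γ₂

    beam-at : ∀ r {s v} → At g s v → ev (beam r) (pos v) ≡ cross r s
    beam-at r {s} p = ≡-trans (cong (ev (beam r)) (At-pos p)) (ev-blend (a r) γ₂ (ℚ.- b r) γ₁ (keyPoint H P g s))
    beam-hub : ∀ r → ev (beam r) (pos hubV) ≡ 0ℚ
    beam-hub r = ≡-trans (cong (ev (beam r)) pos-hub) (≡-trans (ev-blend (a r) γ₂ (ℚ.- b r) γ₁ H)
      (≡-trans (cong₂ (λ p q → a r ℚ.* p ℚ.+ (ℚ.- b r) ℚ.* q) γ₂-H γ₁-H) (blend-00 (a r) (ℚ.- b r))))
    beam-self : ∀ {r v} → At g r v → ev (beam r) (pos v) ≡ 0ℚ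
    beam-self {r} p = ≡-trans (beam-at r p) (cross-self (a r) (b r))
    beam-after : ∀ {r s u v} → At g r u → At g s v → r ℕ.< s → 0ℚ ℚ.< ev (beam r) (pos v)
    beam-after {r} p q r<s = subst (0ℚ ℚ.<_) (sym (beam-at r q)) (cross-pos (At.l≤ p) r<s (At.≤h q))
    beam-before : ∀ {r s u v} → At g r u → At g s v → s ℕ.< r → 0ℚ ℚ.< ev (neg (beam r)) (pos v)
    beam-before {r} {s} {v = v} p q s<r = subst (0ℚ ℚ.<_)
      (sym (≡-trans (ev-neg (beam r) (pos v)) (≡-trans (cong ℚ.-_ (beam-at r q)) (cross-swap (a r) (b r) (a s) (b s)))))
      (cross-pos (At.l≤ q) s<r (At.≤h p))
    beyond-hub : ev beyond (pos hubV) ≡ 0ℚ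
    beyond-hub = ≡-trans (cong (ev beyond) pos-hub) (≡-trans (ev-blend 1ℚ γ₁ 1ℚ γ₂ H)
      (≡-trans (cong₂ (λ p q → 1ℚ ℚ.* p ℚ.+ 1ℚ ℚ.* q) γ₁-H γ₂-H) (blend-00 1ℚ 1ℚ)))
    beyond-at : ∀ {r v} → At g r v → 0ℚ ℚ.< ev beyond (pos v)
    beyond-at {r} p = subst (0ℚ ℚ.<_)
      (sym (≡-trans (cong (ev beyond) (At-pos p)) (≡-trans (ev-blend 1ℚ γ₁ 1ℚ γ₂ (keyPoint H P g r)) (blend-11 (a r) (b r)))))
      sum
      where
      sum : 0ℚ ℚ.< a r ℚ.+ b r
      sum with keyView H P g (At.l≤ p) (At.≤h p)
      ... | low e = +-pos-nonNeg (a-pos (ℕP.≤-reflexive (sym e)) (subst (ℕ._< hi g) (sym e) (lo<hi g))) (ℚP.≤-reflexive (sym (b-lo e)))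
      ... | mid l h = +-pos-nonNeg (a-pos (ℕP.<⇒≤ l) h) (ℚP.<⇒≤ (b-pos l (ℕP.<⇒≤ h)))
      ... | high e = +-nonNeg-pos (ℚP.≤-reflexive (sym (a-hi e))) (b-pos (subst (lo g ℕ.<_) (sym e) (lo<hi g)) (ℕP.≤-reflexive e))

    neg-opposite : ∀ f p → ev f p ≡ ℚ.- ev (neg f) p
    neg-opposite f p = sym (≡-trans (cong ℚ.-_ (ev-neg f p)) (neg-neg (ev f p)))

    zero≥ : ∀ {q} → q ≡ 0ℚ → 0ℚ ℚ.≤ q
    zero≥ e = ℚP.≤-reflexive (sym e)
    neg-zero≥ : ∀ f {q} → ev f q ≡ 0ℚ → 0ℚ ℚ.≤ ev (neg f) q
    neg-zero≥ f e = zero≥ (ev-neg-0 f e)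

    data Rim (r : ℕ) : V → V → Set where
      up   : ∀ {u v} → At g r u → At g (suc r) v → Rim r u v
      down : ∀ {u v} → At g r u → At g (suc r) v → Rim r v u

    both : ∀ {r u v} → Rim r u v → (Q : V → Set) → (∀ {t} → At g r t → Q t) → (∀ {t} → At g (suc r) t → Q t) → Q u × Q v
    both (up p q)   Q f h = f p , h q
    both (down p q) Q f h = h q , f p

    from : ∀ {r u v} → Rim r u v → ∃ λ t → At g r t
    from (up p q)   = _ , p
    from (down p q) = _ , p

    to : ∀ {r u v} → Rim r u v → ∃ λ t → At g (suc r) t
    to (up p q)   = _ , q
    to (down p q) = _ , q

    ends : ∀ {r u v} → Rim r u v → ∀ {t} → At g r t ⊎ At g (suc r) t → t ≡ u ⊎ t ≡ v
    ends (up p q)   (inj₁ t) = inj₁ (At-unique t p)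
    ends (up p q)   (inj₂ t) = inj₂ (At-unique t q)
    ends (down p q) (inj₁ t) = inj₂ (At-unique t p)
    ends (down p q) (inj₂ t) = inj₁ (At-unique t q)

    rim-after : ∀ {r s t u v} → At g s t → Rim r u v → s ℕ.< r → 0ℚ ℚ.< ev (beam s) (pos u) × 0ℚ ℚ.< ev (beam s) (pos v)
    rim-after {s = s} p e s<r = both e (λ t → 0ℚ ℚ.< ev (beam s) (pos t)) (λ q → beam-after p q s<r)
      (λ q → beam-after p q (ℕP.<-trans s<r ℕP.≤-refl))
    rim-before : ∀ {r s t u v} → At g s t → Rim r u v → suc r ℕ.< s → 0ℚ ℚ.< ev (neg (beam s)) (pos u) × 0ℚ ℚ.< ev (neg (beam s)) (pos v)
    rim-before {s = s} p e r<s = both e (λ t → 0ℚ ℚ.< ev (neg (beam s)) (pos t)) (λ q → beam-before p q (ℕP.<-trans ℕP.≤-refl r<s))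
      (λ q → beam-before p q r<s)

    outside : ∀ {r s t u v} → At g s t → Rim r u v → t ≢ u → t ≢ v → s ℕ.< r ⊎ suc r ℕ.< s
    outside {r} {s} p e tu tv with ℕP.<-cmp s r
    ... | tri< s<r _ _ = inj₁ s<r
    ... | tri≈ _ refl _ = ⊥-elim ([ tu , tv ]′ (ends e (inj₁ p)))
    ... | tri> _ _ r<s with ℕP.m≤n⇒m<n∨m≡n r<s
    ...   | inj₁ q = inj₂ q
    ...   | inj₂ refl = ⊥-elim ([ tu , tv ]′ (ends e (inj₂ p)))

    rim-avoids : ∀ {r u v w} → Rim r u v → InFan g w → w ≢ u → w ≢ v → ¬ OnSegment (pos w) (pos u) (pos v)
    rim-avoids {u = u} {v} e (inj₁ refl) wu wv = point-apart {beyond} {neg beyond} (ev-neg beyond)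
      (neg-zero≥ beyond beyond-hub) (proj₁ q) (proj₂ q)
      where q = both e (λ t → 0ℚ ℚ.< ev beyond (pos t)) beyond-at beyond-at
    rim-avoids e (inj₂ (s , p)) wu wv with outside p e wu wv
    ... | inj₁ s<r = point-apart {beam s} {neg (beam s)} (ev-neg (beam s)) (neg-zero≥ (beam s) (beam-self p)) (proj₁ q) (proj₂ q)
      where q = rim-after p e s<r
    ... | inj₂ r<s = point-apart {neg (beam s)} {beam s} (neg-opposite (beam s)) (zero≥ (beam-self p)) (proj₁ q) (proj₂ q)
      where q = rim-before p e r<s

    spoke-avoids : ∀ {r u w} → At g r u → InFan g w → w ≢ u → w ≢ hubV → ¬ OnSegment (pos w) (pos u) (pos hubV)
    spoke-avoids p (inj₁ e) wu wh = ⊥-elim (wh e)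
    spoke-avoids {r} p (inj₂ (s , q)) wu wh with ℕP.<-cmp r s
    ... | tri≈ _ refl _ = ⊥-elim (wu (At-unique q p))
    ... | tri< r<s _ _ = point-apart′ {beam r} {neg (beam r)} (ev-neg (beam r)) (beam-after p q r<s)
            (neg-zero≥ (beam r) (beam-self p)) (neg-zero≥ (beam r) (beam-hub r))
    ... | tri> _ _ s<r = point-apart′ {neg (beam r)} {beam r} (neg-opposite (beam r)) (beam-before p q s<r)
            (zero≥ (beam-self p)) (zero≥ (beam-hub r))

    SegmentsMeet-sym : ∀ a b c d → SegmentsMeet a b c d → SegmentsMeet c d a b
    SegmentsMeet-sym a b c d (s , t , p , q , e) = t , s , q , p , sym e

    spoke-rim : ∀ {r u s x y} → At g s u → Rim r x y → u ≢ x → u ≢ y → ¬ SegmentsMeet (pos u) (pos hubV) (pos x) (pos y)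
    spoke-rim {s = s} p e ux uy with outside p e ux uy
    ... | inj₁ s<r = segments-apart {beam s} {neg (beam s)} (ev-neg (beam s))
            (neg-zero≥ (beam s) (beam-self p)) (neg-zero≥ (beam s) (beam-hub s)) (proj₁ q) (proj₂ q)
      where q = rim-after p e s<r
    ... | inj₂ r<s = segments-apart {neg (beam s)} {beam s} (neg-opposite (beam s))
            (zero≥ (beam-self p)) (zero≥ (beam-hub s)) (proj₁ q) (proj₂ q)
      where q = rim-before p e r<s

    -- The beam through the last key of the first edge separates them: the first edge lies on it or
    -- before it, the second one strictly after it.
    rim-rim-ordered : ∀ {r s u v x y} → Rim r u v → Rim s x y → suc r ℕ.< s → ¬ SegmentsMeet (pos u) (pos v) (pos x) (pos y)
    rim-rim-ordered {r} {s} e e' r<s = segments-apart {beam (suc r)} {neg (beam (suc r))} (ev-neg (beam (suc r)))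
        (proj₁ p) (proj₂ p) (proj₁ q) (proj₂ q)
      where
      t = proj₂ (to e)
      p = both e (λ t → 0ℚ ℚ.≤ ev (neg (beam (suc r))) (pos t)) (λ m → ℚP.<⇒≤ (beam-before t m ℕP.≤-refl))
            (λ m → neg-zero≥ (beam (suc r)) (beam-self m))
      q = rim-after t e' r<s

    rim-rim : ∀ {r s u v x y} → Rim r u v → Rim s x y → u ≢ x → u ≢ y → v ≢ x → v ≢ y →
              ¬ SegmentsMeet (pos u) (pos v) (pos x) (pos y)
    rim-rim {u = u} {v} {x} {y} e e' ux uy vx vy m with ends e (inj₁ (proj₂ (from e))) | ends e (inj₂ (proj₂ (to e)))
    ... | q₁ | q₂ with outside (proj₂ (from e)) e' (avoid ux vx q₁) (avoid uy vy q₁)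
                     | outside (proj₂ (to e)) e' (avoid ux vx q₂) (avoid uy vy q₂)
      where
      avoid : ∀ {t u v x : V} → u ≢ x → v ≢ x → t ≡ u ⊎ t ≡ v → t ≢ x
      avoid ux vx (inj₁ refl) = ux
      avoid ux vx (inj₂ refl) = vx
    ...   | inj₂ s<r | _ = rim-rim-ordered e' e s<r (SegmentsMeet-sym (pos u) (pos v) (pos x) (pos y) m)
    ...   | inj₁ _ | inj₁ r<s = rim-rim-ordered e e' r<s m
    ...   | inj₁ r<s | inj₂ s<r = ⊥-elim (ℕP.<⇒≱ (ℕP.≤-pred s<r) (ℕP.<⇒≤ r<s))

    fan-endpoints : ∀ {u v} → FanEdge g u v → InFan g u × InFan g v
    fan-endpoints (spokeᶠ p) = inj₂ (_ , p) , inj₁ refl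
    fan-endpoints (rimUp p q) = inj₂ (_ , p) , inj₂ (_ , q)
    fan-endpoints (rimDown p q) = inj₂ (_ , q) , inj₂ (_ , p)

    step-loopless : ∀ {r u v} → At g r u → At g (suc r) v → u ≢ v
    step-loopless {r} p q refl = pos≢0 (beam-after p q (ℕP.n<1+n r)) (beam-self p)

    fan-loopless : ∀ {u v} → FanEdge g u v → u ≢ v
    fan-loopless (spokeᶠ p) e = At≢hub p e
    fan-loopless (rimUp p q) = step-loopless p q
    fan-loopless (rimDown p q) e = step-loopless p q (sym e)

    fan-injective : ∀ {u v} → InFan g u → InFan g v → pos u ≡ pos v → u ≡ v
    fan-injective (inj₁ refl) (inj₁ refl) e = refl
    fan-injective (inj₁ refl) (inj₂ (_ , q)) e = ⊥-elim (pos≢0 (beyond-at q) (≡-trans (cong (ev beyond) (sym e)) beyond-hub))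
    fan-injective (inj₂ (_ , p)) (inj₁ refl) e = ⊥-elim (pos≢0 (beyond-at p) (≡-trans (cong (ev beyond) e) beyond-hub))
    fan-injective (inj₂ (r , p)) (inj₂ (s , q)) e with ℕP.<-cmp r s
    ... | tri≈ _ refl _ = At-unique p q
    ... | tri< r<s _ _ = ⊥-elim (pos≢0 (beam-after p q r<s) (≡-trans (cong (ev (beam r)) (sym e)) (beam-self p)))
    ... | tri> _ _ s<r = ⊥-elim (pos≢0 (beam-after q p s<r) (≡-trans (cong (ev (beam s)) e) (beam-self q)))

    fan-avoids : ∀ {u v w} → FanEdge g u v → InFan g w → w ≢ u → w ≢ v → ¬ OnSegment (pos w) (pos u) (pos v)
    fan-avoids (spokeᶠ p) = spoke-avoids p
    fan-avoids (rimUp p q) = rim-avoids (up p q)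
    fan-avoids (rimDown p q) = rim-avoids (down p q)

    fan-disjoint : ∀ {u v x y} → FanEdge g u v → FanEdge g x y → u ≢ x → u ≢ y → v ≢ x → v ≢ y →
                   ¬ SegmentsMeet (pos u) (pos v) (pos x) (pos y)
    fan-disjoint (spokeᶠ p) (spokeᶠ q) ux uy vx vy = ⊥-elim (vy refl)
    fan-disjoint (spokeᶠ p) (rimUp q q') ux uy vx vy = spoke-rim p (up q q') ux uy
    fan-disjoint (spokeᶠ p) (rimDown q q') ux uy vx vy = spoke-rim p (down q q') ux uy
    fan-disjoint {u} {v} {x} (rimUp q q') (spokeᶠ p) ux uy vx vy m = spoke-rim p (up q q') (λ e → ux (sym e)) (λ e → vx (sym e)) (SegmentsMeet-sym (pos u) (pos v) (pos x) (pos hubV) m)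
    fan-disjoint {u} {v} {x} (rimDown q q') (spokeᶠ p) ux uy vx vy m = spoke-rim p (down q q') (λ e → ux (sym e)) (λ e → vx (sym e)) (SegmentsMeet-sym (pos u) (pos v) (pos x) (pos hubV) m)
    fan-disjoint (rimUp q q') (rimUp p p') = rim-rim (up q q') (up p p')
    fan-disjoint (rimUp q q') (rimDown p p') = rim-rim (up q q') (down p p')
    fan-disjoint (rimDown q q') (rimUp p p') = rim-rim (down q q') (up p p')
    fan-disjoint (rimDown q q') (rimDown p p') = rim-rim (down q q') (down p p')

    fanPlanar : PlanarOn (InFan g) (FanEdge g)
    fanPlanar = record { endpoints = fan-endpoints ; loopless = fan-loopless ; injective = fan-injective
      ; avoids = fan-avoids ; disjoint = fan-disjoint }

  at-gap : ∀ j → At (gap (at j)) (at j) (locV j)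
  at-gap j = placed refl (inj₁ refl) (proj₁ b) (ℕP.<⇒≤ (proj₂ b))
    where b = gap-bounds (rank< j)

  at-corner : ∀ g → At g (lo g) (locV (corner g))
  at-corner g = placed refl (inj₁ refl) ℕP.≤-refl (ℕP.<⇒≤ (lo<hi g))

  at-hi⇒at-lo : ∀ g {v} → At g (hi g) v → At (next g) (lo (next g)) v
  at-hi⇒at-lo 0F (placed e k _ _) = placed e k ℕP.≤-refl (ℕP.<⇒≤ x<y)
  at-hi⇒at-lo 1F (placed e k _ _) = placed e k ℕP.≤-refl (ℕP.<⇒≤ y<z)
  at-hi⇒at-lo 2F (placed e k _ _) = placed e k ℕP.≤-refl (ℕP.<⇒≤ (rank< z))
  at-hi⇒at-lo 3F (placed {j} e (inj₁ k) _ _) = ⊥-elim (ℕP.<-irrefl (sym k) (rank< j))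
  at-hi⇒at-lo 3F (placed e (inj₂ (_ , k)) _ _) =
    placed e (inj₁ (≡-trans first (sym k))) ℕP.≤-refl (ℕP.<⇒≤ w<x)

  at-lo⇒at-hi : ∀ g {v} → At (next g) (lo (next g)) v → At g (hi g) v
  at-lo⇒at-hi 0F (placed e k _ _) = placed e k (ℕP.<⇒≤ w<x) ℕP.≤-refl
  at-lo⇒at-hi 1F (placed e k _ _) = placed e k (ℕP.<⇒≤ x<y) ℕP.≤-refl
  at-lo⇒at-hi 2F (placed e k _ _) = placed e k (ℕP.<⇒≤ y<z) ℕP.≤-refl
  at-lo⇒at-hi 3F (placed e (inj₁ k) _ _) =
    placed e (inj₂ (refl , ≡-trans (sym k) first)) (ℕP.<⇒≤ (rank< z)) ℕP.≤-refl
  at-lo⇒at-hi 3F (placed e (inj₂ (k , _)) _ _) = ⊥-elim (ℕP.<-irrefl k (rank< w))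

  private
    at-lo-pos : ∀ {g v} → At g (lo g) v → pos v ≡ P g
    at-lo-pos {g} p = ≡-trans (At-pos p) (keyPoint-lo H P g)

    at-hi-pos : ∀ {g v} → At g (hi g) v → pos v ≡ P (next g)
    at-hi-pos {g} p = ≡-trans (At-pos p) (keyPoint-hi H P g)

    at-mid-pos : ∀ {g r v} → At g r v → lo g ℕ.< r → r ℕ.< hi g → pos v ≡ inner H (P g) (P (next g)) r
    at-mid-pos {g} p l h = ≡-trans (At-pos p) (keyPoint-mid H P g l h)

    triangleSide : ∀ f g {z₂ J} → ev f H ≡ 0ℚ → J hubV →
      0ℚ ℚ.≤ ev f (P g) → 0ℚ ℚ.≤ ev f (P (next g)) → 0ℚ ℚ.< ev f (P g) ⊎ 0ℚ ℚ.< ev f (P (next g)) →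
      (∀ {v} → At g (lo g) v → Side f hubV z₂ J v) → (∀ {v} → At g (hi g) v → Side f hubV z₂ J v) →
      ∀ {v} → InFan g v → Side f hubV z₂ J v
    triangleSide f g h j p q s l u (inj₁ refl) = onLine (≡-trans (cong (ev f) pos-hub) h) (inj₁ refl) j
    triangleSide f g h j p q s l u (inj₂ (r , at)) with keyView H P g (At.l≤ at) (At.≤h at)
    ... | low refl = l at
    ... | high refl = u at
    ... | mid lo<r r<hi = inside (subst (λ z → 0ℚ ℚ.< ev f z) (sym (at-mid-pos at lo<r r<hi))
            (inner-pos f lo<r (ℚP.≤-reflexive (sym h)) p q (inj₂ s)))

    -- Neighbouring fans share exactly the hub and one corner, and the ray through these two
    -- separates them.
    adjacent : ∀ g → Separated (InFan g) (InFan (next g))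
    adjacent g = record
      { f = ray g ; g = neg (ray g) ; z₁ = hubV ; z₂ = locV (corner (next g))
      ; opposite = ev-neg (ray g)
      ; left = triangleSide (ray g) g (ray-hub g) (inj₁ refl) (ℚP.<⇒≤ (ray-before g))
          (ℚP.≤-reflexive (sym (ray-corner g))) (inj₁ (ray-before g))
          (λ p → inside (subst (λ z → 0ℚ ℚ.< ev (ray g) z) (sym (at-lo-pos p)) (ray-before g)))
          (λ p → onLine (≡-trans (cong (ev (ray g)) (at-hi-pos p)) (ray-corner g))
                   (inj₂ (At-unique (at-hi⇒at-lo g p) (at-corner (next g)))) (inj₂ (_ , at-hi⇒at-lo g p)))
      ; right = triangleSide (neg (ray g)) (next g) (ev-neg-0 (ray g) (ray-hub g)) (inj₁ refl)
          (ℚP.≤-reflexive (sym (ev-neg-0 (ray g) (ray-corner g)))) (ℚP.<⇒≤ (ray-after g)) (inj₂ (ray-after g))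
          (λ p → onLine (≡-trans (cong (ev (neg (ray g))) (at-lo-pos p)) (ev-neg-0 (ray g) (ray-corner g)))
                   (inj₂ (At-unique p (at-corner (next g)))) (inj₂ (_ , at-lo⇒at-hi g p)))
          (λ p → inside (subst (λ z → 0ℚ ℚ.< ev (neg (ray g)) z) (sym (at-hi-pos p)) (ray-after g)))
      }

    across : ∀ g → Separated (InFan g) (InFan (next (next g)))
    across g = record
      { f = side g ; g = neg (side g) ; z₁ = hubV ; z₂ = hubV
      ; opposite = ev-neg (side g)
      ; left = triangleSide (side g) g (side-hub g) (inj₁ refl) (ℚP.<⇒≤ (proj₁ near)) (ℚP.<⇒≤ (proj₂ near)) (inj₁ (proj₁ near))
          (λ p → inside (subst (λ z → 0ℚ ℚ.< ev (side g) z) (sym (at-lo-pos p)) (proj₁ near)))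
          (λ p → inside (subst (λ z → 0ℚ ℚ.< ev (side g) z) (sym (at-hi-pos p)) (proj₂ near)))
      ; right = triangleSide (neg (side g)) (next (next g)) (ev-neg-0 (side g) (side-hub g)) (inj₁ refl)
          (ℚP.<⇒≤ (proj₁ far)) (ℚP.<⇒≤ (proj₂ far)) (inj₁ (proj₁ far))
          (λ p → inside (subst (λ z → 0ℚ ℚ.< ev (neg (side g)) z) (sym (at-lo-pos p)) (proj₁ far)))
          (λ p → inside (subst (λ z → 0ℚ ℚ.< ev (neg (side g)) z) (sym (at-hi-pos p)) (proj₂ far)))
      }
      where
      near = side-near g
      far = side-far g

    fans-separated : ∀ g h → g ≡ h ⊎ Separated (InFan g) (InFan h)
    fans-separated 0F 0F = inj₁ refl
    fans-separated 0F 1F = inj₂ (adjacent 0F)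
    fans-separated 0F 2F = inj₂ (across 0F)
    fans-separated 0F 3F = inj₂ (Separated-sym (adjacent 3F))
    fans-separated 1F 0F = inj₂ (Separated-sym (adjacent 0F))
    fans-separated 1F 1F = inj₁ refl
    fans-separated 1F 2F = inj₂ (adjacent 1F)
    fans-separated 1F 3F = inj₂ (across 1F)
    fans-separated 2F 0F = inj₂ (across 2F)
    fans-separated 2F 1F = inj₂ (Separated-sym (adjacent 1F))
    fans-separated 2F 2F = inj₁ refl
    fans-separated 2F 3F = inj₂ (adjacent 2F)
    fans-separated 3F 0F = inj₂ (adjacent 3F)
    fans-separated 3F 1F = inj₂ (across 3F)
    fans-separated 3F 2F = inj₂ (Separated-sym (adjacent 2F))
    fans-separated 3F 3F = inj₁ refl

    -- A gap is closed at its upper end, so an edge that starts in it does not leave its fan. The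
    -- edge back to rank 0 ends at the second key of that location.
    rim-step : ∀ {j j'} → Next n (at j) (at j') → At (gap (at j)) (suc (at j)) (locV j')
    rim-step {j} {j'} e = placed refl (key e) (ℕP.m≤n⇒m≤1+n (proj₁ b)) (proj₂ b)
      where
      b = gap-bounds (rank< j)
      key : Next n (at j) (at j') → Key H P j' (suc (at j))
      key (inj₁ p) = inj₁ (sym p)
      key (inj₂ (p , q)) = inj₂ (p , q)

    inFan : ∀ {v} → (InWheel hubV locV) v → ∃ λ g → InFan g v
    inFan isHub = 0F , inj₁ refl
    inFan (isLoc j) = gap (at j) , inj₂ (_ , at-gap j)

    fanEdge : ∀ {u v} → (WheelEdge hubV locV) u v → ∃ λ g → FanEdge g u v
    fanEdge (spokeᵂ j) = gap (at j) , spokeᶠ (at-gap j)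
    fanEdge (rimᵂ j j' a) with rank-cycle j j' a
    ... | inj₁ e = _ , rimUp (at-gap j) (rim-step e)
    ... | inj₂ e = _ , rimDown (at-gap j') (rim-step e)

    wheelEnds : ∀ {u v} → (WheelEdge hubV locV) u v → (InWheel hubV locV) u × (InWheel hubV locV) v
    wheelEnds (rimᵂ j j' _) = isLoc j , isLoc j'
    wheelEnds (spokeᵂ j) = isLoc j , isHub

  wheelPlanar : PlanarOn (InWheel hubV locV) (WheelEdge hubV locV)
  wheelPlanar = mono inFan fanEdge wheelEnds (glue Fan.fanPlanar fans-separated)

  -- All locations other than the corners carry positive weight at the hub. This is what makes the
  -- planarity test independent of the number of locations: five points decide on which side of a
  -- line a whole copy lies.
  wheelSide : ∀ f {z₁ z₂ J} → 0ℚ ℚ.< ev f H → (∀ g → Side f z₁ z₂ J (locV (corner g))) →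
              ∀ {v} → (InWheel hubV locV) v → Side f z₁ z₂ J v
  wheelSide f h c isHub = inside (subst (λ z → 0ℚ ℚ.< ev f z) (sym pos-hub) h)
  wheelSide f {z₁} {z₂} {J} h c (isLoc j) with keyView H P (gap (at j)) (proj₁ (gap-bounds (rank< j))) (ℕP.<⇒≤ (proj₂ (gap-bounds (rank< j))))
  ... | low e = subst (Side f z₁ z₂ J) (cong locV (rank-inj (sym e))) (c (gap (at j)))
  ... | high e = ⊥-elim (ℕP.<-irrefl e (proj₂ (gap-bounds (rank< j))))
  ... | mid l u = inside (subst (λ z → 0ℚ ℚ.< ev f z) (sym (at-mid-pos (at-gap j) l u))
          (inner-pos f l (ℚP.<⇒≤ h) (corner≥0 (gap (at j))) (corner≥0 (next (gap (at j)))) (inj₁ h)))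
    where
    corner≥0 : ∀ g → 0ℚ ℚ.≤ ev f (P g)
    corner≥0 g = subst (λ z → 0ℚ ℚ.≤ ev f z) (at-lo-pos (at-corner g)) (side≥0 (c g))

-- Planarity by integer computation

∧-T : ∀ {x y} → T (x ∧ y) → T x × T y
∧-T {true} t = tt , t

∨-T : ∀ {x y} → T (x ∨ y) → T x ⊎ T y
∨-T {true} t = inj₁ t
∨-T {false} t = inj₂ t

every : ∀ n → (Fin n → Bool) → Bool
every zero    p = true
every (suc n) p = p 0F ∧ every n (λ i → p (fs i))

every-T : ∀ {n} p → T (every n p) → ∀ i → T (p i)
every-T {suc n} p t 0F     = proj₁ (∧-T t)
every-T {suc n} p t (fs i) = every-T (λ i → p (fs i)) (proj₂ (∧-T {p 0F} t)) i

allOf : {A : Set} → (A → Bool) → List A → Bool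
allOf p []       = true
allOf p (a ∷ as) = p a ∧ allOf p as

allOf-∈ : {A : Set} (p : A → Bool) → ∀ {a as} → T (allOf p as) → a ∈ as → T (p a)
allOf-∈ p h (here refl) = proj₁ (∧-T h)
allOf-∈ p {as = b ∷ as} h (there m) = allOf-∈ p (proj₂ (∧-T {p b} h)) m

pairwise : {A : Set} → (A → A → Bool) → List A → Bool
pairwise p []       = true
pairwise p (a ∷ as) = allOf (p a) as ∧ pairwise p as

pairwise-lookup : {A : Set} (p : A → A → Bool) (as : List A) → T (pairwise p as) →
                  ∀ i j → toℕ i ℕ.< toℕ j → T (p (lookup as i) (lookup as j))
pairwise-lookup p (a ∷ as) h 0F (fs j) _ = allOf-∈ (p a) {as = as} (proj₁ (∧-T {allOf (p a) as} h)) (∈-lookup {xs = as} j)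
pairwise-lookup p (a ∷ as) h (fs i) (fs j) (s≤s i<j) = pairwise-lookup p as (proj₂ (∧-T {allOf (p a) as} h)) i j i<j

-- Written as a fraction in lowest terms at once, so that no common divisor has to be computed.
fromℤ : ℤ → ℚ
fromℤ z = mkℚ z 0 (Coprime.sym (Coprime.1-coprimeTo ℤ.∣ z ∣))

private
  +-lemma : ∀ a b → (a ℤ.+ b) ℤ.* (1ℤ ℤ.* 1ℤ) ≡ (a ℤ.* 1ℤ ℤ.+ b ℤ.* 1ℤ) ℤ.* 1ℤ
  +-lemma = solve 2 (λ a b → (a :+ b) :* (con 1ℤ :* con 1ℤ) := (a :* con 1ℤ :+ b :* con 1ℤ) :* con 1ℤ) refl
    where open ℤSolver.+-*-Solver
  *-lemma : ∀ a b → (a ℤ.* b) ℤ.* (1ℤ ℤ.* 1ℤ) ≡ (a ℤ.* b) ℤ.* 1ℤ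
  *-lemma = solve 2 (λ a b → (a :* b) :* (con 1ℤ :* con 1ℤ) := (a :* b) :* con 1ℤ) refl
    where open ℤSolver.+-*-Solver

fromℤ-+ : ∀ a b → fromℤ (a ℤ.+ b) ≡ fromℤ a ℚ.+ fromℤ b
fromℤ-+ a b = ℚP.toℚᵘ-injective (ℚᵘP.≃-trans (ℚᵘ.*≡* (+-lemma a b)) (ℚᵘP.≃-sym (ℚP.toℚᵘ-homo-+ (fromℤ a) (fromℤ b))))

fromℤ-* : ∀ a b → fromℤ (a ℤ.* b) ≡ fromℤ a ℚ.* fromℤ b
fromℤ-* a b = ℚP.toℚᵘ-injective (ℚᵘP.≃-trans (ℚᵘ.*≡* (*-lemma a b)) (ℚᵘP.≃-sym (ℚP.toℚᵘ-homo-* (fromℤ a) (fromℤ b))))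

fromℤ-neg : ∀ a → fromℤ (ℤ.- a) ≡ ℚ.- fromℤ a
fromℤ-neg (+ zero) = refl
fromℤ-neg (+ suc n) = refl
fromℤ-neg -[1+ n ] = refl

fromℤ-injective : ∀ {a b} → fromℤ a ≡ fromℤ b → a ≡ b
fromℤ-injective refl = refl

positive? zero? : ℤ → Bool
positive? (+ suc _) = true
positive? _         = false
zero? (+ zero) = true
zero? _        = false

positive?-sound : ∀ z → T (positive? z) → 0ℚ ℚ.< fromℤ z
positive?-sound (+ suc n) _ = ℚP.positive⁻¹ (fromℤ (+ suc n))

zero?-sound : ∀ z → T (zero? z) → fromℤ z ≡ 0ℚ
zero?-sound (+ zero) _ = refl

Ptℤ : Set
Ptℤ = ℤ × ℤ

samePoint : Ptℤ → Ptℤ → Bool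
samePoint (x , y) (x' , y') = zero? (x ℤ.- x') ∧ zero? (y ℤ.- y')

Form : Set
Form = ℤ × ℤ × ℤ

value : Form → Ptℤ → ℤ
value (a , b , c) (x , y) = a ℤ.* x ℤ.+ b ℤ.* y ℤ.+ c

negate : Form → Form
negate (a , b , c) = ℤ.- a , ℤ.- b , ℤ.- c

⌊_⌋ : Ptℤ → Pt
⌊ x , y ⌋ = fromℤ x , fromℤ y

⟦_⟧ : Form → Affine
⟦ a , b , c ⟧ = affine (fromℤ a) (fromℤ b) (fromℤ c)

opaque
  unfolding ev
  ev-value : ∀ f p → ev ⟦ f ⟧ ⌊ p ⌋ ≡ fromℤ (value f p)
  ev-value (a , b , c) (x , y) = sym (≡-trans (fromℤ-+ (a ℤ.* x ℤ.+ b ℤ.* y) c)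
    (cong (ℚ._+ fromℤ c) (≡-trans (fromℤ-+ (a ℤ.* x) (b ℤ.* y)) (cong₂ ℚ._+_ (fromℤ-* a x) (fromℤ-* b y)))))

⟦negate⟧ : ∀ f → ⟦ negate f ⟧ ≡ neg ⟦ f ⟧
⟦negate⟧ (a , b , c) = cong₂ (λ { a (b , c) → affine a b c }) (fromℤ-neg a) (cong₂ _,_ (fromℤ-neg b) (fromℤ-neg c))

ev-negate : ∀ f p → ev ⟦ negate f ⟧ p ≡ ℚ.- ev ⟦ f ⟧ p
ev-negate f p = ≡-trans (cong (λ h → ev h p) (⟦negate⟧ f)) (ev-neg ⟦ f ⟧ p)

value-pos : ∀ f p → T (positive? (value f p)) → 0ℚ ℚ.< ev ⟦ f ⟧ ⌊ p ⌋
value-pos f p t = subst (0ℚ ℚ.<_) (sym (ev-value f p)) (positive?-sound (value f p) t)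

value-zero : ∀ f p → T (zero? (value f p)) → ev ⟦ f ⟧ ⌊ p ⌋ ≡ 0ℚ
value-zero f p t = ≡-trans (ev-value f p) (zero?-sound (value f p) t)

value-neg : ∀ f p → T (positive? (value (negate f) p)) → 0ℚ ℚ.< ev (neg ⟦ f ⟧) ⌊ p ⌋
value-neg f p t = subst (λ h → 0ℚ ℚ.< ev h ⌊ p ⌋) (⟦negate⟧ f) (value-pos (negate f) p t)

-- Candidate separating lines.  Nothing is proved about this part:
-- whether a candidate separates is decided afterwards.

through : Ptℤ → Ptℤ → Form
through (px , py) (qx , qy) = ℤ.- (qy ℤ.- py) , qx ℤ.- px , (qy ℤ.- py) ℤ.* px ℤ.- (qx ℤ.- px) ℤ.* py

infixl 6 _⊕_
_⊕_ : Form → Form → Form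
(a , b , c) ⊕ (a' , b' , c') = a ℤ.+ a' , b ℤ.+ b' , c ℤ.+ c'

infixr 7 _⊙_
_⊙_ : ℤ → Form → Form
k ⊙ (a , b , c) = k ℤ.* a , k ℤ.* b , k ℤ.* c

towards : Ptℤ → Form → Form
towards p f = if positive? (value f p) then f else negate f

-- At integer points the values of `f` are integers. So the line is moved by half a unit: `above f`
-- is positive where `f` is at least 0 and still negative where `f` is negative, and `below f` is
-- positive only where `f` is, with no zeros in either case.
above below : Form → Form
above f = (+ 2) ⊙ f ⊕ (+ 0 , + 0 , + 1)
below f = (+ 2) ⊙ f ⊕ (+ 0 , + 0 , -[1+ 0 ])

record Shape : Set where
  constructor shape
  field
    hubᶻ    : Ptℤ
    cornerᶻ : Fin 4 → Ptℤ
open Shape public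

-- The side is the difference of the two rays bounding a triangle: at each of its two corners one
-- ray vanishes and the other one contributes with the right sign.
rayForm sideForm : Shape → Fin 4 → Form
rayForm s g = towards (cornerᶻ s g) (through (hubᶻ s) (cornerᶻ s (next g)))
sideForm s g = rayForm s g ⊕ negate (rayForm s (next (next (next g))))

edgeForms : Shape → List Form
edgeForms s = map (λ g → towards (hubᶻ s) (through (cornerᶻ s g) (cornerᶻ s (next g))))
  (0F ∷ fs 0F ∷ fs 1F ∷ fs 2F ∷ [])

starTestAt : Shape → Fin 4 → Bool
starTestAt s g =
  zero? (value (rayForm s g) (hubᶻ s)) ∧ zero? (value (rayForm s g) (cornerᶻ s (next g))) ∧
  positive? (value (rayForm s g) (cornerᶻ s g)) ∧ positive? (value (negate (rayForm s g)) (cornerᶻ s (next (next g)))) ∧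
  zero? (value (sideForm s g) (hubᶻ s)) ∧
  positive? (value (sideForm s g) (cornerᶻ s g)) ∧ positive? (value (sideForm s g) (cornerᶻ s (next g))) ∧
  positive? (value (negate (sideForm s g)) (cornerᶻ s (next (next g)))) ∧
  positive? (value (negate (sideForm s g)) (cornerᶻ s (next (next (next g)))))

starTest : Shape → Bool
starTest s = every 4 (starTestAt s)

starQuad : ∀ s → T (starTest s) → StarQuad ⌊ hubᶻ s ⌋ (λ g → ⌊ cornerᶻ s g ⌋)
starQuad s t = record
  { ray = λ g → ⟦ rayForm s g ⟧
  ; side = λ g → ⟦ sideForm s g ⟧
  ; ray-hub = λ g → value-zero (rayForm s g) _ (proj₁ (tests g))
  ; ray-corner = λ g → value-zero (rayForm s g) _ (proj₁ (t₁ g))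
  ; ray-before = λ g → value-pos (rayForm s g) _ (proj₁ (t₂ g))
  ; ray-after = λ g → value-neg (rayForm s g) _ (proj₁ (t₃ g))
  ; side-hub = λ g → value-zero (sideForm s g) _ (proj₁ (t₄ g))
  ; side-near = λ g → value-pos (sideForm s g) _ (proj₁ (t₅ g)) , value-pos (sideForm s g) _ (proj₁ (t₆ g))
  ; side-far = λ g → value-neg (sideForm s g) _ (proj₁ (t₇ g)) , value-neg (sideForm s g) _ (proj₂ (t₇ g))
  }
  where
  tests = λ g → ∧-T (every-T (starTestAt s) t g)
  t₁ = λ g → ∧-T (proj₂ (tests g))
  t₂ = λ g → ∧-T (proj₂ (t₁ g))
  t₃ = λ g → ∧-T (proj₂ (t₂ g))
  t₄ = λ g → ∧-T (proj₂ (t₃ g))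
  t₅ = λ g → ∧-T (proj₂ (t₄ g))
  t₆ = λ g → ∧-T (proj₂ (t₅ g))
  t₇ = λ g → ∧-T (proj₂ (t₆ g))

-- The vertices carrying connections: corners of copies, and the hub of the outer wheel.
data Anchor (N : ℕ) : Set where
  corner : Fin N → Fin 4 → Anchor N
  apex   : Anchor N

sameAnchor : ∀ {N} → Anchor N → Anchor N → Bool
sameAnchor (corner i g) (corner i' g') = does (g ≟ g') ∧ does (i ≟ i')
sameAnchor apex apex = true
sameAnchor _ _ = false

does-≡ : ∀ {n} {i j : Fin n} → T (does (i ≟ j)) → i ≡ j
does-≡ {i = i} {j} t with i ≟ j
... | yes p = p

sameAnchor-≡ : ∀ {N} (b b' : Anchor N) → T (sameAnchor b b') → b ≡ b'
sameAnchor-≡ (corner i g) (corner i' g') t = cong₂ corner (does-≡ (proj₂ (∧-T t))) (does-≡ (proj₁ (∧-T {does (g ≟ g')} t)))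
sameAnchor-≡ apex apex t = refl

Link : ℕ → Set
Link N = Anchor N × Anchor N

record Layout (N : ℕ) : Set where
  field
    shapes : Fin N → Shape
    apexᶻ  : Ptℤ
    links  : List (Link N)

  anchorᶻ : Anchor N → Ptℤ
  anchorᶻ (corner i g) = cornerᶻ (shapes i) g
  anchorᶻ apex         = apexᶻ

  onLink : Link N → Anchor N → Bool
  onLink (b , b') v = sameAnchor v b ∨ sameAnchor v b'

  onCopy : Fin N → Anchor N → Bool
  onCopy i (corner i' g) = does (i ≟ i')
  onCopy i apex          = false

  sideTest : Form → (Anchor N → Bool) → Anchor N → Bool
  sideTest f shared b = positive? (value f (anchorᶻ b)) ∨ (zero? (value f (anchorᶻ b)) ∧ shared b)

  copySide : Form → (Anchor N → Bool) → Fin N → Bool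
  copySide f shared i = positive? (value f (hubᶻ (shapes i))) ∧ every 4 (λ g → sideTest f shared (corner i g))

  linkSide : Form → (Anchor N → Bool) → Link N → Bool
  linkSide f shared (b , b') = sideTest f shared b ∧ sideTest f shared b'

  nothing : Anchor N → Bool
  nothing _ = false

  opaque
    -- Disjoint convex polygons are separated by a line parallel to a side of one of them; the shift
    -- keeps the corners on that side off the line.
    copiesCandidates : Fin N → Fin N → List Form
    copiesCandidates i i' = map above (edgeForms (shapes i)) ++ map (λ f → below (negate f)) (edgeForms (shapes i'))

    -- The candidates correspond to the number of common ends. If there are two, the line of the
    -- link itself is tried; if none, this line or a side of the copy, shifted; if one, a line that
    -- meets the copy only in that corner.
    copyLinkCandidates : Fin N → Link N → List Form
    copyLinkCandidates i (b , b') = towards (hubᶻ (shapes i)) line ∷ below (towards (hubᶻ (shapes i)) line) ∷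
      map above (edgeForms (shapes i)) ++
      concatMap (λ f → concatMap (λ f' → tilt f f' (anchorᶻ b) ∷ tilt f f' (anchorᶻ b') ∷ [])
                          (edgeForms (shapes i))) (edgeForms (shapes i))
      where
      line : Form
      line = through (anchorᶻ b) (anchorᶻ b')
      tilt : Form → Form → Ptℤ → Form
      -- For two adjacent sides this line passes through their common corner, and it is positive on
      -- the rest of a convex copy. The weight of `f` is large enough to make the form negative at
      -- `p` whenever `f` is negative there.
      tilt f f' p = (ℤ.+ ℤ.∣ value f' p ∣ ℤ.+ + 1) ⊙ f ⊕ f'

    -- Links with a common end can only be separated by a line through it. The diagonal of the
    -- parallelogram spanned by them runs between them; if they point in opposite directions it
    -- degenerates, and a perpendicular takes its place.
    linksCandidates : Link N → Link N → List Form
    linksCandidates (b , b') (d , d') =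
      above (negate (towards z line)) ∷ below (towards x line') ∷
      split x y z w ++ split x y w z ++ split y x z w ++ split y x w z
      where
      x y z w : Ptℤ
      x = anchorᶻ b
      y = anchorᶻ b'
      z = anchorᶻ d
      w = anchorᶻ d'
      line line' : Form
      line = through x y
      line' = through z w
      _−_ : Ptℤ → Ptℤ → Ptℤ
      (a , b) − (c , d) = a ℤ.- c , b ℤ.- d
      _＋_ : Ptℤ → Ptℤ → Ptℤ
      (a , b) ＋ (c , d) = a ℤ.+ c , b ℤ.+ d
      dot : Ptℤ → Ptℤ → Form
      dot (px , py) (ux , uy) = ux , uy , ℤ.- (ux ℤ.* px ℤ.+ uy ℤ.* py)
      -- lines through the common end p of the segments p q and p' r
      split : Ptℤ → Ptℤ → Ptℤ → Ptℤ → List Form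
      split p q p' r = if zero? (proj₁ (p − p')) ∧ zero? (proj₂ (p − p'))
        then towards q (through p ((q ＋ r) − p)) ∷ dot p (q − p) ∷ []
        else []

  copiesTest : Fin N → Fin N → Form → Bool
  copiesTest i i' f = copySide f nothing i ∧ copySide (negate f) nothing i'

  copyLinkTest : Fin N → Link N → Form → Bool
  copyLinkTest i e f = copySide f (onLink e) i ∧ linkSide (negate f) (onCopy i) e

  linksTest : Link N → Link N → Form → Bool
  linksTest e e' f = linkSide f (onLink e') e ∧ linkSide (negate f) (onLink e) e'

  distinctTest : Link N → Bool
  distinctTest (b , b') = not (samePoint (anchorᶻ b) (anchorᶻ b'))

  ascending : ∀ {n} → Fin n → Fin n → Bool → Bool
  ascending i j b = if toℕ i ℕ.<ᵇ toℕ j then b else true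

  copiesTests : Fin N → Fin N → Bool
  copiesTests i i' = ascending i i' (any (copiesTest i i') (copiesCandidates i i'))

  copyLinkTests : Fin N → Link N → Bool
  copyLinkTests i e = any (copyLinkTest i e) (copyLinkCandidates i e)

  linksTests : Link N → Link N → Bool
  linksTests e e' = any (linksTest e e') (linksCandidates e e')

  shapesOK copiesOK copyLinksOK linksOK distinctOK : Bool
  shapesOK    = every N (λ i → starTest (shapes i))
  copiesOK    = every N (λ i → every N (copiesTests i))
  copyLinksOK = every N (λ i → allOf (copyLinkTests i) links)
  linksOK     = pairwise linksTests links
  distinctOK  = allOf distinctTest links

  layoutTest : Bool
  layoutTest = shapesOK ∧ copiesOK ∧ copyLinksOK ∧ linksOK ∧ distinctOK

-- Soundness of the planarity test

any-T : {A : Set} (p : A → Bool) (xs : List A) → T (any p xs) → ∃ λ x → T (p x)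
any-T p (x ∷ xs) t with ∨-T {p x} t
... | inj₁ q = x , q
... | inj₂ q = any-T p xs q

record Frame (n : ℕ) : Set where
  constructor frame
  field
    {w x y z} : Fin n
    quad      : Quad w x y z
open Frame using (quad)

module LayoutGraph {N : ℕ} (L : Layout N) {n : ℕ} (frames : Fin N → Frame n) where
  open Layout L

  V : Set
  V = Vtx N n

  pos : V → Pt
  pos (loc (i , j)) = Wheel.locPoint (quad (frames i)) ⌊ hubᶻ (shapes i) ⌋ (λ g → ⌊ cornerᶻ (shapes i) g ⌋) j
  pos (hub i)       = ⌊ hubᶻ (shapes i) ⌋
  pos outer         = ⌊ apexᶻ ⌋

  place : Anchor N → V
  place (corner i g) = loc (i , Wheel.corner (quad (frames i)) g)
  place apex         = outer

  InCopy : Fin N → V → Set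
  InCopy i = InWheel (hub i) (λ j → loc (i , j))

  CopyEdge : Fin N → V → V → Set
  CopyEdge i = WheelEdge (hub i) (λ j → loc (i , j))

  OnLink : Link N → V → Set
  OnLink (b , b') v = v ≡ place b ⊎ v ≡ place b'

  LinkEdge : Link N → V → V → Set
  LinkEdge (b , b') u v = u ≡ place b × v ≡ place b'

  data LayoutEdge : V → V → Set where
    inCopy : ∀ {u v} i → CopyEdge i u v → LayoutEdge u v
    onLinkᴸ : ∀ {b b'} → (b , b') ∈ links → LayoutEdge (place b) (place b')

module LayoutDrawing {N : ℕ} (L : Layout N) (test : T (Layout.layoutTest L)) {n : ℕ} (frames : Fin N → Frame n) where
  open Layout L
  open LayoutGraph L frames public

  M : ℕ
  M = length links

  link : Fin M → Link N
  link = lookup links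

  private
    rest₁ : T (copiesOK ∧ copyLinksOK ∧ linksOK ∧ distinctOK)
    rest₁ = proj₂ (∧-T {shapesOK} test)
    rest₂ : T (copyLinksOK ∧ linksOK ∧ distinctOK)
    rest₂ = proj₂ (∧-T {copiesOK} rest₁)
    rest₃ : T (linksOK ∧ distinctOK)
    rest₃ = proj₂ (∧-T {copyLinksOK} rest₂)

    star : ∀ i → T (starTest (shapes i))
    star = every-T (λ i → starTest (shapes i)) (proj₁ (∧-T {shapesOK} test))

    distinct : ∀ e → T (distinctTest (link e))
    distinct e = allOf-∈ distinctTest {as = links} (proj₂ (∧-T {linksOK} rest₃)) (∈-lookup {xs = links} e)

    fromAscending : ∀ {n} (i j : Fin n) b → toℕ i ℕ.< toℕ j → T (ascending i j b) → T b
    fromAscending i j b i<j = lem (toℕ i ℕ.<ᵇ toℕ j) (ℕP.<⇒<ᵇ i<j)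
      where
      lem : ∀ c → T c → T (if c then b else true) → T b
      lem true _ t = t

    copies-form : ∀ i i' → toℕ i ℕ.< toℕ i' → ∃ λ f → T (copiesTest i i' f)
    copies-form i i' i<i' = any-T (copiesTest i i') (copiesCandidates i i') (fromAscending i i' (any (copiesTest i i') (copiesCandidates i i')) i<i'
      (every-T (copiesTests i) (every-T (λ i → every N (copiesTests i)) (proj₁ (∧-T {copiesOK} rest₁)) i) i'))

    copyLink-form : ∀ i e → ∃ λ f → T (copyLinkTest i (link e) f)
    copyLink-form i e = any-T (copyLinkTest i (link e)) (copyLinkCandidates i (link e))
      (allOf-∈ (copyLinkTests i) {as = links} (every-T (λ i → allOf (copyLinkTests i) links) (proj₁ (∧-T {copyLinksOK} rest₂)) i) (∈-lookup {xs = links} e))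

    links-form : ∀ e e' → toℕ e ℕ.< toℕ e' → ∃ λ f → T (linksTest (link e) (link e') f)
    links-form e e' e<e' = any-T (linksTest (link e) (link e')) (linksCandidates (link e) (link e'))
      (pairwise-lookup linksTests links (proj₁ (∧-T {linksOK} rest₃)) e e' e<e')

  open Drawing pos

  pos-place : ∀ b → pos (place b) ≡ ⌊ anchorᶻ b ⌋
  pos-place (corner i g) = Wheel.locPoint-corner (quad (frames i)) _ _ g
  pos-place apex         = refl

  private
    loc-injective : ∀ {i} {j j' : Fin n} → loc {N} (i , j) ≡ loc (i , j') → j ≡ j'
    loc-injective refl = refl

    hub≢loc : ∀ {i} (j : Fin n) → hub {N} i ≢ loc (i , j)
    hub≢loc _ ()

  module Copy (i : Fin N) = WheelDrawing pos (quad (frames i)) ⌊ hubᶻ (shapes i) ⌋ (λ g → ⌊ cornerᶻ (shapes i) g ⌋)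
    (starQuad (shapes i) (star i)) (hub i) (λ j → loc (i , j)) loc-injective hub≢loc refl (λ _ → refl)

  private
    onLink-sound : ∀ e b → T (onLink e b) → OnLink e (place b)
    onLink-sound (d , d') b t with ∨-T t
    ... | inj₁ s = inj₁ (cong place (sameAnchor-≡ b d s))
    ... | inj₂ s = inj₂ (cong place (sameAnchor-≡ b d' s))

    onCopy-sound : ∀ i b → T (onCopy i b) → InCopy i (place b)
    onCopy-sound i (corner i' g) t = subst (λ h → InCopy h (place (corner i' g))) (sym (does-≡ t)) (isLoc (Wheel.corner (quad (frames i')) g))

    side-sound : ∀ f {shared z₁ z₂ J} b → T (sideTest f shared b) →
      (T (shared b) → (place b ≡ z₁ ⊎ place b ≡ z₂) × J (place b)) → Side ⟦ f ⟧ z₁ z₂ J (place b)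
    side-sound f b t s with ∨-T t
    ... | inj₁ p = inside (subst (λ q → 0ℚ ℚ.< ev ⟦ f ⟧ q) (sym (pos-place b)) (value-pos f (anchorᶻ b) p))
    ... | inj₂ p = onLine (≡-trans (cong (ev ⟦ f ⟧) (pos-place b)) (value-zero f (anchorᶻ b) (proj₁ (∧-T p))))
                     (proj₁ q) (proj₂ q)
      where q = s (proj₂ (∧-T p))

    copySide-sound : ∀ f shared {z₁ z₂ J} i → T (copySide f shared i) →
      (∀ b → T (shared b) → (place b ≡ z₁ ⊎ place b ≡ z₂) × J (place b)) →
      ∀ {v} → InCopy i v → Side ⟦ f ⟧ z₁ z₂ J v
    copySide-sound f shared i t s = Copy.wheelSide i ⟦ f ⟧ (value-pos f (hubᶻ (shapes i)) (proj₁ (∧-T t)))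
      (λ g → side-sound f {shared} (corner i g)
        (every-T (λ g → sideTest f shared (corner i g)) (proj₂ (∧-T {positive? (value f (hubᶻ (shapes i)))} t)) g) (s (corner i g)))

    linkSide-sound : ∀ f shared {z₁ z₂ J} e → T (linkSide f shared e) →
      (∀ b → OnLink e (place b) → T (shared b) → (place b ≡ z₁ ⊎ place b ≡ z₂) × J (place b)) →
      ∀ {v} → OnLink e v → Side ⟦ f ⟧ z₁ z₂ J v
    linkSide-sound f shared (b , b') t s (inj₁ refl) = side-sound f {shared} b (proj₁ (∧-T t)) (s b (inj₁ refl))
    linkSide-sound f shared (b , b') t s (inj₂ refl) =
      side-sound f {shared} b' (proj₂ (∧-T {sideTest f shared b} t)) (s b' (inj₂ refl))

    copies-separated : ∀ i i' → toℕ i ℕ.< toℕ i' → Separated (InCopy i) (InCopy i')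
    copies-separated i i' i<i' = record
      { f = ⟦ f ⟧ ; g = ⟦ negate f ⟧ ; z₁ = outer ; z₂ = outer
      ; opposite = ev-negate f
      ; left = copySide-sound f nothing i (proj₁ (∧-T t)) (λ _ ())
      ; right = copySide-sound (negate f) nothing i' (proj₂ (∧-T {copySide f nothing i} t)) (λ _ ())
      }
      where
      f = proj₁ (copies-form i i' i<i')
      t = proj₂ (copies-form i i' i<i')

    copy-link-separated : ∀ i e → Separated (InCopy i) (OnLink (link e))
    copy-link-separated i e = record
      { f = ⟦ f ⟧ ; g = ⟦ negate f ⟧ ; z₁ = place (proj₁ (link e)) ; z₂ = place (proj₂ (link e))
      ; opposite = ev-negate f
      ; left = copySide-sound f (onLink (link e)) i (proj₁ (∧-T t)) (λ b s → onLink-sound (link e) b s , onLink-sound (link e) b s)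
      ; right = linkSide-sound (negate f) (onCopy i) (link e) (proj₂ (∧-T {copySide f (onLink (link e)) i} t))
                  (λ b o s → o , onCopy-sound i b s)
      }
      where
      f = proj₁ (copyLink-form i e)
      t = proj₂ (copyLink-form i e)

    links-separated : ∀ e e' → toℕ e ℕ.< toℕ e' → Separated (OnLink (link e)) (OnLink (link e'))
    links-separated e e' e<e' = record
      { f = ⟦ f ⟧ ; g = ⟦ negate f ⟧ ; z₁ = place (proj₁ (link e)) ; z₂ = place (proj₂ (link e))
      ; opposite = ev-negate f
      ; left = linkSide-sound f (onLink (link e')) (link e) (proj₁ (∧-T t)) (λ b o s → o , onLink-sound (link e') b s)
      ; right = linkSide-sound (negate f) (onLink (link e)) (link e') (proj₂ (∧-T {linkSide f (onLink (link e')) (link e)} t))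
                  (λ b o s → onLink-sound (link e) b s , onLink-sound (link e) b s)
      }
      where
      f = proj₁ (links-form e e' e<e')
      t = proj₂ (links-form e e' e<e')

    InCell : Fin N ⊎ Fin M → V → Set
    InCell (inj₁ i) = InCopy i
    InCell (inj₂ e) = OnLink (link e)

    CellEdge : Fin N ⊎ Fin M → V → V → Set
    CellEdge (inj₁ i) = CopyEdge i
    CellEdge (inj₂ e) = LinkEdge (link e)

    cells-separated : ∀ c d → c ≡ d ⊎ Separated (InCell c) (InCell d)
    cells-separated (inj₁ i) (inj₁ i') with FinP.<-cmp i i'
    ... | tri< p _ _ = inj₂ (copies-separated i i' p)
    ... | tri≈ _ refl _ = inj₁ refl
    ... | tri> _ _ p = inj₂ (Separated-sym (copies-separated i' i p))
    cells-separated (inj₁ i) (inj₂ e) = inj₂ (copy-link-separated i e)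
    cells-separated (inj₂ e) (inj₁ i) = inj₂ (Separated-sym (copy-link-separated i e))
    cells-separated (inj₂ e) (inj₂ e') with FinP.<-cmp e e'
    ... | tri< p _ _ = inj₂ (links-separated e e' p)
    ... | tri≈ _ refl _ = inj₁ refl
    ... | tri> _ _ p = inj₂ (Separated-sym (links-separated e' e p))

    zero-sub : ∀ a → T (zero? (a ℤ.- a))
    zero-sub a = subst (λ z → T (zero? z)) (sym (ℤP.+-inverseʳ a)) tt

    samePoint-refl : ∀ p → T (samePoint p p)
    samePoint-refl (x , y) = T-∧ {zero? (x ℤ.- x)} (zero-sub x) (zero-sub y)
      where
      T-∧ : ∀ {a b} → T a → T b → T (a ∧ b)
      T-∧ {true} _ t = t

    ⌊⌋-injective : ∀ {p p'} → ⌊ p ⌋ ≡ ⌊ p' ⌋ → p ≡ p'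
    ⌊⌋-injective e = cong₂ _,_ (fromℤ-injective (cong proj₁ e)) (fromℤ-injective (cong proj₂ e))

    not-T : ∀ {a} → T a → ¬ T (not a)
    not-T {true} _ ()

    distinct-sound : ∀ e → T (distinctTest e) → pos (place (proj₁ e)) ≢ pos (place (proj₂ e))
    distinct-sound (b , b') t same =
      not-T {samePoint (anchorᶻ b) (anchorᶻ b')} (subst (λ p → T (samePoint (anchorᶻ b) p)) p≡p' (samePoint-refl (anchorᶻ b))) t
      where
      p≡p' : anchorᶻ b ≡ anchorᶻ b'
      p≡p' = ⌊⌋-injective (≡-trans (sym (pos-place b)) (≡-trans same (pos-place b')))

    linkPlanar : ∀ e → T (distinctTest e) → PlanarOn (OnLink e) (LinkEdge e)
    linkPlanar e@(b , b') t = record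
      { endpoints = λ { (p , q) → inj₁ p , inj₂ q }
      ; loopless = λ { (refl , refl) r → distinct-sound e t (cong pos r) }
      ; injective = λ { (inj₁ refl) (inj₁ refl) _ → refl ; (inj₂ refl) (inj₂ refl) _ → refl
                      ; (inj₁ refl) (inj₂ refl) r → ⊥-elim (distinct-sound e t r)
                      ; (inj₂ refl) (inj₁ refl) r → ⊥-elim (distinct-sound e t (sym r)) }
      ; avoids = λ { (refl , refl) (inj₁ r) a _ → ⊥-elim (a r) ; (refl , refl) (inj₂ r) _ a → ⊥-elim (a r) }
      ; disjoint = λ { (refl , refl) (refl , refl) a _ _ _ → ⊥-elim (a refl) }
      }

    cellPlanar : ∀ c → PlanarOn (InCell c) (CellEdge c)
    cellPlanar (inj₁ i) = Copy.wheelPlanar i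
    cellPlanar (inj₂ e) = linkPlanar (link e) (distinct e)

  layoutPlanar : ∀ {E b} → (b , apex) ∈ links → (∀ u v → E u v → LayoutEdge u v) → Planar V E
  layoutPlanar {b = b} apex∈ E⊆ = planar-on-all (glue cellPlanar cells-separated) covered (λ u v e → classify (E⊆ u v e))
    where
    classify : ∀ {u v} → LayoutEdge u v → ∃ λ c → CellEdge c u v
    classify (inCopy i e) = inj₁ i , e
    classify (onLinkᴸ {b} {b'} m) = inj₂ (Any.index m) , cong (λ l → place (proj₁ l)) (lookup-index m) , cong (λ l → place (proj₂ l)) (lookup-index m)
    covered : ∀ v → ∃ λ c → InCell c v
    covered (loc (i , j)) = inj₁ i , isLoc j
    covered (hub i) = inj₁ i , isHub
    -- The hub of the outer wheel belongs to no copy, so it needs a link that ends there.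
    covered outer = inj₂ (Any.index apex∈) , inj₂ (cong (λ l → place (proj₂ l)) (lookup-index apex∈))

-- Behaviour by exhaustive search

-- A core copy is used through the interacting tunnels, its ends 0, 1, 2, 3 being a, a', c, c' where
-- passing from a to a' closes c. A half copy is half of a 1-toggle with outer end 0 and inner end 1;
-- if a passage through it takes two tunnels, their other ends are 2 and 3.
data Kind : Set where
  core half : Kind

-- From idle, a core copy is shut by a passage through a and sent away by one through c; it may be possible
-- to go beyond from there through a. A half copy is ahead, behind, or between its two tunnels.
data State : Set where
  idle shut away beyond ahead behind between : State

code : State → ℕ
code idle    = 0
code shut    = 1
code away    = 2
code beyond  = 3
code ahead   = 4
code behind  = 5
code between = 6

code-injective : ∀ {σ τ} → code σ ≡ code τ → σ ≡ τ
code-injective {σ} {τ} e = ≡-trans (sym (decode-code σ)) (≡-trans (cong decode e) (decode-code τ))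
  where
  decode : ℕ → State
  decode 0 = idle
  decode 1 = shut
  decode 2 = away
  decode 3 = beyond
  decode 4 = ahead
  decode 5 = behind
  decode _ = between
  decode-code : ∀ σ → decode (code σ) ≡ σ
  decode-code idle    = refl
  decode-code shut    = refl
  decode-code away    = refl
  decode-code beyond  = refl
  decode-code ahead   = refl
  decode-code behind  = refl
  decode-code between = refl

-- `unknown` asserts nothing about the gadget, and a search that meets such a row fails. A
-- successful search therefore shows that the robot never comes to an entrance whose behaviour could
-- vary from gadget to gadget.
data Row : Set where
  unknown blocked : Row
  go : Fin 4 → State → Row

Table : Set
Table = Kind → State → Fin 4 → Row

Rule : Set
Rule = Kind × State × Fin 4 × Row

sameKind : Kind → Kind → Bool
sameKind core core = true
sameKind half half = true
sameKind _    _    = false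

sameKind-sound : ∀ k l → T (sameKind k l) → k ≡ l
sameKind-sound core core _ = refl
sameKind-sound half half _ = refl

matches : Kind → State → Fin 4 → Rule → Bool
matches k σ a (l , τ , b , _) = sameKind k l ∧ (code σ ℕ.≡ᵇ code τ) ∧ does (a ≟ b)

fromRules : List Rule → Table
fromRules []       k σ a = unknown
fromRules (r ∷ rs) k σ a = if matches k σ a r then proj₂ (proj₂ (proj₂ r)) else fromRules rs k σ a

fromRules-∈ : ∀ rs k σ a → fromRules rs k σ a ≡ unknown ⊎ (k , σ , a , fromRules rs k σ a) ∈ rs
fromRules-∈ [] k σ a = inj₁ refl
fromRules-∈ (r@(l , τ , b , o) ∷ rs) k σ a with matches k σ a r in eq
... | true = inj₂ (here (cong₂ _,_ (sameKind-sound k l (proj₁ (∧-T h)))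
      (cong₂ _,_ (code-injective (ℕP.≡ᵇ⇒≡ (code σ) (code τ) (proj₁ (∧-T h′)))) (cong (_, o) (does-≡ (proj₂ (∧-T {code σ ℕ.≡ᵇ code τ} h′)))))))
  where
  h = subst T (sym eq) tt
  h′ = proj₂ (∧-T {sameKind k l} h)
... | false with fromRules-∈ rs k σ a
...   | inj₁ e = inj₁ e
...   | inj₂ m = inj₂ (there m)

Place : ℕ → Set
Place N = Fin N × Fin 4

Conf : ℕ → Set
Conf N = Vec State N

Node : ℕ → Set
Node N = Place N × Conf N

record Design : Set where
  field
    N       : ℕ
    kinds   : Vec Kind N
    wires   : List (Place N × Place N)
    ports   : Vec (Place N) 4
    configs : Vec (Conf N) 3

samePlace : ∀ {N} → Place N → Place N → Bool
samePlace (i , a) (j , b) = does (a ≟ b) ∧ does (i ≟ j)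

sameConf : ∀ {N} → Conf N → Conf N → Bool
sameConf [] [] = true
sameConf (σ ∷ c) (τ ∷ d) = (code σ ℕ.≡ᵇ code τ) ∧ sameConf c d

sameNode : ∀ {N} → Node N → Node N → Bool
sameNode (p , c) (q , d) = samePlace p q ∧ sameConf c d

samePlace-sound : ∀ {N} (p q : Place N) → T (samePlace p q) → p ≡ q
samePlace-sound (i , a) (j , b) h = cong₂ _,_ (does-≡ (proj₂ (∧-T {does (a ≟ b)} h))) (does-≡ (proj₁ (∧-T {does (a ≟ b)} h)))

does-refl : ∀ {n} (i : Fin n) → T (does (i ≟ i))
does-refl i with i ≟ i
... | yes _ = tt
... | no p = p refl

samePlace-refl : ∀ {N} (p : Place N) → T (samePlace p p)
samePlace-refl (i , a) with does (a ≟ a) | does-refl a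
... | true | _ = does-refl i

sameConf-sound : ∀ {N} (c d : Conf N) → T (sameConf c d) → c ≡ d
sameConf-sound [] [] _ = refl
sameConf-sound (σ ∷ c) (τ ∷ d) h = cong₂ _∷_ (code-injective (ℕP.≡ᵇ⇒≡ (code σ) (code τ) (proj₁ (∧-T h))))
  (sameConf-sound c d (proj₂ (∧-T {code σ ℕ.≡ᵇ code τ} h)))

sameNode-sound : ∀ {N} (m n : Node N) → T (sameNode m n) → m ≡ n
sameNode-sound (p , c) (q , d) h = cong₂ _,_ (samePlace-sound p q (proj₁ (∧-T h))) (sameConf-sound c d (proj₂ (∧-T {samePlace p q} h)))

member : ∀ {N} → Node N → List (Node N) → Bool
member n []       = false
member n (m ∷ ms) = sameNode n m ∨ member n ms

member-∈ : ∀ {N} {n : Node N} ms → T (member n ms) → n ∈ ms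
member-∈ {n = n} (m ∷ ms) h with ∨-T {sameNode n m} h
... | inj₁ e = here (sameNode-sound n m e)
... | inj₂ e = there (member-∈ ms e)

module Search (table : Table) {N : ℕ} (kinds : Vec Kind N) (wires : List (Place N × Place N))
  (ports : Vec (Place N) 4) (configs : Vec (Conf N) 3) where

  row : Node N → Row
  row ((i , a) , c) = table (Vec.lookup kinds i) (Vec.lookup c i) a

  neighbours : List (Place N × Place N) → Node N → List (Node N)
  neighbours [] n = []
  neighbours ((p , q) ∷ ws) (l , c) =
    (if samePlace l p then (q , c) ∷ [] else []) ++ (if samePlace l q then (p , c) ∷ [] else []) ++ neighbours ws (l , c)

  crossings : Row → Node N → List (Node N)
  crossings (go b τ) ((i , a) , c) = ((i , b) , c [ i ]≔ τ) ∷ []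
  crossings _        n             = []

  successors : Node N → List (Node N)
  successors n = crossings (row n) n ++ neighbours wires n

  isKnown : Row → Bool
  isKnown unknown = false
  isKnown _       = true

  explore : ℕ → List (Node N) → List (Node N) → List (Node N)
  explore zero       queue    seen = seen
  explore (suc fuel) []       seen = seen
  explore (suc fuel) (n ∷ ns) seen =
    if member n seen then explore fuel ns seen else explore fuel (successors n ++ ns) (n ∷ seen)

  -- A list that contains the start and is closed under successors contains everything reachable, in
  -- whatever way it was found. So the soundness of the test does not depend on how long the
  -- exploration runs.
  closed : List (Node N) → Bool
  closed K = allOf (λ n → isKnown (row n) ∧ allOf (λ m → member m K) (successors n)) K

  module _ (H : Fin 3 → Fin 4 → Fin 4 → Fin 3 → Bool) where

    port : Fin 4 → Place N
    port = Vec.lookup ports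

    config : Fin 3 → Conf N
    config = Vec.lookup configs

    exitAllowed : Fin 3 → Fin 4 → Fin 4 → Conf N → Bool
    exitAllowed q a b c =
      (does (a ≟ b) ∧ sameConf c (config q)) ∨ some 3 (λ q' → H q a b q' ∧ sameConf c (config q'))
      where
      some : ∀ n → (Fin n → Bool) → Bool
      some n p = not (every n (λ i → not (p i)))

    exitsAllowed : Fin 3 → Fin 4 → List (Node N) → Bool
    exitsAllowed q a = allOf (λ n → every 4 (λ b → if samePlace (proj₁ n) (port b) then exitAllowed q a b (proj₂ n) else true))

    exitsReached : Fin 3 → Fin 4 → List (Node N) → Bool
    exitsReached q a K = every 4 (λ b → every 3 (λ q' → if H q a b q' then member (port b , config q') K else true))

    reachTest : Fin 3 → Fin 4 → List (Node N) → Bool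
    reachTest q a K = member (port a , config q) K ∧ closed K ∧ exitsAllowed q a K ∧ exitsReached q a K

    portsDistinct : Bool
    portsDistinct = every 4 (λ a → every 4 (λ b → does (a ≟ b) ∨ not (samePlace (port a) (port b))))

    behaviourTest : ℕ → Bool
    behaviourTest fuel = portsDistinct ∧
      every 3 (λ q → every 4 (λ a → reachTest q a (explore fuel ((port a , config q) ∷ []) [])))

-- From the search to the behaviour of the gadget

record Model (G : Gadget) (table : Table) : Set where
  field
    location     : Kind → Fin 4 → Fin (nLoc G)
    location-inj : ∀ k {a b} → location k a ≡ location k b → a ≡ b
    state        : State → Fin (nState G)
    blocked-row  : ∀ k σ a → table k σ a ≡ blocked → ∀ b τ → ¬ Trans G (state σ) (location k a) b τ
    go-row       : ∀ k σ a b τ → table k σ a ≡ go b τ → Trans G (state σ) (location k a) (location k b) (state τ)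

Valid : (G : Gadget) → (Kind → Fin 4 → Fin (nLoc G)) → (State → Fin (nState G)) → Rule → Set
Valid G location state (k , σ , a , unknown) = ⊤
Valid G location state (k , σ , a , blocked) = ∀ b τ → ¬ Trans G (state σ) (location k a) b τ
Valid G location state (k , σ , a , go b τ)  = Trans G (state σ) (location k a) (location k b) (state τ)

ruleModel : (G : Gadget) (location : Kind → Fin 4 → Fin (nLoc G)) → (∀ k {a b} → location k a ≡ location k b → a ≡ b) →
            (state : State → Fin (nState G)) → ∀ {rs} → All (Valid G location state) rs → Model G (fromRules rs)
ruleModel G location inj state {rs} valid = record
  { location = location ; location-inj = inj ; state = state
  ; blocked-row = λ k σ a e → found k σ a e (λ ())
  ; go-row = λ k σ a b τ e → found k σ a e (λ ())
  }
  where
  found : ∀ k σ a {r} → fromRules rs k σ a ≡ r → r ≢ unknown → Valid G location state (k , σ , a , r)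
  found k σ a refl known with fromRules-∈ rs k σ a
  ... | inj₁ e = ⊥-elim (known e)
  ... | inj₂ m = All.lookup valid m

module Realisation {G : Gadget} {table : Table} (M : Model G table) (det : Deterministic G) (D : Design) where
  open Model M
  open Design D
  open Search table kinds wires ports configs

  embed : Place N → Fin N × Fin (nLoc G)
  embed (i , a) = i , location (Vec.lookup kinds i) a

  embed-injective : ∀ {p q} → embed p ≡ embed q → p ≡ q
  embed-injective {i , a} {j , b} e with cong proj₁ e
  ... | refl = cong (i ,_) (location-inj (Vec.lookup kinds i) (cong proj₂ e))

  sameLoc : Fin N × Fin (nLoc G) → Fin N × Fin (nLoc G) → Bool
  sameLoc (i , a) (j , b) = does (i ≟ j) ∧ does (a ≟ b)

  connected : List (Place N × Place N) → Fin N × Fin (nLoc G) → Fin N × Fin (nLoc G) → Bool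
  connected [] l m = false
  connected ((p , q) ∷ ws) l m = (sameLoc l (embed p) ∧ sameLoc m (embed q)) ∨ connected ws l m

  system : System G
  system = record { copies = N ; conn = connected wires }

  realise : Node N → Loc system × Config system
  realise (p , c) = embed p , Vec.map state c

  private
    sameLoc-sound : ∀ l m → T (sameLoc l m) → l ≡ m
    sameLoc-sound (i , a) (j , b) h = cong₂ _,_ (does-≡ (proj₁ (∧-T h))) (does-≡ (proj₂ (∧-T {does (i ≟ j)} h)))

    sameLoc-refl : ∀ l → T (sameLoc l l)
    sameLoc-refl (i , a) with does (i ≟ i) | does-refl i
    ... | true | _ = does-refl a

    T-∧ : ∀ {a b} → T a → T b → T (a ∧ b)
    T-∧ {true} _ h = h

    T-∨ʳ : ∀ a {b} → T b → T (a ∨ b)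
    T-∨ʳ true _ = tt
    T-∨ʳ false h = h

    T-∨ˡ : ∀ {a b} → T a → T (a ∨ b)
    T-∨ˡ {true} _ = tt

    if-∈ : ∀ {b} {m n : Node N} → T b → m ≡ n → m ∈ (if b then n ∷ [] else [])
    if-∈ {true} _ e = here e

    ∈-if : ∀ b {m n : Node N} → m ∈ (if b then n ∷ [] else []) → T b × m ≡ n
    ∈-if true (here e) = tt , e

  connected-wire : ∀ ws {l m} → T (connected ws l m) → ∃ λ p → ∃ λ q → (p , q) ∈ ws × l ≡ embed p × m ≡ embed q
  connected-wire ((p , q) ∷ ws) {l} {m} h with ∨-T {sameLoc l (embed p) ∧ sameLoc m (embed q)} h
  ... | inj₁ e = p , q , here refl , sameLoc-sound l (embed p) (proj₁ (∧-T e)) , sameLoc-sound m (embed q) (proj₂ (∧-T {sameLoc l (embed p)} e))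
  ... | inj₂ e with connected-wire ws e
  ...   | p' , q' , m∈ , e₁ , e₂ = p' , q' , there m∈ , e₁ , e₂

  wire-connected : ∀ ws {p q} → (p , q) ∈ ws → T (connected ws (embed p) (embed q))
  wire-connected ((p , q) ∷ ws) (here refl) = T-∨ˡ (T-∧ {sameLoc (embed p) (embed p)} (sameLoc-refl (embed p)) (sameLoc-refl (embed q)))
  wire-connected ((p' , q') ∷ ws) {p} {q} (there m) = T-∨ʳ (sameLoc (embed p) (embed p') ∧ sameLoc (embed q) (embed q')) (wire-connected ws m)

  wire-neighbour : ∀ ws {p q c} → (p , q) ∈ ws → (q , c) ∈ neighbours ws (p , c)
  wire-neighbour ((p , q) ∷ ws) (here refl) = ∈-++⁺ˡ (if-∈ (samePlace-refl p) refl)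
  wire-neighbour ((p' , q') ∷ ws) {p} {q} {c} (there m) =
    ∈-++⁺ʳ (if samePlace p p' then (q' , c) ∷ [] else [])
      (∈-++⁺ʳ (if samePlace p q' then (p' , c) ∷ [] else []) (wire-neighbour ws m))

  wire-neighbour′ : ∀ ws {p q c} → (p , q) ∈ ws → (p , c) ∈ neighbours ws (q , c)
  wire-neighbour′ ((p , q) ∷ ws) {c = c} (here refl) =
    ∈-++⁺ʳ (if samePlace q p then (q , c) ∷ [] else []) (∈-++⁺ˡ (if-∈ (samePlace-refl q) refl))
  wire-neighbour′ ((p' , q') ∷ ws) {p} {q} {c} (there m) =
    ∈-++⁺ʳ (if samePlace q p' then (q' , c) ∷ [] else [])
      (∈-++⁺ʳ (if samePlace q q' then (p' , c) ∷ [] else []) (wire-neighbour′ ws m))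

  neighbour-wire : ∀ ws {n m} → m ∈ neighbours ws n →
    proj₂ m ≡ proj₂ n × ((proj₁ n , proj₁ m) ∈ ws ⊎ (proj₁ m , proj₁ n) ∈ ws)
  neighbour-wire ((p , q) ∷ ws) {l , c} h with ∈-++⁻ (if samePlace l p then (q , c) ∷ [] else []) h
  ... | inj₁ i with ∈-if (samePlace l p) i
  ...   | e , refl = refl , inj₁ (here (cong (_, q) (samePlace-sound l p e)))
  neighbour-wire ((p , q) ∷ ws) {l , c} h | inj₂ i with ∈-++⁻ (if samePlace l q then (p , c) ∷ [] else []) i
  ... | inj₁ j with ∈-if (samePlace l q) j
  ...   | e , refl = refl , inj₂ (here (cong (p ,_) (samePlace-sound l q e)))
  neighbour-wire ((p , q) ∷ ws) {l , c} h | inj₂ i | inj₂ j with neighbour-wire ws j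
  ...   | e , inj₁ k = e , inj₁ (there k)
  ...   | e , inj₂ k = e , inj₂ (there k)

  private
    row-state : ∀ i (c : Conf N) → Vec.lookup (Vec.map state c) i ≡ state (Vec.lookup c i)
    row-state i c = VecP.lookup-map i state c

    set-state : ∀ i (c : Conf N) τ → Vec.map state (c [ i ]≔ τ) ≡ Vec.map state c [ i ]≔ state τ
    set-state i c τ = VecP.map-[]≔ state c i

  -- By determinism a `go` row describes the only traversal from its entrance, and a `blocked` row
  -- excludes any. Different names may stand for the same state of the gadget; as each row is true
  -- of the state named, the step can still be read off the row of the given node.
  step-successor : ∀ n {m} → T (isKnown (row n)) → Step system (realise n) m → ∃ λ n' → n' ∈ successors n × m ≡ realise n'
  step-successor n@(l , c) known (walk p q C w) with connected-wire wires w
  ... | p' , q' , m∈ , e₁ , refl with embed-injective {l} {p'} e₁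
  ...   | refl = (q' , c) , ∈-++⁺ʳ (crossings (row n) n) (wire-neighbour wires m∈) , refl
  step-successor n@(l , c) known (walkBack p q C w) with connected-wire wires w
  ... | p' , q' , m∈ , refl , e₂ with embed-injective {l} {q'} e₂
  ...   | refl = (p' , c) , ∈-++⁺ʳ (crossings (row n) n) (wire-neighbour′ wires m∈) , refl
  step-successor n@((i , a) , c) known (traverse .i .(location (Vec.lookup kinds i) a) b τ C w)
    with row n in eq
  ... | blocked = ⊥-elim (blocked-row _ _ _ eq b τ (subst (λ σ → Trans G σ _ b τ) (row-state i c) w))
  ... | go b' τ' with det _ _ _ _ _ _ (subst (λ σ → Trans G σ _ b τ) (row-state i c) w) (go-row _ _ _ _ _ eq)
  ...   | refl , refl = ((i , b') , c [ i ]≔ τ') , ∈-++⁺ˡ {xs = ((i , b') , c [ i ]≔ τ') ∷ []} (here refl)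
                      , cong (_ ,_) (sym (set-state i c τ'))

  successor-reach : ∀ n {m} → m ∈ successors n → Reach system (realise n) (realise m)
  successor-reach n@((i , a) , c) m∈ with ∈-++⁻ (crossings (row n) n) m∈
  ... | inj₂ k with neighbour-wire wires k
  ...   | refl , inj₁ w = walk _ _ _ (wire-connected wires w) ◅ ε
  ...   | refl , inj₂ w = walkBack _ _ _ (wire-connected wires w) ◅ ε
  successor-reach n@((i , a) , c) m∈ | inj₁ k with row n in eq
  successor-reach n@((i , a) , c) m∈ | inj₁ (here refl) | go b τ =
    subst (λ C → Step system (realise n) ((i , location (Vec.lookup kinds i) b) , C)) (sym (set-state i c τ))
      (traverse i _ _ _ _ (subst (λ σ → Trans G σ _ _ _) (sym (row-state i c)) (go-row _ _ _ _ _ eq))) ◅ ε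

  Reached : Node N → Node N → Set
  Reached n m = Reach system (realise n) (realise m)

  explore-reach : ∀ n fuel queue seen → (∀ {m} → m ∈ queue → Reached n m) → (∀ {m} → m ∈ seen → Reached n m) →
                  ∀ {m} → m ∈ explore fuel queue seen → Reached n m
  explore-reach n zero queue seen q r m∈ = r m∈
  explore-reach n (suc fuel) [] seen q r m∈ = r m∈
  explore-reach n (suc fuel) (k ∷ ks) seen q r m∈ with member k seen
  ... | true = explore-reach n fuel ks seen (λ i → q (there i)) r m∈
  ... | false = explore-reach n fuel (successors k ++ ks) (k ∷ seen)
          (λ i → [ (λ j → q (here refl) ◅◅ successor-reach k j) , (λ j → q (there j)) ]′ (∈-++⁻ (successors k) i))
          (λ { (here refl) → q (here refl) ; (there i) → r i }) m∈

  closed-reach : ∀ K → T (closed K) → ∀ {n} → n ∈ K → ∀ {m} → Reach system (realise n) m → ∃ λ n' → n' ∈ K × m ≡ realise n'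
  closed-reach K h {n} n∈ ε = n , n∈ , refl
  closed-reach K h {n} n∈ (st ◅ rest)
    with allOf-∈ (λ n → isKnown (row n) ∧ allOf (λ m → member m K) (successors n)) h n∈
  ... | k with step-successor n (proj₁ (∧-T k)) st
  ...   | n' , n'∈ , refl = closed-reach K h
            (member-∈ K (allOf-∈ (λ m → member m K) {as = successors n} (proj₂ (∧-T {isKnown (row n)} k)) n'∈)) rest

  module _ (H : Fin 3 → Fin 4 → Fin 4 → Fin 3 → Bool) (fuel : ℕ) (test : T (behaviourTest H fuel)) where
    private
      K : Fin 3 → Fin 4 → List (Node N)
      K q a = explore fuel ((port H a , config H q) ∷ []) []

      tests : ∀ q a → T (reachTest H q a (K q a))
      tests q a = every-T (λ a → reachTest H q a (K q a))
        (every-T (λ q → every 4 (λ a → reachTest H q a (K q a))) (proj₂ (∧-T {portsDistinct H} test)) q) a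

      rest₁ : ∀ q a → T (closed (K q a) ∧ exitsAllowed H q a (K q a) ∧ exitsReached H q a (K q a))
      rest₁ q a = proj₂ (∧-T {member (port H a , config H q) (K q a)} (tests q a))

      rest₂ : ∀ q a → T (exitsAllowed H q a (K q a) ∧ exitsReached H q a (K q a))
      rest₂ q a = proj₂ (∧-T {closed (K q a)} (rest₁ q a))

      start∈ : ∀ q a → (port H a , config H q) ∈ K q a
      start∈ q a = member-∈ (K q a) (proj₁ (∧-T (tests q a)))

      T-if : ∀ {b c} → T b → T (if b then c else true) → T c
      T-if {true} _ h = h

      not-T : ∀ {a} → T (not a) → ¬ T a
      not-T {true} () _

      some-T : ∀ n (p : Fin n → Bool) → T (not (every n (λ i → not (p i)))) → ∃ λ i → T (p i)
      some-T (suc n) p h with p 0F in eq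
      ... | true = 0F , subst T (sym eq) tt
      ... | false with some-T n (λ i → p (fs i)) h
      ...   | i , k = fs i , k

    ports-injective : ∀ a b → embed (port H a) ≡ embed (port H b) → a ≡ b
    ports-injective a b e with ∨-T {does (a ≟ b)} (every-T (λ b → does (a ≟ b) ∨ not (samePlace (port H a) (port H b)))
        (every-T (λ a → every 4 (λ b → does (a ≟ b) ∨ not (samePlace (port H a) (port H b)))) (proj₁ (∧-T test)) a) b)
    ... | inj₁ k = does-≡ k
    ... | inj₂ k = ⊥-elim (not-T {samePlace (port H a) (port H b)} k
            (subst (λ p → T (samePlace (port H a) p)) (embed-injective {port H a} {port H b} e) (samePlace-refl (port H a))))

    moves-available : ∀ q a b q' → T (H q a b q') →
      Reach system (realise (port H a , config H q)) (realise (port H b , config H q'))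
    moves-available q a b q' h = explore-reach (port H a , config H q) fuel ((port H a , config H q) ∷ []) []
      (λ { (here refl) → ε }) (λ ())
      (member-∈ (K q a) (T-if h (every-T (λ q' → if H q a b q' then member (port H b , config H q') (K q a) else true)
        (every-T (λ b → every 3 (λ q' → if H q a b q' then member (port H b , config H q') (K q a) else true))
          (proj₂ (∧-T {exitsAllowed H q a (K q a)} (rest₂ q a))) b) q')))

    only-moves : ∀ q a b C → Reach system (realise (port H a , config H q)) (embed (port H b) , C) →
      (a ≡ b × C ≡ Vec.map state (config H q)) ⊎
      (Σ (Fin 3) λ q' → T (H q a b q') × C ≡ Vec.map state (config H q'))
    only-moves q a b C r with closed-reach (K q a) (proj₁ (∧-T (rest₁ q a))) (start∈ q a) r
    ... | (p , c) , n∈ , e with embed-injective {port H b} {p} (cong proj₁ e)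
    ...   | refl with ∨-T {does (a ≟ b) ∧ sameConf c (config H q)} allowed
      where
      allowed : T (exitAllowed H q a b c)
      allowed = T-if (samePlace-refl (port H b))
        (every-T (λ b → if samePlace p (port H b) then exitAllowed H q a b c else true)
          (allOf-∈ (λ n → every 4 (λ b → if samePlace (proj₁ n) (port H b) then exitAllowed H q a b (proj₂ n) else true))
            (proj₁ (∧-T (rest₂ q a))) n∈) b)
    ...     | inj₁ k = inj₁ (does-≡ (proj₁ (∧-T k)) ,
                ≡-trans (cong proj₂ e) (cong (Vec.map state) (sameConf-sound c (config H q) (proj₂ (∧-T {does (a ≟ b)} k)))))
    ...     | inj₂ k with some-T 3 (λ q' → H q a b q' ∧ sameConf c (config H q')) k
    ...       | q' , j = inj₂ (q' , proj₁ (∧-T j) ,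
                ≡-trans (cong proj₂ e) (cong (Vec.map state) (sameConf-sound c (config H q') (proj₂ (∧-T {H q a b q'} j)))))

-- Designs together with their drawings

Slots : Set
Slots = Kind → Fin 4 → Fin 4

record Drawn (D : Design) : Set where
  open Design D
  field
    slots  : Slots
    apexᵈ  : Ptℤ
    points : Vec (Ptℤ × Vec Ptℤ 4) N

module _ {D : Design} (P : Drawn D) where
  open Design D
  open Drawn P

  anchor : Place N → Anchor N
  anchor (i , a) = corner i (slots (Vec.lookup kinds i) a)

  layout : Layout N
  layout = record
    { shapes = λ i → shape (proj₁ (Vec.lookup points i)) (Vec.lookup (proj₂ (Vec.lookup points i)))
    ; apexᶻ = apexᵈ
    ; links = map (λ w → anchor (proj₁ w) , anchor (proj₂ w)) wires ++
              -- The rim and the spokes of the outer wheel are drawn in the same way as the wires.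
              map (λ a → anchor (Vec.lookup ports a) , anchor (Vec.lookup ports (next a))) (allFin 4) ++
              map (λ a → anchor (Vec.lookup ports a) , apex) (allFin 4)
    }

rimAdj-next : ∀ {x y : Fin 4} → RimAdj x y → y ≡ next x
rimAdj-next {0F} (inj₁ e) = FinP.toℕ-injective e
rimAdj-next {fs 0F} (inj₁ e) = FinP.toℕ-injective e
rimAdj-next {fs 1F} (inj₁ e) = FinP.toℕ-injective e
rimAdj-next {fs 2F} {y} (inj₁ e) = ⊥-elim (lem (toℕ y) e (FinP.toℕ<n y))
  where
  lem : ∀ m → m ≡ 4 → ¬ m ℕ.< 4
  lem _ refl (ℕ.s≤s (ℕ.s≤s (ℕ.s≤s (ℕ.s≤s ()))))
rimAdj-next {fs 2F} (inj₂ (_ , e)) = FinP.toℕ-injective e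
rimAdj-next {0F} (inj₂ (() , _))
rimAdj-next {fs 0F} (inj₂ (() , _))
rimAdj-next {fs 1F} (inj₂ (() , _))

module _ {G : Gadget} (det : Deterministic G) (D : Design) (P : Drawn D) (table : Table)
  (frames : Kind → Frame (nLoc G))
  (M : Model G table) (located : ∀ k a → Model.location M k a ≡ Wheel.corner (Frame.quad (frames k)) (Drawn.slots P k a))
  (H : Fin 3 → Fin 4 → Fin 4 → Fin 3 → Bool) (fuel : ℕ)
  (drawing : T (Layout.layoutTest (layout P))) (behaviour : T (Search.behaviourTest table (Design.kinds D) (Design.wires D) (Design.ports D) (Design.configs D) H fuel)) where
  open Design D
  open Drawn P
  open Realisation M det D

  private
    port′ : Fin 4 → Place N
    port′ = Vec.lookup ports

    module L = LayoutGraph (layout P) (λ i → frames (Vec.lookup kinds i))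

    place-anchor : ∀ p → L.place (anchor P p) ≡ loc (embed p)
    place-anchor (i , a) = cong (λ j → loc (i , j)) (sym (located (Vec.lookup kinds i) a))

    wireLinks rimLinks spokeLinks : List (Link N)
    wireLinks = map (λ w → anchor P (proj₁ w) , anchor P (proj₂ w)) wires
    rimLinks = map (λ a → anchor P (port′ a) , anchor P (port′ (next a))) (allFin 4)
    spokeLinks = map (λ a → anchor P (port′ a) , apex) (allFin 4)

    linkEdge : ∀ {b b' v v'} → (b , b') ∈ wireLinks ++ rimLinks ++ spokeLinks → L.place b ≡ v → L.place b' ≡ v' → L.LayoutEdge v v'
    linkEdge m refl refl = L.onLinkᴸ m

    layoutEdge : ∀ u v → SimEdge system 4 (λ a → embed (port′ a)) u v → L.LayoutEdge u v
    layoutEdge _ _ (rim i j j' e) = L.inCopy i (rimᵂ j j' e)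
    layoutEdge _ _ (spoke i j) = L.inCopy i (spokeᵂ j)
    layoutEdge _ _ (connection p q c) = wireEdge (connected-wire wires c)
      where
      wireEdge : (∃ λ p' → ∃ λ q' → (p' , q') ∈ wires × p ≡ embed p' × q ≡ embed q') → L.LayoutEdge (loc p) (loc q)
      wireEdge (p' , q' , m , e , e') = linkEdge (∈-++⁺ˡ (∈-map⁺ (λ w → anchor P (proj₁ w) , anchor P (proj₂ w)) m))
        (≡-trans (place-anchor p') (cong loc (sym e))) (≡-trans (place-anchor q') (cong loc (sym e')))
    layoutEdge _ _ (outerRim x y e) = linkEdge
      (∈-++⁺ʳ wireLinks (∈-++⁺ˡ (∈-map⁺ (λ a → anchor P (port′ a) , anchor P (port′ (next a))) (∈-allFin x))))
      (place-anchor (port′ x)) (≡-trans (place-anchor (port′ (next x))) (cong (λ a → loc (embed (port′ a))) (sym (rimAdj-next {x} {y} e))))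
    layoutEdge _ _ (outerSpoke x) = linkEdge (∈-++⁺ʳ wireLinks (∈-++⁺ʳ rimLinks (∈-map⁺ (λ a → anchor P (port′ a) , apex) (∈-allFin x))))
                   (place-anchor (port′ x)) refl

  assemble : PlanarSimulates G (record { nLoc = 4 ; nState = 3 ; trans = H })
  assemble = system , (λ a → embed (port′ a)) , (λ q → Vec.map (Model.state M) (Vec.lookup configs q))
    , ports-injective H fuel behaviour
    , LayoutDrawing.layoutPlanar (layout P) drawing (λ i → frames (Vec.lookup kinds i)) (∈-++⁺ʳ wireLinks (∈-++⁺ʳ rimLinks (∈-map⁺ (λ a → anchor P (port′ a) , apex) (∈-allFin 0F)))) layoutEdge
    , moves-available H fuel behaviour
    , only-moves H fuel behaviour

-- The systems and their drawings

-- Replace each of m copies of a gadget by the design D realising it.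
nest : (D : Design) (m : ℕ) → List ((Fin m × Fin 4) × (Fin m × Fin 4)) → Vec (Fin m × Fin 4) 4 →
       Vec (Vec (Fin 3) m) 3 → Design
nest D m joints ports′ states = record
  { N = m ℕ.* N
  ; kinds = Vec.concat (Vec.replicate m kinds)
  ; wires = concatMap (λ b → map (λ w → inside b (proj₁ w) , inside b (proj₂ w)) wires) (allFin m) ++
            map (λ w → join (proj₁ w) , join (proj₂ w)) joints
  ; ports = Vec.map join ports′
  ; configs = Vec.map (λ q → Vec.concat (Vec.map (Vec.lookup configs) q)) states
  }
  where
  open Design D
  inside : Fin m → Place N → Place (m ℕ.* N)
  inside b (i , a) = combine b i , a
  join : Fin m × Fin 4 → Place (m ℕ.* N)
  join (b , p) = inside b (Vec.lookup ports p)

wire : ∀ {N} (i : Fin N) (a : Fin 4) (j : Fin N) (b : Fin 4) → Place N × Place N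
wire i a j b = (i , a) , (j , b)

selfWires : ∀ {N} → Bool → List (Fin N) → List (Place N × Place N)
selfWires b is = if b then map (λ i → wire i 2F i 3F) is else []

twoLocks : Vec Kind 6
twoLocks = core ∷ core ∷ half ∷ half ∷ half ∷ half ∷ []

-- While the robot is outside, the two halves of a 1-toggle are in opposite phases; the half that is
-- `ahead` marks the end at which the tunnel can be entered next.
twoLockConfigs : Vec (Conf 6) 3
twoLockConfigs =
  (idle ∷ idle ∷ ahead  ∷ behind ∷ ahead  ∷ behind ∷ []) ∷
  (away ∷ shut ∷ behind ∷ ahead  ∷ ahead  ∷ behind ∷ []) ∷
  (shut ∷ away ∷ ahead  ∷ behind ∷ behind ∷ ahead  ∷ []) ∷ []

-- In this and the next two designs the first tunnel runs through c of copy 0 and then a of the other core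
-- copies, so that it shuts c there; the second tunnel runs through a of copy 0 and c of the others.
sameWay : Bool → Design
sameWay twoStep = record
  { N = 6
  ; kinds = twoLocks
  ; wires = wire (# 2) 1F (# 0) 2F ∷ wire (# 0) 3F (# 1) 0F ∷ wire (# 1) 1F (# 3) 1F ∷
            wire (# 4) 1F (# 0) 0F ∷ wire (# 0) 1F (# 1) 2F ∷ wire (# 1) 3F (# 5) 1F ∷
            selfWires twoStep (# 2 ∷ # 3 ∷ # 4 ∷ # 5 ∷ [])
  ; ports = (# 2 , 0F) ∷ (# 3 , 0F) ∷ (# 5 , 0F) ∷ (# 4 , 0F) ∷ []
  ; configs = twoLockConfigs
  }

oppositeWays : Bool → Design
oppositeWays twoStep = record
  { N = 6
  ; kinds = twoLocks
  ; wires = wire (# 2) 1F (# 0) 2F ∷ wire (# 0) 3F (# 1) 0F ∷ wire (# 1) 1F (# 3) 1F ∷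
            wire (# 4) 1F (# 1) 2F ∷ wire (# 1) 3F (# 0) 0F ∷ wire (# 0) 1F (# 5) 1F ∷
            selfWires twoStep (# 2 ∷ # 3 ∷ # 4 ∷ # 5 ∷ [])
  ; ports = (# 2 , 0F) ∷ (# 3 , 0F) ∷ (# 4 , 0F) ∷ (# 5 , 0F) ∷ []
  ; configs = twoLockConfigs
  }

threeLocks : Bool → Design
threeLocks twoStep = record
  { N = 7
  ; kinds = core ∷ core ∷ core ∷ half ∷ half ∷ half ∷ half ∷ []
  ; wires = wire (# 3) 1F (# 0) 2F ∷ wire (# 0) 3F (# 1) 0F ∷ wire (# 1) 1F (# 2) 0F ∷ wire (# 2) 1F (# 4) 1F ∷
            wire (# 5) 1F (# 2) 2F ∷ wire (# 2) 3F (# 1) 2F ∷ wire (# 1) 3F (# 0) 0F ∷ wire (# 0) 1F (# 6) 1F ∷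
            selfWires twoStep (# 3 ∷ # 4 ∷ # 5 ∷ # 6 ∷ [])
  ; ports = (# 3 , 0F) ∷ (# 5 , 0F) ∷ (# 4 , 0F) ∷ (# 6 , 0F) ∷ []
  ; configs =
      (idle ∷ idle ∷ idle ∷ ahead  ∷ behind ∷ ahead  ∷ behind ∷ []) ∷
      (away ∷ shut ∷ shut ∷ behind ∷ ahead  ∷ ahead  ∷ behind ∷ []) ∷
      (shut ∷ away ∷ away ∷ ahead  ∷ behind ∷ behind ∷ ahead  ∷ []) ∷ []
  }

-- In state S₁ the passage of one tunnel of a parallel toggle opens the other tunnel in the opposite sense.
-- By copies 0 and 1, either simulated tunnel can thus be left only by a robot that entered it. Inside there are
-- two junctions, joined by one passage in each direction; each tunnel uses one of these passages, which
-- shuts the entry of the other tunnel (copies 2 and 3).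
parallel⇒antiparallel : Design → Design
parallel⇒antiparallel D = nest D 4
  (((0F , a₁) , (3F , a₁)) ∷ ((1F , a₁) , (2F , a₂)) ∷
   ((3F , b₁) , (3F , b₂)) ∷ ((3F , b₂) , (2F , a₁)) ∷ ((3F , b₁) , (1F , a₂)) ∷
   ((2F , b₂) , (2F , b₁)) ∷ ((2F , b₁) , (3F , a₂)) ∷ ((2F , b₂) , (0F , a₂)) ∷ [])
  ((0F , b₁) ∷ (0F , b₂) ∷ (1F , b₁) ∷ (1F , b₂) ∷ [])
  ((stS₁ ∷ stS₁ ∷ stM ∷ stM ∷ []) ∷ (stS₂ ∷ stS₁ ∷ stS₁ ∷ stS₁ ∷ []) ∷ (stS₁ ∷ stS₂ ∷ stS₂ ∷ stS₂ ∷ []) ∷ [])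
  where
  a₁ b₁ a₂ b₂ : Fin 4
  a₁ = 0F
  b₁ = 1F
  b₂ = 2F
  a₂ = 3F

-- The four ends lead to one junction, and entering at either entry shuts the neighbouring wrong exit.
antiparallel⇒crossing : Design → Design
antiparallel⇒crossing D = nest D 2
  (((0F , b₁) , (0F , a₂)) ∷ ((1F , b₁) , (1F , a₂)) ∷ ((0F , b₁) , (1F , b₁)) ∷ [])
  ((0F , a₁) ∷ (1F , a₁) ∷ (1F , b₂) ∷ (0F , b₂) ∷ [])
  ((stM ∷ stM ∷ []) ∷ (stS₁ ∷ stS₂ ∷ []) ∷ (stS₂ ∷ stS₁ ∷ []) ∷ [])
  where
  a₁ b₁ a₂ b₂ : Fin 4
  a₁ = 0F
  b₁ = 1F
  a₂ = 2F
  b₂ = 3F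

-- The two tunnels cross twice.
crossing⇒parallel : Design → Design
crossing⇒parallel D = nest D 2
  (((0F , b₁) , (1F , a₁)) ∷ ((0F , b₂) , (1F , a₂)) ∷ [])
  ((0F , a₁) ∷ (1F , b₁) ∷ (1F , b₂) ∷ (0F , a₂) ∷ [])
  ((stM ∷ stM ∷ []) ∷ (stS₁ ∷ stS₁ ∷ []) ∷ (stS₂ ∷ stS₂ ∷ []) ∷ [])
  where
  a₁ b₁ a₂ b₂ : Fin 4
  a₁ = 0F
  a₂ = 1F
  b₁ = 2F
  b₂ = 3F

-- The half copies have a wire between their ends 2 and 3 even if a single passage makes the toggle.
-- The robot then never gets to these ends. Since in both cases the ends 0 and 1 are neighbours on
-- the copy, one drawing serves both kinds of toggle.
parallel→parallel parallel→antiparallel parallel→crossing : Design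
parallel→parallel     = sameWay true
parallel→antiparallel = parallel⇒antiparallel parallel→parallel
parallel→crossing     = antiparallel⇒crossing parallel→antiparallel

antiparallel→antiparallel antiparallel→crossing antiparallel→parallel : Design
antiparallel→antiparallel = oppositeWays false
antiparallel→crossing     = antiparallel⇒crossing antiparallel→antiparallel
antiparallel→parallel     = crossing⇒parallel antiparallel→crossing

-- If a and c cross, the two simulated tunnels cross once in every core copy. Two copies undo the
-- crossing, so the crossing toggle takes three. The versions differ in the half copies: the ends of
-- a single passage are opposite on the copy, while the outer ends of two successive passages are
-- neighbours.
crossing→parallelᵃ crossing→antiparallelᵃ crossing→crossingᵃ : Design
crossing→parallelᵃ     = sameWay false
crossing→antiparallelᵃ = oppositeWays false
crossing→crossingᵃ     = threeLocks false

crossing→parallelᵇ crossing→antiparallelᵇ crossing→crossingᵇ : Design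
crossing→parallelᵇ     = sameWay true
crossing→antiparallelᵇ = oppositeWays true
crossing→crossingᵇ     = threeLocks true

-- Hub and corners of a copy. The drawings below are projective images of one of the basic designs in a square,
-- placed in a drawing of the copies it replaces and rounded.
spot : (hx hy ax ay bx by cx cy dx dy : ℕ) → Ptℤ × Vec Ptℤ 4
spot hx hy ax ay bx by cx cy dx dy =
  (+ hx , + hy) , (+ ax , + ay) ∷ (+ bx , + by) ∷ (+ cx , + cy) ∷ (+ dx , + dy) ∷ []

-- The positions of the ends 0, 1, 2, 3 in the cyclic order of the copy.
slotsᴾ : Slots
slotsᴾ core = Vec.lookup (# 0 ∷ # 1 ∷ # 3 ∷ # 2 ∷ [])
slotsᴾ half = Vec.lookup (# 0 ∷ # 1 ∷ # 3 ∷ # 2 ∷ [])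

slotsᴬ : Slots
slotsᴬ core = Vec.lookup (# 0 ∷ # 1 ∷ # 2 ∷ # 3 ∷ [])
slotsᴬ half = Vec.lookup (# 0 ∷ # 1 ∷ # 3 ∷ # 2 ∷ [])

slotsˣᵃ : Slots
slotsˣᵃ core = Vec.lookup (# 0 ∷ # 2 ∷ # 1 ∷ # 3 ∷ [])
slotsˣᵃ half = Vec.lookup (# 0 ∷ # 2 ∷ # 1 ∷ # 3 ∷ [])

slotsˣᵇ : Slots
slotsˣᵇ core = Vec.lookup (# 0 ∷ # 2 ∷ # 1 ∷ # 3 ∷ [])
slotsˣᵇ half = Vec.lookup (# 0 ∷ # 1 ∷ # 2 ∷ # 3 ∷ [])

-- In every drawing the ports are the corners of a trapezoid with its shorter side on top. The hub
-- of the outer wheel is so far above it that the straight spokes to the lower ports pass beside the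
-- upper ones. The largest drawing is scaled by ten to leave room for rounding.
draw-parallel→parallel : Drawn parallel→parallel
draw-parallel→parallel = record { slots = slotsᴾ ; apexᵈ = + 500 , + 4000 ; points =
    spot 418 625  370 473  451 473  458 756  388 756 ∷
    spot 582 625  542 756  612 756  630 473  549 473 ∷
    spot 215 867  200 1000  316 855  225 780  193 870 ∷
    spot 785 867  800 1000  684 855  775 780  807 870 ∷
    spot 116 299  0 0  256 320  170 440  85 294 ∷
    spot 884 299  1000 0  744 320  830 440  915 294 ∷ [] }

draw-parallel→antiparallel : Drawn parallel→antiparallel
draw-parallel→antiparallel = record { slots = slotsᴾ ; apexᵈ = + 500 , + 4000 ; points =
    spot 500 932  566 928  568 936  432 936  434 928 ∷
    spot 500 952  428 947  425 957  575 957  572 947 ∷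
    spot 384 908  309 904  383 919  428 911  384 906 ∷
    spot 328 991  200 1000  351 971  398 986  323 996 ∷
    spot 616 908  691 904  617 919  572 911  616 906 ∷
    spot 672 991  800 1000  649 971  602 986  677 996 ∷
    spot 500 169  403 177  398 159  602 159  597 177 ∷
    spot 500 123  610 134  617 110  383 110  390 134 ∷
    spot 667 219  773 227  670 197  603 214  666 224 ∷
    spot 782 25  1000 0  737 77  666 38  793 12 ∷
    spot 333 219  227 227  330 197  397 214  334 224 ∷
    spot 218 25  0 0  263 77  334 38  207 12 ∷
    spot 628 475  645 455  652 471  610 495  598 479 ∷
    spot 645 503  622 510  631 521  664 498  659 487 ∷
    spot 490 422  333 417  546 468  543 424  473 409 ∷
    spot 633 555  615 577  624 543  643 543  635 557 ∷
    spot 644 383  671 357  654 424  628 400  642 373 ∷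
    spot 685 512  699 505  680 500  675 517  686 514 ∷
    spot 390 755  416 751  403 739  369 757  377 769 ∷
    spot 372 733  362 746  356 737  382 719  391 727 ∷
    spot 385 817  367 833  373 791  397 807  388 824 ∷
    spot 335 726  323 731  341 735  343 722  334 724 ∷
    spot 508 792  636 795  461 759  465 790  522 801 ∷
    spot 376 690  390 671  386 701  368 701  374 688 ∷ [] }

draw-parallel→crossing : Drawn parallel→crossing
draw-parallel→crossing = record { slots = slotsᴾ ; apexᵈ = + 5000 , + 40000 ; points =
    spot 3073 8137  3213 7971  3225 8016  2899 8340  2901 8273 ∷
    spot 3088 8270  2897 8431  2896 8516  3255 8129  3241 8075 ∷
    spot 2733 8267  2458 8475  2740 8350  2870 8163  2732 8250 ∷
    spot 2605 9152  2000 10000  2670 8883  2839 8825  2589 9220 ∷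
    spot 3297 7765  3421 7632  3305 7825  3213 7856  3295 7753 ∷
    spot 3450 8129  3636 7955  3399 8059  3327 8243  3462 8145 ∷
    spot 2587 3888  2323 3671  2297 3560  2813 4074  2812 4141 ∷
    spot 2563 3675  2815 3984  2817 3900  2225 3262  2260 3407 ∷
    spot 2968 4443  3148 4630  2962 4357  2844 4313  2970 4460 ∷
    spot 3061 3900  3333 4167  3016 4008  2875 3718  3072 3875 ∷
    spot 2112 3680  1667 3333  2088 3544  2324 3846  2116 3707 ∷
    spot 1531 2046  0 0  1761 2589  2020 2700  1471 1903 ∷
    spot 3040 5522  3060 5444  3082 5521  3017 5608  2983 5522 ∷
    spot 3088 5668  3050 5688  3072 5743  3118 5651  3103 5598 ∷
    spot 2705 5131  2222 4861  2866 5426  2834 5203  2654 5037 ∷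
    spot 3097 5906  3077 6010  3073 5846  3108 5852  3102 5918 ∷
    spot 3018 5119  3052 5032  3059 5309  2995 5174  3007 5069 ∷
    spot 3163 5728  3184 5705  3148 5673  3149 5744  3166 5739 ∷
    spot 2637 7128  2715 7074  2669 7005  2573 7172  2606 7245 ∷
    spot 2562 6993  2537 7097  2512 7042  2588 6884  2622 6935 ∷
    spot 2668 7581  2619 7738  2608 7410  2698 7485  2683 7623 ∷
    spot 2428 6980  2387 7034  2458 7041  2455 6946  2422 6969 ∷
    spot 2990 7230  3256 7122  2848 7081  2880 7274  3028 7269 ∷
    spot 2548 6693  2581 6552  2587 6756  2530 6770  2540 6681 ∷
    spot 6927 8137  6787 7971  6775 8016  7101 8340  7099 8273 ∷
    spot 6912 8270  7103 8431  7104 8516  6745 8129  6759 8075 ∷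
    spot 7267 8267  7542 8475  7260 8350  7130 8163  7268 8250 ∷
    spot 7395 9152  8000 10000  7330 8883  7161 8825  7411 9220 ∷
    spot 6703 7765  6579 7632  6695 7825  6787 7856  6705 7753 ∷
    spot 6550 8129  6364 7955  6601 8059  6673 8243  6538 8145 ∷
    spot 7413 3888  7677 3671  7703 3560  7187 4074  7188 4141 ∷
    spot 7437 3675  7185 3984  7183 3900  7775 3262  7740 3407 ∷
    spot 7032 4443  6852 4630  7038 4357  7156 4313  7030 4460 ∷
    spot 6939 3900  6667 4167  6984 4008  7125 3718  6928 3875 ∷
    spot 7888 3680  8333 3333  7912 3544  7676 3846  7884 3707 ∷
    spot 8469 2046  10000 0  8239 2589  7980 2700  8529 1903 ∷
    spot 6960 5522  6940 5444  6918 5521  6983 5608  7017 5522 ∷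
    spot 6912 5668  6950 5688  6928 5743  6882 5651  6897 5598 ∷
    spot 7295 5131  7778 4861  7134 5426  7166 5203  7346 5037 ∷
    spot 6903 5906  6923 6010  6927 5846  6892 5852  6898 5918 ∷
    spot 6982 5119  6948 5032  6941 5309  7005 5174  6993 5069 ∷
    spot 6837 5728  6816 5705  6852 5673  6851 5744  6834 5739 ∷
    spot 7363 7128  7285 7074  7331 7005  7427 7172  7394 7245 ∷
    spot 7438 6993  7463 7097  7488 7042  7412 6884  7378 6935 ∷
    spot 7332 7581  7381 7738  7392 7410  7302 7485  7317 7623 ∷
    spot 7572 6980  7613 7034  7542 7041  7545 6946  7578 6969 ∷
    spot 7010 7230  6744 7122  7152 7081  7120 7274  6972 7269 ∷
    spot 7452 6693  7419 6552  7413 6756  7470 6770  7460 6681 ∷ [] }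

draw-antiparallel→antiparallel : Drawn antiparallel→antiparallel
draw-antiparallel→antiparallel = record { slots = slotsᴬ ; apexᵈ = + 500 , + 4000 ; points =
    spot 418 625  451 473  370 473  388 756  458 756 ∷
    spot 582 625  542 756  612 756  630 473  549 473 ∷
    spot 215 867  200 1000  316 855  225 780  193 870 ∷
    spot 785 867  800 1000  684 855  775 780  807 870 ∷
    spot 884 299  1000 0  744 320  830 440  915 294 ∷
    spot 116 299  0 0  256 320  170 440  85 294 ∷ [] }

draw-antiparallel→crossing : Drawn antiparallel→crossing
draw-antiparallel→crossing = record { slots = slotsᴬ ; apexᵈ = + 500 , + 4000 ; points =
    spot 263 625  263 536  239 527  263 714  284 706 ∷
    spot 304 625  304 698  318 693  304 552  288 545 ∷
    spot 198 848  200 1000  245 804  198 761  186 860 ∷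
    spot 353 734  364 795  338 739  346 694  356 733 ∷
    spot 334 502  333 417  315 496  334 550  337 503 ∷
    spot 104 332  0 0  185 404  146 466  81 311 ∷
    spot 737 625  737 536  761 527  737 714  716 706 ∷
    spot 696 625  696 698  682 693  696 552  712 545 ∷
    spot 802 848  800 1000  755 804  802 761  814 860 ∷
    spot 647 734  636 795  662 739  654 694  644 733 ∷
    spot 666 502  667 417  685 496  666 550  663 503 ∷
    spot 896 332  1000 0  815 404  854 466  919 311 ∷ [] }

draw-antiparallel→parallel : Drawn antiparallel→parallel
draw-antiparallel→parallel = record { slots = slotsᴬ ; apexᵈ = + 500 , + 4000 ; points =
    spot 353 780  370 764  373 775  330 801  331 785 ∷
    spot 350 755  332 769  332 759  366 743  368 752 ∷
    spot 289 897  200 1000  302 842  321 860  285 913 ∷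
    spot 318 742  294 746  317 754  330 740  318 739 ∷
    spot 373 721  387 712  375 730  365 726  373 719 ∷
    spot 403 804  432 795  393 781  386 810  406 810 ∷
    spot 323 439  348 462  348 446  291 409  296 432 ∷
    spot 326 474  301 454  305 469  346 489  347 478 ∷
    spot 202 241  0 0  243 342  261 311  190 210 ∷
    spot 292 492  264 486  288 475  307 495  292 495 ∷
    spot 359 519  375 529  359 507  348 512  359 521 ∷
    spot 380 403  417 417  371 437  357 394  383 394 ∷
    spot 677 439  704 432  709 409  652 446  652 462 ∷
    spot 674 474  653 478  654 489  695 469  699 454 ∷
    spot 620 403  583 417  629 437  643 394  617 394 ∷
    spot 641 519  625 529  641 507  652 512  641 521 ∷
    spot 708 492  736 486  712 475  693 495  708 495 ∷
    spot 798 241  1000 0  757 342  739 311  810 210 ∷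
    spot 647 780  669 785  670 801  627 775  630 764 ∷
    spot 650 755  632 752  634 743  668 759  668 769 ∷
    spot 597 804  568 795  607 781  614 810  594 810 ∷
    spot 627 721  613 712  625 730  635 726  627 719 ∷
    spot 682 742  706 746  683 754  670 740  682 739 ∷
    spot 711 897  800 1000  698 842  679 860  715 913 ∷ [] }

draw-crossing→parallelᵃ : Drawn crossing→parallelᵃ
draw-crossing→parallelᵃ = record { slots = slotsˣᵃ ; apexᵈ = + 500 , + 4000 ; points =
    spot 418 625  370 473  388 756  458 756  451 473 ∷
    spot 582 625  549 473  542 756  612 756  630 473 ∷
    spot 261 924  200 1000  216 884  304 870  303 963 ∷
    spot 739 924  800 1000  784 884  696 870  697 963 ∷
    spot 148 185  0 0  107 268  235 294  192 96 ∷
    spot 852 185  1000 0  893 268  765 294  808 96 ∷ [] }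

draw-crossing→antiparallelᵃ : Drawn crossing→antiparallelᵃ
draw-crossing→antiparallelᵃ = record { slots = slotsˣᵃ ; apexᵈ = + 500 , + 4000 ; points =
    spot 418 625  458 756  388 756  370 473  451 473 ∷
    spot 582 625  549 473  630 473  612 756  542 756 ∷
    spot 261 924  200 1000  216 884  304 870  303 963 ∷
    spot 739 924  800 1000  784 884  696 870  697 963 ∷
    spot 852 185  1000 0  893 268  765 294  808 96 ∷
    spot 148 185  0 0  107 268  235 294  192 96 ∷ [] }

draw-crossing→crossingᵃ : Drawn crossing→crossingᵃ
draw-crossing→crossingᵃ = record { slots = slotsˣᵃ ; apexᵈ = + 500 , + 4000 ; points =
    spot 380 625  416 756  360 756  338 473  403 473 ∷
    spot 500 596  467 440  533 440  528 731  472 731 ∷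
    spot 620 625  584 756  640 756  662 473  597 473 ∷
    spot 261 924  200 1000  216 884  304 870  303 963 ∷
    spot 852 185  1000 0  893 268  765 294  808 96 ∷
    spot 739 924  800 1000  784 884  696 870  697 963 ∷
    spot 148 185  0 0  107 268  235 294  192 96 ∷ [] }

draw-crossing→parallelᵇ : Drawn crossing→parallelᵇ
draw-crossing→parallelᵇ = record { slots = slotsˣᵇ ; apexᵈ = + 500 , + 4000 ; points =
    spot 418 625  370 473  388 756  458 756  451 473 ∷
    spot 582 625  549 473  542 756  612 756  630 473 ∷
    spot 215 867  200 1000  316 855  225 780  193 870 ∷
    spot 785 867  800 1000  684 855  775 780  807 870 ∷
    spot 116 299  0 0  256 320  170 440  85 294 ∷
    spot 884 299  1000 0  744 320  830 440  915 294 ∷ [] }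

draw-crossing→antiparallelᵇ : Drawn crossing→antiparallelᵇ
draw-crossing→antiparallelᵇ = record { slots = slotsˣᵇ ; apexᵈ = + 500 , + 4000 ; points =
    spot 418 625  458 756  388 756  370 473  451 473 ∷
    spot 582 625  549 473  630 473  612 756  542 756 ∷
    spot 215 867  200 1000  316 855  225 780  193 870 ∷
    spot 785 867  800 1000  684 855  775 780  807 870 ∷
    spot 884 299  1000 0  744 320  830 440  915 294 ∷
    spot 116 299  0 0  256 320  170 440  85 294 ∷ [] }

draw-crossing→crossingᵇ : Drawn crossing→crossingᵇ
draw-crossing→crossingᵇ = record { slots = slotsˣᵇ ; apexᵈ = + 500 , + 4000 ; points =
    spot 380 625  416 756  360 756  338 473  403 473 ∷
    spot 500 596  467 440  533 440  528 731  472 731 ∷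
    spot 620 625  584 756  640 756  662 473  597 473 ∷
    spot 215 867  200 1000  316 855  225 780  193 870 ∷
    spot 884 299  1000 0  744 320  830 440  915 294 ∷
    spot 785 867  800 1000  684 855  775 780  807 870 ∷
    spot 116 299  0 0  256 320  170 440  85 294 ∷ [] }

-- The known transitions and the computed checks

lockRules : Bool → List Rule
lockRules open? =
  (core , idle , 0F , go 1F shut) ∷ (core , shut , 1F , go 0F idle) ∷
  (core , idle , 2F , go 3F away) ∷ (core , away , 3F , go 2F idle) ∷ (core , shut , 2F , blocked) ∷
  -- A robot that has used one tunnel and then tries the other one may come to a in the state
  -- `away`. Whether it can pass there depends on the gadget, so both answers are tabulated; if it
  -- passes, it is stopped at the next c.
  (if open? then (core , away , 0F , go 1F beyond) ∷ (core , beyond , 1F , go 0F away) ∷ []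
            else (core , away , 0F , blocked) ∷ [])

halfRules : Bool → List Rule
halfRules false =
  (half , ahead , 0F , go 1F behind) ∷ (half , behind , 1F , go 0F ahead) ∷ (half , behind , 0F , blocked) ∷ []
halfRules true =
  (half , ahead , 0F , go 2F between) ∷ (half , between , 2F , go 0F ahead) ∷
  (half , between , 3F , go 1F behind) ∷ (half , behind , 1F , go 3F between) ∷ (half , behind , 0F , blocked) ∷ []

table : (twoStep open? : Bool) → Table
table twoStep open? = fromRules (lockRules open? ++ halfRules twoStep)

-- 2000 steps are enough for the search to stop; an incomplete search would fail the test.
opaque
  behaves : Table → Design → (Fin 3 → Fin 4 → Fin 4 → Fin 3 → Bool) → Bool
  behaves table D H = Search.behaviourTest table kinds wires ports configs H 2000
    where open Design D

  isPlanar : ∀ {D} → Drawn D → Bool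
  isPlanar P = Layout.layoutTest (layout P)

  realisation : ∀ {G} → Deterministic G → ∀ {D} (P : Drawn D) table (frames : Kind → Frame (nLoc G)) (M : Model G table) →
    (∀ k a → Model.location M k a ≡ Wheel.corner (Frame.quad (frames k)) (Drawn.slots P k a)) →
    ∀ H → isPlanar P ≡ true → behaves table D H ≡ true →
    PlanarSimulates G (record { nLoc = 4 ; nState = 3 ; trans = H })
  realisation det {D} P table frames M located H drawing works =
    assemble det D P table frames M located H 2000 (subst T (sym drawing) tt) (subst T (sym works) tt)

opaque
  unfolding Layout.copiesCandidates Layout.copyLinkCandidates Layout.linksCandidates behaves

  works-parallel→parallel : ∀ twoStep open? → behaves (table twoStep open?) parallel→parallel (Gadget.trans parallelLocking2Toggle) ≡ true
  works-parallel→parallel false true = refl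
  works-parallel→parallel false false = refl
  works-parallel→parallel true true = refl
  works-parallel→parallel true false = refl

  planar-parallel→parallel : isPlanar draw-parallel→parallel ≡ true
  planar-parallel→parallel = refl

  works-parallel→antiparallel : ∀ twoStep open? → behaves (table twoStep open?) parallel→antiparallel (Gadget.trans antiparallelLocking2Toggle) ≡ true
  works-parallel→antiparallel false true = refl
  works-parallel→antiparallel false false = refl
  works-parallel→antiparallel true true = refl
  works-parallel→antiparallel true false = refl

  planar-parallel→antiparallel : isPlanar draw-parallel→antiparallel ≡ true
  planar-parallel→antiparallel = refl

  works-parallel→crossing : ∀ twoStep open? → behaves (table twoStep open?) parallel→crossing (Gadget.trans crossingLocking2Toggle) ≡ true
  works-parallel→crossing false true = refl
  works-parallel→crossing false false = refl
  works-parallel→crossing true true = refl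
  works-parallel→crossing true false = refl

  planar-parallel→crossing : isPlanar draw-parallel→crossing ≡ true
  planar-parallel→crossing = refl

  works-antiparallel→antiparallel : ∀ open? → behaves (table false open?) antiparallel→antiparallel (Gadget.trans antiparallelLocking2Toggle) ≡ true
  works-antiparallel→antiparallel true = refl
  works-antiparallel→antiparallel false = refl

  planar-antiparallel→antiparallel : isPlanar draw-antiparallel→antiparallel ≡ true
  planar-antiparallel→antiparallel = refl

  works-antiparallel→crossing : ∀ open? → behaves (table false open?) antiparallel→crossing (Gadget.trans crossingLocking2Toggle) ≡ true
  works-antiparallel→crossing true = refl
  works-antiparallel→crossing false = refl

  planar-antiparallel→crossing : isPlanar draw-antiparallel→crossing ≡ true
  planar-antiparallel→crossing = refl

  works-antiparallel→parallel : ∀ open? → behaves (table false open?) antiparallel→parallel (Gadget.trans parallelLocking2Toggle) ≡ true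
  works-antiparallel→parallel true = refl
  works-antiparallel→parallel false = refl

  planar-antiparallel→parallel : isPlanar draw-antiparallel→parallel ≡ true
  planar-antiparallel→parallel = refl

  works-crossing→parallelᵃ : ∀ open? → behaves (table false open?) crossing→parallelᵃ (Gadget.trans parallelLocking2Toggle) ≡ true
  works-crossing→parallelᵃ true = refl
  works-crossing→parallelᵃ false = refl

  planar-crossing→parallelᵃ : isPlanar draw-crossing→parallelᵃ ≡ true
  planar-crossing→parallelᵃ = refl

  works-crossing→antiparallelᵃ : ∀ open? → behaves (table false open?) crossing→antiparallelᵃ (Gadget.trans antiparallelLocking2Toggle) ≡ true
  works-crossing→antiparallelᵃ true = refl
  works-crossing→antiparallelᵃ false = refl

  planar-crossing→antiparallelᵃ : isPlanar draw-crossing→antiparallelᵃ ≡ true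
  planar-crossing→antiparallelᵃ = refl

  works-crossing→crossingᵃ : ∀ open? → behaves (table false open?) crossing→crossingᵃ (Gadget.trans crossingLocking2Toggle) ≡ true
  works-crossing→crossingᵃ true = refl
  works-crossing→crossingᵃ false = refl

  planar-crossing→crossingᵃ : isPlanar draw-crossing→crossingᵃ ≡ true
  planar-crossing→crossingᵃ = refl

  works-crossing→parallelᵇ : ∀ open? → behaves (table true open?) crossing→parallelᵇ (Gadget.trans parallelLocking2Toggle) ≡ true
  works-crossing→parallelᵇ true = refl
  works-crossing→parallelᵇ false = refl

  planar-crossing→parallelᵇ : isPlanar draw-crossing→parallelᵇ ≡ true
  planar-crossing→parallelᵇ = refl

  works-crossing→antiparallelᵇ : ∀ open? → behaves (table true open?) crossing→antiparallelᵇ (Gadget.trans antiparallelLocking2Toggle) ≡ true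
  works-crossing→antiparallelᵇ true = refl
  works-crossing→antiparallelᵇ false = refl

  planar-crossing→antiparallelᵇ : isPlanar draw-crossing→antiparallelᵇ ≡ true
  planar-crossing→antiparallelᵇ = refl

  works-crossing→crossingᵇ : ∀ open? → behaves (table true open?) crossing→crossingᵇ (Gadget.trans crossingLocking2Toggle) ≡ true
  works-crossing→crossingᵇ true = refl
  works-crossing→crossingᵇ false = refl

  planar-crossing→crossingᵇ : isPlanar draw-crossing→crossingᵇ ≡ true
  planar-crossing→crossingᵇ = refl

-- From an arbitrary gadget to a lock and a toggle

corner-injective : ∀ {n} {w x y z : Fin n} (q : Quad w x y z) g h → Wheel.corner q g ≡ Wheel.corner q h → g ≡ h
corner-injective {w = w} {x} {y} {z} q = inj
  where
  open Quad q
  ne : ∀ {j k} → at j ℕ.< at k → j ≢ k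
  ne lt refl = ℕP.<-irrefl refl lt
  w<y = ℕP.<-trans w<x x<y
  x<z = ℕP.<-trans x<y y<z
  w<z = ℕP.<-trans w<x x<z
  inj : ∀ g h → Wheel.corner q g ≡ Wheel.corner q h → g ≡ h
  inj 0F 0F _ = refl
  inj 0F 1F e = ⊥-elim (ne w<x e)
  inj 0F 2F e = ⊥-elim (ne w<y e)
  inj 0F 3F e = ⊥-elim (ne w<z e)
  inj 1F 0F e = ⊥-elim (ne w<x (sym e))
  inj 1F 1F _ = refl
  inj 1F 2F e = ⊥-elim (ne x<y e)
  inj 1F 3F e = ⊥-elim (ne x<z e)
  inj 2F 0F e = ⊥-elim (ne w<y (sym e))
  inj 2F 1F e = ⊥-elim (ne x<y (sym e))
  inj 2F 2F _ = refl
  inj 2F 3F e = ⊥-elim (ne y<z e)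
  inj 3F 0F e = ⊥-elim (ne w<z (sym e))
  inj 3F 1F e = ⊥-elim (ne x<z (sym e))
  inj 3F 2F e = ⊥-elim (ne y<z (sym e))
  inj 3F 3F _ = refl

involution-injective : {A : Set} (f : A → A) → (∀ a → f (f a) ≡ a) → ∀ {a b} → f a ≡ f b → a ≡ b
involution-injective f inv {a} {b} e = ≡-trans (sym (inv a)) (≡-trans (cong f e) (inv b))

slotsᴾ-involutive : ∀ k a → slotsᴾ k (slotsᴾ k a) ≡ a
slotsᴾ-involutive core = λ { 0F → refl ; 1F → refl ; 2F → refl ; 3F → refl }
slotsᴾ-involutive half = λ { 0F → refl ; 1F → refl ; 2F → refl ; 3F → refl }

slotsᴬ-involutive : ∀ k a → slotsᴬ k (slotsᴬ k a) ≡ a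
slotsᴬ-involutive core = λ { 0F → refl ; 1F → refl ; 2F → refl ; 3F → refl }
slotsᴬ-involutive half = λ { 0F → refl ; 1F → refl ; 2F → refl ; 3F → refl }

slotsˣᵃ-involutive : ∀ k a → slotsˣᵃ k (slotsˣᵃ k a) ≡ a
slotsˣᵃ-involutive core = λ { 0F → refl ; 1F → refl ; 2F → refl ; 3F → refl }
slotsˣᵃ-involutive half = λ { 0F → refl ; 1F → refl ; 2F → refl ; 3F → refl }

slotsˣᵇ-involutive : ∀ k a → slotsˣᵇ k (slotsˣᵇ k a) ≡ a
slotsˣᵇ-involutive core = λ { 0F → refl ; 1F → refl ; 2F → refl ; 3F → refl }
slotsˣᵇ-involutive half = λ { 0F → refl ; 1F → refl ; 2F → refl ; 3F → refl }

Goal : Gadget → Set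
Goal G = PlanarSimulates G parallelLocking2Toggle × PlanarSimulates G antiparallelLocking2Toggle ×
         PlanarSimulates G crossingLocking2Toggle

module _ {G : Gadget} (rev : Reversible G) (det : Deterministic G) where

  Loc′ St : Set
  Loc′ = Fin (nLoc G)
  St = Fin (nState G)

  Closed : St → Loc′ → Set
  Closed σ a = ∀ b τ → ¬ Trans G σ a b τ

  record Lock (a a' c c' : Loc′) : Set where
    field
      {σ σ' τ} : St
      pass     : Trans G σ a a' σ'
      open′    : Trans G σ c c' τ
      shut′    : Closed σ' c

  -- A passage that cannot be repeated; done in one copy and undone in another one, it makes a 1-toggle.
  record OneWay (w w' : Loc′) : Set where
    field
      {ξ η} : St
      once  : Trans G ξ w w' η
      stop  : Closed η w

  assign : St → St → St → St → St → St → St → State → St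
  assign s s' t u x y z idle = s
  assign s s' t u x y z shut = s'
  assign s s' t u x y z away = t
  assign s s' t u x y z beyond = u
  assign s s' t u x y z ahead = x
  assign s s' t u x y z behind = y
  assign s s' t u x y z between = z

  module Build {a a' c c' : Loc′} (lock : Lock a a' c c') (beyond? : (∃ λ υ → Trans G (Lock.τ lock) a a' υ) ⊎ Closed (Lock.τ lock) a) where
    open Lock lock

    open? : Bool
    open? = [ (λ _ → true) , (λ _ → false) ]′ beyond?

    υ : St
    -- If a is closed in τ, no rule mentions `beyond`, and τ only fills its place.
    υ = [ proj₁ , (λ _ → τ) ]′ beyond?

    lockValid : ∀ location ξ η ζ → location core 0F ≡ a → location core 1F ≡ a' → location core 2F ≡ c → location core 3F ≡ c' →
      All (Valid G location (assign σ σ' τ υ ξ η ζ)) (lockRules open?)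
    lockValid location ξ η ζ refl refl refl refl =
      pass ∷ rev _ _ _ _ pass ∷ open′ ∷ rev _ _ _ _ open′ ∷ shut′ ∷ past beyond?
      where
      past : (b : (∃ λ υ → Trans G τ a a' υ) ⊎ Closed τ a) → All (Valid G location (assign σ σ' τ ([ proj₁ , (λ _ → τ) ]′ b) ξ η ζ))
        (if [ (λ _ → true) , (λ _ → false) ]′ b then (core , away , 0F , go 1F beyond) ∷ (core , beyond , 1F , go 0F away) ∷ []
                      else (core , away , 0F , blocked) ∷ [])
      past (inj₁ (_ , e)) = e ∷ rev _ _ _ _ e ∷ []
      past (inj₂ e) = e ∷ []

    oneWayValid : ∀ location s s' t u z {w w'} (o : OneWay w w') → location half 0F ≡ w → location half 1F ≡ w' →
      All (Valid G location (assign s s' t u (OneWay.ξ o) (OneWay.η o) z)) (halfRules false)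
    oneWayValid location s s' t u z o refl refl = OneWay.once o ∷ rev _ _ _ _ (OneWay.once o) ∷ OneWay.stop o ∷ []

    -- In through c' and out through a' : from the state τ over σ to σ'.
    twoStepValid : ∀ location u → Closed σ' c' →
      location half 0F ≡ c' → location half 1F ≡ a' → location half 2F ≡ c → location half 3F ≡ a →
      All (Valid G location (assign σ σ' τ u τ σ' σ)) (halfRules true)
    twoStepValid location u stop refl refl refl refl =
      rev _ _ _ _ open′ ∷ open′ ∷ pass ∷ rev _ _ _ _ pass ∷ stop ∷ []

    framesOf : Frame (nLoc G) → Frame (nLoc G) → Kind → Frame (nLoc G)
    framesOf f g core = f
    framesOf f g half = g

    module _ (slots : Slots) (involutive : ∀ k a → slots k (slots k a) ≡ a) (coreFrame halfFrame : Frame (nLoc G)) where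

      location : Kind → Fin 4 → Loc′
      location k b = Wheel.corner (Frame.quad (framesOf coreFrame halfFrame k)) (slots k b)

      location-injective : ∀ k {b d} → location k b ≡ location k d → b ≡ d
      location-injective k e = involution-injective (slots k) (involutive k)
        (corner-injective (Frame.quad (framesOf coreFrame halfFrame k)) _ _ e)

      simulate : ∀ {twoStep} (state : State → St) → All (Valid G location state) (lockRules open?) →
        All (Valid G location state) (halfRules twoStep) →
        ∀ {D} (P : Drawn D) → Drawn.slots P ≡ slots → ∀ H →
        isPlanar P ≡ true → behaves (table twoStep open?) D H ≡ true →
        PlanarSimulates G (record { nLoc = 4 ; nState = 3 ; trans = H })
      simulate {twoStep} state lv hv {D} P refl H drawing works =
        realisation det P (table twoStep open?) (framesOf coreFrame halfFrame)
          (ruleModel G location location-injective state (AllP.++⁺ lv hv)) (λ _ _ → refl) H drawing works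

    -- The frame of the half copies is turned and reflected until the ends fit the fixed drawing:
    -- the order becomes c, c', a', a for a toggle made of one passage and c', a', a, c for one made
    -- of two, where c and a are joined.
    parallelGoal : Quad a a' c' c → OneWay c c' ⊎ Closed σ' c' → Goal G
    parallelGoal q (inj₁ o) =
        sim draw-parallel→parallel refl _ planar-parallel→parallel (works-parallel→parallel false open?)
      , sim draw-parallel→antiparallel refl _ planar-parallel→antiparallel (works-parallel→antiparallel false open?)
      , sim draw-parallel→crossing refl _ planar-parallel→crossing (works-parallel→crossing false open?)
      where
      sim = λ {D} → simulate slotsᴾ slotsᴾ-involutive (frame q) (frame (rotate (reverse q))) {false} _
        (lockValid _ (OneWay.ξ o) (OneWay.η o) σ refl refl refl refl) (oneWayValid _ σ σ' τ υ σ o refl refl) {D}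
    parallelGoal q (inj₂ h) =
        sim draw-parallel→parallel refl _ planar-parallel→parallel (works-parallel→parallel true open?)
      , sim draw-parallel→antiparallel refl _ planar-parallel→antiparallel (works-parallel→antiparallel true open?)
      , sim draw-parallel→crossing refl _ planar-parallel→crossing (works-parallel→crossing true open?)
      where
      sim = λ {D} → simulate slotsᴾ slotsᴾ-involutive (frame q) (frame (rotate (rotate (reverse q)))) {true} _
        (lockValid _ τ σ' σ refl refl refl refl) (twoStepValid _ υ h refl refl refl refl) {D}

    antiparallelGoal : Quad a a' c c' → OneWay a a' ⊎ OneWay c c' → Goal G
    antiparallelGoal q o =
        sim draw-antiparallel→parallel refl _ planar-antiparallel→parallel (works-antiparallel→parallel open?)
      , sim draw-antiparallel→antiparallel refl _ planar-antiparallel→antiparallel (works-antiparallel→antiparallel open?)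
      , sim draw-antiparallel→crossing refl _ planar-antiparallel→crossing (works-antiparallel→crossing open?)
      where
      sim : ∀ {D} (P : Drawn D) → Drawn.slots P ≡ slotsᴬ → ∀ H →
        isPlanar P ≡ true → behaves (table false open?) D H ≡ true →
        PlanarSimulates G (record { nLoc = 4 ; nState = 3 ; trans = H })
      sim = [ (λ o → simulate slotsᴬ slotsᴬ-involutive (frame q) (frame q) {false} _
                (lockValid _ (OneWay.ξ o) (OneWay.η o) σ refl refl refl refl) (oneWayValid _ σ σ' τ υ σ o refl refl))
            , (λ o → simulate slotsᴬ slotsᴬ-involutive (frame q) (frame (rotate (rotate q))) {false} _
                (lockValid _ (OneWay.ξ o) (OneWay.η o) σ refl refl refl refl) (oneWayValid _ σ σ' τ υ σ o refl refl)) ]′ o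

    crossingGoal : Quad a c a' c' → OneWay c c' ⊎ Closed σ' c' → Goal G
    crossingGoal q (inj₁ o) =
        sim draw-crossing→parallelᵃ refl _ planar-crossing→parallelᵃ (works-crossing→parallelᵃ open?)
      , sim draw-crossing→antiparallelᵃ refl _ planar-crossing→antiparallelᵃ (works-crossing→antiparallelᵃ open?)
      , sim draw-crossing→crossingᵃ refl _ planar-crossing→crossingᵃ (works-crossing→crossingᵃ open?)
      where
      sim = λ {D} → simulate slotsˣᵃ slotsˣᵃ-involutive (frame q) (frame (rotate q)) {false} _
        (lockValid _ (OneWay.ξ o) (OneWay.η o) σ refl refl refl refl) (oneWayValid _ σ σ' τ υ σ o refl refl) {D}
    crossingGoal q (inj₂ h) =
        sim draw-crossing→parallelᵇ refl _ planar-crossing→parallelᵇ (works-crossing→parallelᵇ open?)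
      , sim draw-crossing→antiparallelᵇ refl _ planar-crossing→antiparallelᵇ (works-crossing→antiparallelᵇ open?)
      , sim draw-crossing→crossingᵇ refl _ planar-crossing→crossingᵇ (works-crossing→crossingᵇ open?)
      where
      sim = λ {D} → simulate slotsˣᵇ slotsˣᵇ-involutive (frame q) (frame (rotate (reverse q))) {true} _
        (lockValid _ τ σ' σ refl refl refl refl) (twoStepValid _ υ h refl refl refl refl) {D}

  -- Finding a lock and a toggle among the states

  module _ {k : ℕ} (tun : KTunnel G k) where

    Opposite : Loc′ → Loc′ → Set
    Opposite a a' = partner tun a ≡ a' × partner tun a' ≡ a

    Opposite-sym : ∀ {a a'} → Opposite a a' → Opposite a' a
    Opposite-sym (p , q) = q , p

    passable? : ∀ {a a'} → Opposite a a' → ∀ σ → (∃ λ τ → Trans G σ a a' τ) ⊎ Closed σ a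
    passable? {a} {a'} (a→a' , _) σ with FinP.any? (λ τ → T? (Gadget.trans G σ a a' τ))
    ... | yes p = inj₁ p
    ... | no ¬p = inj₂ (λ b τ e → ¬p (τ , subst (λ b → Trans G σ a b τ) (≡-trans (inTunnel tun σ a b τ e) a→a') e))

    module _ {a a' c c' : Loc′} (A : Opposite a a') (C : Opposite c c')
             (lock : Lock a a' c c') where
      open Lock lock

      beyond? : (∃ λ υ → Trans G τ a a' υ) ⊎ Closed τ a
      beyond? = passable? A τ

      toggle : OneWay c c' ⊎ Closed σ' c'
      toggle = [ (λ e → inj₁ (record { once = rev _ _ _ _ (proj₂ e) ; stop = shut′ })) , inj₂ ]′ (passable? (Opposite-sym C) σ')

      -- Going on through a from σ', the robot either gets stuck or comes to a first state in which c is
      -- open again: otherwise it would return to σ, where c is open.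
      next-state : St → St
      next-state ρ = [ proj₁ , (λ _ → ρ) ]′ (passable? A ρ)

      iterate : ℕ → St
      iterate zero    = σ
      iterate (suc m) = next-state (iterate m)

      -- The transition is included because `next-state` stands still where a is closed.
      Stays : ℕ → Set
      Stays m = Trans G (iterate m) a a' (iterate (suc m)) × Closed (iterate (suc m)) c

      Outcome : Set
      Outcome = OneWay a a' ⊎ Lock a' a c c'

      next-trans : ∀ {ρ τ} → Trans G ρ a a' τ → Trans G ρ a a' (next-state ρ)
      next-trans {ρ} {τ} e with passable? A ρ
      ... | inj₁ (_ , p) = p
      ... | inj₂ h = ⊥-elim (h _ _ e)

      stays-0 : Stays 0
      stays-0 = e , subst (λ ρ → Closed ρ c) (proj₂ (det _ _ _ _ _ _ pass e)) shut′
        where e = next-trans pass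

      stays-suc : ∀ m → Stays m → Outcome ⊎ Stays (suc m)
      stays-suc m (e , h) with passable? A (iterate (suc m))
      ... | inj₂ stuck = inj₁ (inj₁ (record { once = e ; stop = stuck }))
      ... | inj₁ (ρ , p) with passable? C ρ
      -- c is open in `ρ` and closed one step earlier, so the step undone, which enters at a', shuts
      -- c.
      ...   | inj₁ (_ , q) = inj₁ (inj₂ (record { pass = rev _ _ _ _ p ; open′ = q ; shut′ = h }))
      ...   | inj₂ h' = inj₂ (p , h')

      stays : ∀ m → Outcome ⊎ (∀ j → j ℕ.< m → Stays j)
      stays zero = inj₂ (λ _ ())
      stays (suc zero) = inj₂ (λ { zero _ → stays-0 ; (suc _) (s≤s ()) })
      stays (suc (suc m)) with stays (suc m)
      ... | inj₁ o = inj₁ o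
      ... | inj₂ all with stays-suc m (all m ℕP.≤-refl)
      ...   | inj₁ o = inj₁ o
      ...   | inj₂ new = inj₂ extend
        where
        extend : ∀ j → j ℕ.< suc (suc m) → Stays j
        extend j (s≤s j≤) with ℕP.m≤n⇒m<n∨m≡n j≤
        ... | inj₁ j< = all j j<
        ... | inj₂ refl = new

      -- Passing through a can be undone and the way back is deterministic, so equal states have
      -- equal predecessors. A repetition can thus be traced back to the state σ at the start; but c
      -- is open in σ and closed in every later state of the sequence.
      no-return : ∀ {m} → (∀ j → j ℕ.< m → Stays j) → ∀ i d → i ℕ.+ suc d ℕ.≤ m → iterate i ≢ iterate (i ℕ.+ suc d)
      no-return all zero d d<m e = proj₂ (all d d<m) _ _ (subst (λ ρ → Trans G ρ c c' τ) e open′)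
      no-return all (suc i) d i+d<m e = no-return all i d (ℕP.≤-trans (ℕP.n≤1+n _) i+d<m)
        (proj₂ (det _ _ _ _ _ _ (rev _ _ _ _ (proj₁ (all i i<m)))
          (subst (λ ρ → Trans G ρ a' a (iterate (i ℕ.+ suc d))) (sym e) (rev _ _ _ _ (proj₁ (all (i ℕ.+ suc d) i+d<m))))))
        where i<m = ℕP.≤-<-trans (ℕP.m≤m+n i (suc d)) i+d<m

      outcome : Outcome
      outcome with stays (nState G)
      ... | inj₁ o = o
      ... | inj₂ all with FinP.pigeonhole (ℕP.n<1+n (nState G)) (λ (i : Fin (suc (nState G))) → iterate (toℕ i))
      ...   | i , j , i<j , e = ⊥-elim (no-return all (toℕ i) (toℕ j ℕ.∸ suc (toℕ i))
                (subst (ℕ._≤ nState G) (sym j≡) (ℕP.≤-pred (FinP.toℕ<n j))) (≡-trans e (cong iterate (sym j≡))))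
        where
        j≡ : toℕ i ℕ.+ suc (toℕ j ℕ.∸ suc (toℕ i)) ≡ toℕ j
        j≡ = ≡-trans (ℕP.+-suc (toℕ i) _) (ℕP.m+[n∸m]≡n i<j)

    fromLock : ∀ {a a' c c'} → Opposite a a' → Opposite c c' → Lock a a' c c' → CyclicOrder a a' c c' → Goal G
    fromLock A C lock (parallel q) = Build.parallelGoal lock (beyond? A C lock) q (toggle A C lock)
    fromLock A C lock (crossing q) = Build.crossingGoal lock (beyond? A C lock) q (toggle A C lock)
    fromLock A C lock (antiparallel q) with toggle A C lock
    ... | inj₁ o = Build.antiparallelGoal lock (beyond? A C lock) q (inj₂ o)
    ... | inj₂ _ with outcome A C lock
    ...   | inj₁ o = Build.antiparallelGoal lock (beyond? A C lock) q (inj₁ o)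
    -- The order a, a', c, c' is turned into a', a, c', c, which is the parallel one once a' has
    -- taken the place of a.
    ...   | inj₂ lock' = Build.parallelGoal lock' (beyond? (Opposite-sym A) C lock') (rotate (rotate (rotate (reverse q))))
                           (toggle (Opposite-sym A) C lock')

    opposite : ∀ a → Opposite a (partner tun a)
    opposite a = refl , involutive tun a

    theLock : InteractingTunnels G tun →
      ∃ λ a → ∃ λ c → c ≢ a × c ≢ partner tun a × Lock a (partner tun a) c (partner tun c)
    theLock (s , a , b , s' , e , c , c≢a , c≢b , change) with inTunnel tun s a b s' e
    ... | refl = [ opens , shuts ]′ change
      where
      closed : ∀ {ρ} → ¬ Allowed G ρ c (partner tun c) → Closed ρ c
      closed {ρ} h b τ p = h (τ , subst (λ b → Trans G ρ c b τ) (inTunnel tun ρ c b τ p) p)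
      opens : Allowed G s c (partner tun c) × ¬ Allowed G s' c (partner tun c) → _
      opens (y , n) = a , c , c≢a , c≢b , record { pass = e ; open′ = proj₂ y ; shut′ = closed n }
      -- A transition that opens c shuts it when reversed, and the reversed passage starts at the
      -- partner of `a`.
      shuts : ¬ Allowed G s c (partner tun c) × Allowed G s' c (partner tun c) → _
      shuts (n , y) = partner tun a , c , c≢b , (λ h → c≢a (≡-trans h (involutive tun a)))
        , subst (λ a' → Lock (partner tun a) a' c (partner tun c)) (sym (involutive tun a))
            (record { pass = rev _ _ _ _ e ; open′ = proj₂ y ; shut′ = closed n })

    goal : InteractingTunnels G tun → Goal G
    goal i = fromLock (opposite a) (opposite c) lock
      (cyclicOrder a (p a) c (p c) (λ e → noFixed tun a (sym e)) (λ e → c≢a (sym e))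
        (λ e → c≢pa (≡-trans (sym (involutive tun c)) (cong p (sym e)))) (λ e → c≢pa (sym e))
        (λ e → c≢a (≡-trans (sym (involutive tun c)) (≡-trans (cong p (sym e)) (involutive tun a))))
        (λ e → noFixed tun c (sym e)))
      where
      p = partner tun
      l = theLock i
      a = proj₁ l
      c = proj₁ (proj₂ l)
      c≢a = proj₁ (proj₂ (proj₂ l))
      c≢pa = proj₁ (proj₂ (proj₂ (proj₂ l)))
      lock = proj₂ (proj₂ (proj₂ (proj₂ l)))

theorem2p9 : (G : Gadget) (k : ℕ) (t : KTunnel G k) →
    Reversible G → Deterministic G → InteractingTunnels G t →
    PlanarSimulates G parallelLocking2Toggle ×
    PlanarSimulates G antiparallelLocking2Toggle ×
    PlanarSimulates G crossingLocking2Toggle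
theorem2p9 G k t rev det = goal rev det t
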